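{- Let $p$ be an odd prime, $\alpha\geqslant1$, and $X\subseteq\mathbb{Z}_{p^\alpha}\setminus\{0\}$, $Y\subseteq\mathbb{Z}_{p^\alpha}$ with $0\in Y$. Then $Dih(p^\alpha,X,Y)$ is a (genuine) directed strongly regular graph with $X\subset Y$ and $Y\setminus X$ a union of some $\mathbb{Z}_{p^\alpha}^\ast$-orbits if and only if $Y=\psi_{\gamma}^{ -1}(H)$ and either $X=Y\setminus\{0\}$ or $X=Y\setminus p^\gamma\mathbb{Z}_{p^\alpha}$, for some $1\leqslant\gamma\leqslant\alpha$ and some subset $H\subseteq\mathbb{Z}_{p^\gamma}$ with $H\uplus(-H)=\mathbb{Z}_{p^\gamma}\uplus\{0\}$ (as multisets).
   Context: $D_n=\langle x,a\mid x^n=1,\ a^2=1,\ ax=x^{ -1}a\rangle$; for $X,Y\subseteq\mathbb{Z}_n$ with $0\notin X$, $Dih(n,X,Y)$ is the Cayley digraph on $D_n$ with connection set $\{x^i:i\in X\}\cup\{x^ja:j\in Y\}$ (arc $g\to h$ iff $g^{ -1}h$ lies in it). A DSRG with parameters $(n,k,\mu,\lambda,t)$: adjacency matrix $A$ with $AJ=JA=kJ$, $A^2=tI+\lambda A+\mu(J-I-A)$; DSRGs are required to be genuine ($0<t<k$). The unit group $\mathbb{Z}_{p^\alpha}^\ast$ acts on $\mathbb{Z}_{p^\alpha}$ by multiplication; its orbits are the sets of elements of a given additive order. $\psi_\gamma:\mathbb{Z}_{p^\alpha}\to\mathbb{Z}_{p^\gamma}$ is reduction mod $p^\gamma$; $p^\gamma\mathbb{Z}_{p^\alpha}$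 is the subgroup of multiples of $p^\gamma$; $\uplus$ is multiset union. -}

module Defs where

open import Data.Nat using (ℕ; zero; suc; _%_; _∸_; _≡ᵇ_)
import Data.Nat as ℕ
open import Data.Nat.DivMod using (m%n<n)
open import Data.Fin using (Fin; toℕ; fromℕ<)
open import Data.Fin.Subset using (Subset; Side; inside; outside)
open import Data.Bool using (Bool; true; false; if_then_else_; _xor_)
open import Data.Product using (_×_; _,_; Σ; ∃)
open import Data.List using (List; []; _∷_; map; allFin; cartesianProduct)
open import Data.Nat.ListAction using (sum)
open import Data.Product.Properties using (≡-dec)
open import Data.Vec using (lookup)
open import Data.Integer using (ℤ; +_) renaming (_+_ to _+ℤ_; _*_ to _*ℤ_; _-_ to _-ℤ_)
open import Relation.Binary.PropositionalEquality using (_≡_)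
open import Relation.Nullary using (Dec; yes; no; does)
open import Data.Fin.Subset using (_∈_)
open import Data.Fin.Properties using () renaming (_≟_ to _≟F_)
open import Data.Bool.Properties using () renaming (_≟_ to _≟B_)

_+ₘ_ : ∀ {n} → Fin n → Fin n → Fin n
_+ₘ_ {suc m} i j = fromℕ< (m%n<n (toℕ i ℕ.+ toℕ j) (suc m))

_*ₘ_ : ∀ {n} → Fin n → Fin n → Fin n
_*ₘ_ {suc m} i j = fromℕ< (m%n<n (toℕ i ℕ.* toℕ j) (suc m))

-ₘ_ : ∀ {n} → Fin n → Fin n
-ₘ_ {suc m} i = fromℕ< (m%n<n (suc m ∸ toℕ i) (suc m))

oneₘ : ∀ {n} → Fin n → Fin n      -- the element 1 of ℤ_n (argument only witnesses n ≠ 0)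
oneₘ {suc m} _ = fromℕ< (m%n<n 1 (suc m))

IsUnit : ∀ {n} → Fin n → Set
IsUnit u = ∃ λ v → u *ₘ v ≡ oneₘ u

_∈ℕ_ : ∀ {m} → ℕ → Subset m → Set
a ∈ℕ H = Σ (Fin _) λ h → (toℕ h ≡ a) × (h ∈ H)

-- a mod m  (m = 0 case irrelevant; only used with m = p^γ > 0)
_mod′_ : ℕ → ℕ → ℕ
a mod′ zero = a
a mod′ suc m = a % suc m

-- y ∈ ψ_γ⁻¹(H)  for y ∈ ℤ_{p^α}, H ⊆ ℤ_{p^γ}, where ψ_γ is reduction mod p^γ
InPreimage : ∀ {m n} → Subset m → Fin n → Set
InPreimage {m} H y = (toℕ y mod′ m) ∈ℕ H

[_]ₛ : Side → ℕ
[ inside ]ₛ = 1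
[ outside ]ₛ = 0

-- Dihedral group D_n = ⟨x,a | xⁿ = 1, a² = 1, a x = x⁻¹ a⟩.
-- The element (i , e) stands for xⁱ aᵉ  (e = false : aᵉ = 1, e = true : aᵉ = a).

D : ℕ → Set
D n = Fin n × Bool

_·_ : ∀ {n} → D n → D n → D n
(i , false) · (j , f) = (i +ₘ j , f)
(i , true)  · (j , f) = (i +ₘ (-ₘ j) , true xor f)

inv : ∀ {n} → D n → D n
inv (i , false) = (-ₘ i , false)
inv (i , true)  = (i , true)

InConn : ∀ {n} → Subset n → Subset n → D n → Bool
InConn X Y (i , false) = lookup X i
InConn X Y (j , true)  = lookup Y j

DihArc : ∀ {n} → Subset n → Subset n → D n → D n → Bool
DihArc X Y g h = InConn X Y (inv g · h)

allD : ∀ n → List (D n)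
allD n = cartesianProduct (allFin n) (false ∷ true ∷ [])

_≟D_ : ∀ {n} → (g h : D n) → Dec (g ≡ h)
_≟D_ = ≡-dec _≟F_ _≟B_

Σ[_]_ : ∀ {V : Set} → List V → (V → ℕ) → ℕ
Σ[ vs ] f = sum (map f vs)

𝟙 : Bool → ℕ
𝟙 true  = 1
𝟙 false = 0

-- A digraph with (finite) vertex list vs (each vertex exactly once),
-- decidable vertex equality and adjacency relation arc is a DSRG with
-- parameters (|vs|, k, μ, λ, t):  AJ = JA = kJ  and
-- A² = tI + λA + μ(J − I − A)  (entrywise, in ℤ), genuine: 0 < t < k.
IsDSRGWith : {V : Set} → List V → ((g h : V) → Dec (g ≡ h)) → (V → V → Bool)
           → (k μ λ' t : ℕ) → Set
IsDSRGWith vs eq arc k μ λ' t =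
  (0 ℕ.< t) × (t ℕ.< k) ×
  (∀ g → Σ[ vs ] (λ z → A g z) ≡ k) ×
  (∀ g → Σ[ vs ] (λ z → A z g) ≡ k) ×
  (∀ g h → + (Σ[ vs ] (λ z → A g z ℕ.* A z h))
           ≡ (+ t *ℤ + I g h) +ℤ (+ λ' *ℤ + A g h)
               +ℤ (+ μ *ℤ ((+ 1 -ℤ + I g h) -ℤ + A g h)))
  where
  A : _ → _ → ℕ
  A g h = 𝟙 (arc g h)
  I : _ → _ → ℕ
  I g h = 𝟙 (does (eq g h))

IsDSRG : {V : Set} → List V → ((g h : V) → Dec (g ≡ h)) → (V → V → Bool) → Set
IsDSRG vs eq arc = ∃ λ k → ∃ λ μ → ∃ λ λ' → ∃ λ t → IsDSRGWith vs eq arc k μ λ' t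

{-# OPTIONS --safe #-}
module Submission where

-- Subsets of ℤ_n become n-periodic 0/1-valued functions on ℤ, multiplied by convolution over a period.
-- Write x, y, z for the indicators of X, Y and Y∖X, y′(g) = y(−g), x′(g) = x(−g) and d = λ − μ. The
-- digraph is a DSRG iff x∗x + y∗y′ = (t−μ)δ + dx + μ and x∗y + y∗x′ = dy + μ. Subtracting the two
-- gives z∗z = (t−μ)δ − dz, so Y∖X is {0} or a subgroup of order −d. In both cases B = y + y′ − 1,
-- which takes values in {−1,0,1}, satisfies B∗B = sB + c, and equality in the Cauchy–Schwarz
-- inequality shows that B is constant on the cosets of R = {B = 1}; hence R is the subgroup generated
-- by some p^γ. On ℤ/p^γ, where again B∗B = sB + c, the values 0 and −1 cannot both occur: modulo p the
-- Frobenius map f ↦ f^(p^γ) sends f to its coefficient sum, so if p ∤ s one of B, B − sδ is constant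
-- modulo p, while if p ∣ s then B^p is constant modulo p and the sum of B over the subgroup of order
-- p, an odd number of absolute value below p, is divisible by p. As t < k rules out B ∈ {1,−1}, B is
-- the indicator of R, and y is R-periodic because R∗y = sy.

-- Characters of the cyclic group would diagonalise the equations but lead into cyclotomic rings;
-- with integer-valued periodic functions all arithmetic stays in ℤ and is reduced modulo p only
-- where Frobenius acts. The function B comes from the reflection equation: for w = x + x′ it reads
-- w∗y = dy + μ, reflecting it gives the same equation for y′, and w = B + 1 - 2z since Y∖X is
-- closed under the unit -1. Hence B∗B = 2 z∗B + dB + const, and the obstacle is the term z∗B. If
-- Y∖X = {0} it is B. If Y∖X is a subgroup, Cauchy-Schwarz must be applied once before any quadratic
-- equation is at hand, to see that B is invariant under Y∖X; only then is z∗B a multiple of B.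
-- Oddness of p enters twice: the values 1 and -1 must differ modulo p, and the subgroup of order p
-- must pair off as j and -j around 0. In the converse the product y∗y is unknown. It cancels,
-- because y′ = 1 + R - y makes it occur with opposite signs.

module Binomial where

  open import Algebra.Bundles using (CommutativeSemiring)
  open import Data.Nat as ℕ using (ℕ; zero; suc)
  import Data.Nat.Properties as ℕ
  import Data.Nat.Divisibility as ℕ
  open import Data.Nat.Combinatorics using (_C_; nCn≡1; nCk+nC[k+1]≡[n+1]C[k+1]; nC1≡n)
  open import Data.Nat.Primality using (Prime; euclidsLemma; prime⇒nonZero)
  open import Data.Nat.Tactic.RingSolver using () renaming (solve-∀ to solve-∀ℕ)
  open import Data.Fin as Fin using (Fin; toℕ; inject₁; fromℕ)
  open import Data.Fin.Properties using (toℕ-inject₁; toℕ-fromℕ; toℕ<n)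
  open import Data.Product using (_,_; ∃)
  open import Data.Sum using (inj₁; inj₂)
  open import Relation.Nullary using (contradiction)
  open import Relation.Binary.PropositionalEquality using (_≡_; refl; sym; trans; cong; cong₂; subst; module ≡-Reasoning)

  -- Binomial coefficients modulo a prime

  absorption : ∀ n k → suc k ℕ.* (suc n C suc k) ≡ suc n ℕ.* (n C k)
  absorption zero    zero    = refl
  absorption zero    (suc k) = ℕ.*-zeroʳ (suc (suc k))
  absorption (suc n) zero    = trans (cong (1 ℕ.*_) (nC1≡n (suc (suc n)))) (ℕ.*-comm 1 (suc (suc n)))
  absorption (suc n) (suc k) = let open ≡-Reasoning in begin
    suc (suc k) ℕ.* (suc (suc n) C suc (suc k))                          ≡⟨ cong (suc (suc k) ℕ.*_) (nCk+nC[k+1]≡[n+1]C[k+1] (suc n) (suc k)) ⟨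
    suc (suc k) ℕ.* (c ℕ.+ d)                                            ≡⟨ lemma₁ (suc k) c d ⟩
    (c ℕ.+ suc k ℕ.* c) ℕ.+ suc (suc k) ℕ.* d                            ≡⟨ cong₂ (λ u v → (c ℕ.+ u) ℕ.+ v) (absorption n k) (absorption n (suc k)) ⟩
    (c ℕ.+ suc n ℕ.* (n C k)) ℕ.+ suc n ℕ.* (n C suc k)                  ≡⟨ lemma₂ c (suc n) (n C k) (n C suc k) ⟩
    c ℕ.+ suc n ℕ.* (n C k ℕ.+ n C suc k)                                ≡⟨ cong (λ w → c ℕ.+ suc n ℕ.* w) (nCk+nC[k+1]≡[n+1]C[k+1] n k) ⟩
    suc (suc n) ℕ.* c                                                    ∎
    where
    c = suc n C suc k
    d = suc n C suc (suc k)
    lemma₁ : ∀ k c d → suc k ℕ.* (c ℕ.+ d) ≡ (c ℕ.+ k ℕ.* c) ℕ.+ suc k ℕ.* d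
    lemma₁ = solve-∀ℕ
    lemma₂ : ∀ c n a b → (c ℕ.+ n ℕ.* a) ℕ.+ n ℕ.* b ≡ c ℕ.+ n ℕ.* (a ℕ.+ b)
    lemma₂ = solve-∀ℕ

  -- By `absorption`, p divides `suc k` times the coefficient, and `suc k` is too small to absorb
  -- the prime.
  prime∣binomial : ∀ {p} → Prime p → ∀ k → suc k ℕ.< p → p ℕ.∣ p C suc k
  prime∣binomial {suc n} pp k k<p with euclidsLemma (suc k) (suc n C suc k) pp (ℕ.divides (n C k) (trans (absorption n k) (ℕ.*-comm (suc n) (n C k))))
  ... | inj₁ p∣k = contradiction p∣k (ℕ.>⇒∤ k<p)
  ... | inj₂ p∣C = p∣C

  -- The p-power map in a commutative semiring

  module FreshmansDream {c ℓ} (R : CommutativeSemiring c ℓ) {p : ℕ} (pp : Prime p) where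
    open CommutativeSemiring R renaming (Carrier to A; _+_ to _⊕_; _*_ to _⊛_; refl to ≈-refl; sym to ≈-sym; trans to ≈-trans)
    open import Algebra.Properties.Semiring.Exp semiring
    open import Algebra.Properties.Semiring.Mult semiring renaming (_×_ to _·_)
    open import Algebra.Properties.CommutativeMonoid.Mult +-commutativeMonoid using () renaming (×-distrib-+ to ·-distrib-+)
    open import Algebra.Properties.Semiring.Sum semiring using (sum; sum-init-last)
    open import Algebra.Properties.CommutativeSemiring.Binomial R using (binomialTerm; theorem)
    open import Relation.Binary.Reasoning.Setoid setoid 

    p∣_ : A → Set _
    p∣ x = ∃ λ u → x ≈ p · u

    p∣-+ : ∀ {x y} → p∣ x → p∣ y → p∣ (x ⊕ y)
    p∣-+ (u , eq) (v , eq′) = u ⊕ v , ≈-trans (+-cong eq eq′) (≈-sym (·-distrib-+ u v p))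

    p∣-sum : ∀ {n} (t : Fin n → A) → (∀ i → p∣ t i) → p∣ sum t
    p∣-sum {zero}  t d = 0# ⊛ 0# , ≈-sym (≈-trans (≈-sym (×-comm-* p 0# 0#)) (zeroˡ _))
    p∣-sum {suc n} t d = p∣-+ (d Fin.zero) (p∣-sum (λ i → t (Fin.suc i)) (λ i → d (Fin.suc i)))

    p∣-· : ∀ {n} → p ℕ.∣ n → ∀ x → p∣ (n · x)
    p∣-· (ℕ.divides k eq) x = k · x , ≈-trans (×-congˡ (trans eq (ℕ.*-comm k p))) (≈-sym (×-assocˡ x p k))

    -- Pulling out one factor shows that a positive power of a multiple of p is again a multiple of
    -- p.
    ^-split : ∀ {n} → 0 ℕ.< n → ∀ x → ∃ λ y → x ^ n ≈ x ⊛ y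
    ^-split {suc n} _ x = x ^ n , ≈-refl

    -- A semiring has no subtraction, so congruence modulo p is recorded one-sidedly, with the
    -- multiple of p displayed on the right.
    _≋_ : A → A → Set _
    x ≋ y = ∃ λ u → x ≈ y ⊕ p · u

    freshman : ∀ x y → ((x ⊕ y) ^ p) ≋ (x ^ p ⊕ y ^ p)
    freshman x y = go p refl
      where
      -- The exponent is a variable tied to p by an equation, so that matching on `suc q` exposes
      -- the two end terms of the binomial sum; p divides all the others.
      go : ∀ q → q ≡ p → ((x ⊕ y) ^ q) ≋ (x ^ q ⊕ y ^ q)
      go zero    eq = contradiction (sym eq) (ℕ.≢-nonZero⁻¹ p {{prime⇒nonZero pp}})
      go (suc q) eq with p∣-sum (λ i → binomialTerm x y (suc q) (Fin.suc (inject₁ i))) inner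
        where
        inner : ∀ (i : Fin q) → p∣ binomialTerm x y (suc q) (Fin.suc (inject₁ i))
        inner i rewrite toℕ-inject₁ i =
          p∣-· (subst (λ w → p ℕ.∣ w C suc (toℕ i)) (sym eq)
                      (prime∣binomial pp (toℕ i) (subst (suc (toℕ i) ℕ.<_) eq (ℕ.s≤s (toℕ<n i))))) _
      ... | u , sum≈ = u , (begin
        (x ⊕ y) ^ suc q
          ≈⟨ theorem (suc q) x y ⟩
        t Fin.zero ⊕ sum (λ i → t (Fin.suc i))
          ≈⟨ +-cong first (≈-trans (sum-init-last (λ i → t (Fin.suc i))) (+-cong sum≈ final)) ⟩
        y ^ suc q ⊕ (p · u ⊕ x ^ suc q)
          ≈⟨ ≈-trans (+-congˡ (+-comm _ _)) (≈-sym (+-assoc _ _ _)) ⟩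
        (y ^ suc q ⊕ x ^ suc q) ⊕ p · u
          ≈⟨ +-congʳ (+-comm _ _) ⟩
        (x ^ suc q ⊕ y ^ suc q) ⊕ p · u ∎)
        where
        t = binomialTerm x y (suc q)
        first : t Fin.zero ≈ y ^ suc q
        first = ≈-trans (+-identityʳ _) (*-identityˡ _)
        final : t (Fin.suc (fromℕ q)) ≈ x ^ suc q
        final rewrite toℕ-fromℕ q | nCn≡1 (suc q) | ℕ.n∸n≡0 q = ≈-trans (+-identityʳ _) (*-identityʳ _)

    -- Induction on k: apply `freshman` once, then raise to the power p^k. The error `p · u` becomes
    -- a summand of its own, and its power stays divisible by p because p^k is positive.
    freshman^ : ∀ k x y → ((x ⊕ y) ^ (p ℕ.^ k)) ≋ (x ^ (p ℕ.^ k) ⊕ y ^ (p ℕ.^ k))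
    freshman^ zero    x y =
      -- The empty sum supplies a witness that 0 is a multiple of p.
      let u , 0≈pu = p∣-sum {0} (λ ()) (λ ()) in
      u , ≈-trans (*-identityʳ _) (≈-trans (≈-sym (+-identityʳ _))
            (+-cong (+-cong (≈-sym (*-identityʳ x)) (≈-sym (*-identityʳ y))) 0≈pu))
    freshman^ (suc k) x y =
      let q           = p ℕ.^ k
          u , eq₁     = freshman x y
          v , eq₂     = freshman^ k (x ^ p ⊕ y ^ p) (p · u)
          w , eq₃     = freshman^ k (x ^ p) (y ^ p)
          s , eq₄     = ^-split (ℕ.m^n>0 p {{prime⇒nonZero pp}} k) (p · u)
          z , eq₅     = p∣-+ (w , ≈-refl) (p∣-+ (u ⊛ s , ≈-trans eq₄ (×-assoc-* p u s)) (v , ≈-refl))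
      in z , (begin
        (x ⊕ y) ^ (p ℕ.* q)                                        ≈⟨ ^-assocʳ (x ⊕ y) p q ⟨
        ((x ⊕ y) ^ p) ^ q                                          ≈⟨ ^-congˡ q eq₁ ⟩
        ((x ^ p ⊕ y ^ p) ⊕ p · u) ^ q                              ≈⟨ eq₂ ⟩
        ((x ^ p ⊕ y ^ p) ^ q ⊕ (p · u) ^ q) ⊕ p · v                ≈⟨ +-congʳ (+-congʳ eq₃) ⟩
        ((((x ^ p) ^ q ⊕ (y ^ p) ^ q) ⊕ p · w) ⊕ (p · u) ^ q) ⊕ p · v ≈⟨ ≈-trans (+-assoc _ _ _) (+-assoc _ _ _) ⟩
        ((x ^ p) ^ q ⊕ (y ^ p) ^ q) ⊕ (p · w ⊕ ((p · u) ^ q ⊕ p · v)) ≈⟨ +-cong (+-cong (^-assocʳ x p q) (^-assocʳ y p q)) eq₅ ⟩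
        (x ^ (p ℕ.* q) ⊕ y ^ (p ℕ.* q)) ⊕ p · z                    ∎)

module Dihedral where

  open import Algebra.Bundles using (CommutativeSemiring)
  import Algebra.Properties.Semiring.Exp as Exp
  import Algebra.Properties.Semiring.Mult as Mult
  open import Data.Bool using (Bool; true; false; _xor_)
  open import Data.Empty using (⊥)
  open import Data.Fin using (Fin; toℕ; fromℕ<)
  open import Data.Fin.Properties using (toℕ<n; toℕ-fromℕ<; toℕ-injective)
  open import Data.Fin.Subset using (Subset; inside; outside; _∈_; _∉_; _⊆_; _⊂_; _─_)
  open import Data.Fin.Subset.Properties using (x∈p∧x∉q⇒x∈p─q; p─q⊆p)
  open import Data.Integer using (ℤ; +_; -[1+_]; 0ℤ; 1ℤ; -1ℤ; _+_; _*_; -_; _-_; _≤_; +≤+; ∣_∣)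
  open import Data.Integer.DivMod using (_%ℕ_; _/ℕ_; n%ℕd<d; a≡a%ℕn+[a/ℕn]*n)
  open import Data.Integer.Divisibility.Signed
  open import Data.Integer.Properties
  open import Data.Integer.Tactic.RingSolver using (solve-∀)
  open import Data.List as List using (cartesianProduct; []; _∷_)
  open import Data.Nat as ℕ using (ℕ; zero; suc)
  open import Data.Nat.Coprimality using (Coprime; coprime-divisor)
  open import Data.Nat.DivMod using (m%n<n; m≡m%n+[m/n]*n)
  import Data.Nat.Divisibility as ℕ
  open import Data.Nat.GCD using (gcd; gcd[m,n]∣m; gcd[m,n]∣n; gcd-GCD; module Bézout)
  open import Data.Nat.Primality using (Prime; euclidsLemma; prime⇒nonZero; prime⇒nonTrivial; prime⇒irreducible)
  import Data.Nat.Properties as ℕ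
  open import Data.Product using (_×_; _,_; proj₁; proj₂; ∃)
  open import Data.Sum using ([_,_]′; _⊎_; inj₁; inj₂)
  open import Data.Vec using (lookup; tabulate; _∷_; here; there)
  open import Data.Vec.Properties using ([]=⇒lookup; lookup⇒[]=; lookup∘tabulate)
  open import Function using (_∘_; case_of_)
  open import Function.Bundles using (_⇔_; mk⇔; module Equivalence)
  open import Level using (0ℓ)
  open import Relation.Binary.PropositionalEquality using (_≡_; _≢_; refl; sym; trans; cong; cong₂; subst; subst₂; module ≡-Reasoning)
  open import Relation.Nullary using (Dec; does; ¬_; yes; no; contradiction)
  open import Relation.Nullary.Decidable using (decidable-stable; ¬?)
  open Binomial
  open ≡-Reasoning

  -- Sums over a period

  ∑ : ℕ → (ℤ → ℤ) → ℤ
  ∑ zero    f = 0ℤ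
  ∑ (suc n) f = ∑ n f + f (+ n)

  ∑-cong< : ∀ n {f g} → (∀ i → i ℕ.< n → f (+ i) ≡ g (+ i)) → ∑ n f ≡ ∑ n g
  ∑-cong< zero    eq = refl
  ∑-cong< (suc n) eq = cong₂ _+_ (∑-cong< n (λ i i<n → eq i (ℕ.m<n⇒m<1+n i<n))) (eq n (ℕ.n<1+n n))

  ∑-cong : ∀ n {f g} → (∀ x → f x ≡ g x) → ∑ n f ≡ ∑ n g
  ∑-cong n eq = ∑-cong< n (λ i _ → eq (+ i))

  ∑-+ : ∀ n f g → ∑ n (λ x → f x + g x) ≡ ∑ n f + ∑ n g
  ∑-+ zero    f g = refl
  ∑-+ (suc n) f g = trans (cong (_+ (f (+ n) + g (+ n))) (∑-+ n f g))
                          (lemma (∑ n f) (∑ n g) (f (+ n)) (g (+ n)))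
    where
    lemma : ∀ a b c d → (a + b) + (c + d) ≡ (a + c) + (b + d)
    lemma = solve-∀

  ∑-*ˡ : ∀ n c f → ∑ n (λ x → c * f x) ≡ c * ∑ n f
  ∑-*ˡ zero    c f = sym (*-zeroʳ c)
  ∑-*ˡ (suc n) c f = trans (cong (_+ c * f (+ n)) (∑-*ˡ n c f)) (sym (*-distribˡ-+ c _ _))

  ∑-*ʳ : ∀ n c f → ∑ n (λ x → f x * c) ≡ ∑ n f * c
  ∑-*ʳ n c f = trans (∑-cong n (λ x → *-comm (f x) c)) (trans (∑-*ˡ n c f) (*-comm c _))

  ∑-neg : ∀ n f → ∑ n (λ x → - f x) ≡ - ∑ n f
  ∑-neg zero    f = refl
  ∑-neg (suc n) f = trans (cong (_+ - f (+ n)) (∑-neg n f)) (sym (neg-distrib-+ (∑ n f) _))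

  ∑-0 : ∀ n → ∑ n (λ _ → 0ℤ) ≡ 0ℤ
  ∑-0 zero    = refl
  ∑-0 (suc n) = trans (+-identityʳ _) (∑-0 n)

  ∑-const : ∀ n c → ∑ n (λ _ → c) ≡ + n * c
  ∑-const zero    c = refl
  ∑-const (suc n) c = trans (cong (_+ c) (∑-const n c)) (lemma (+ n) c)
    where
    lemma : ∀ a c → a * c + c ≡ (+ 1 + a) * c
    lemma = solve-∀

  ∑-swap : ∀ m n (f : ℤ → ℤ → ℤ) → ∑ m (λ x → ∑ n (λ y → f x y)) ≡ ∑ n (λ y → ∑ m (λ x → f x y))
  ∑-swap zero    n f = sym (∑-0 n)
  ∑-swap (suc m) n f = trans (cong (_+ ∑ n (f (+ m))) (∑-swap m n f))
                             (sym (∑-+ n (λ y → ∑ m (λ x → f x y)) (f (+ m))))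

  ∑-front : ∀ n f → ∑ (suc n) f ≡ f 0ℤ + ∑ n (λ x → f (+ 1 + x))
  ∑-front zero    f = +-comm 0ℤ (f 0ℤ)
  ∑-front (suc n) f = trans (cong (_+ f (+ suc n)) (∑-front n f)) (+-assoc (f 0ℤ) _ _)

  ∑-nonneg : ∀ n f → (∀ x → 0ℤ ≤ f x) → 0ℤ ≤ ∑ n f
  ∑-nonneg zero    f f≥0 = ≤-refl
  ∑-nonneg (suc n) f f≥0 = +-mono-≤ (∑-nonneg n f f≥0) (f≥0 _)

  +-zeroˡ : ∀ {a b} → 0ℤ ≤ a → 0ℤ ≤ b → a + b ≡ 0ℤ → a ≡ 0ℤ
  +-zeroˡ {a} {b} a≥0 b≥0 eq = ≤-antisym (≤-trans (≤-trans (≤-reflexive (sym (+-identityʳ a))) (+-monoʳ-≤ a b≥0)) (≤-reflexive eq)) a≥0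

  ∑-zero< : ∀ n f → (∀ x → 0ℤ ≤ f x) → ∑ n f ≡ 0ℤ → ∀ i → i ℕ.< n → f (+ i) ≡ 0ℤ
  ∑-zero< (suc n) f f≥0 eq i i<1+n with ℕ.m≤n⇒m<n∨m≡n (ℕ.≤-pred i<1+n)
  ... | inj₁ i<n  = ∑-zero< n f f≥0 (+-zeroˡ (∑-nonneg n f f≥0) (f≥0 _) eq) i i<n
  ... | inj₂ refl = +-zeroˡ (f≥0 _) (∑-nonneg n f f≥0) (trans (+-comm (f (+ n)) _) eq)

  -- Indices are written as jb + i. This serves to fold an m-periodic sum over a longer period, and
  -- to isolate the multiples of p^γ in ℤ/p^(γ+1).
  ∑-blocks : ∀ a b f → ∑ (a ℕ.* b) f ≡ ∑ a (λ j → ∑ b (λ i → f (j * + b + i)))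
  ∑-blocks zero    b f = refl
  ∑-blocks (suc a) b f = begin
    ∑ (b ℕ.+ a ℕ.* b) f                                      ≡⟨ cong (λ k → ∑ k f) (ℕ.+-comm b (a ℕ.* b)) ⟩
    ∑ (a ℕ.* b ℕ.+ b) f                                      ≡⟨ ∑-append (a ℕ.* b) b ⟩
    ∑ (a ℕ.* b) f + ∑ b (λ i → f (+ (a ℕ.* b) + i))          ≡⟨ cong₂ _+_ (∑-blocks a b f) (∑-cong b (λ i → cong (λ w → f (w + i)) (pos-* a b))) ⟩
    ∑ a (λ j → ∑ b (λ i → f (j * + b + i))) + ∑ b (λ i → f (+ a * + b + i)) ∎
    where
    ∑-append : ∀ k l → ∑ (k ℕ.+ l) f ≡ ∑ k f + ∑ l (λ i → f (+ k + i))
    ∑-append k zero    = trans (cong (λ w → ∑ w f) (ℕ.+-identityʳ k)) (sym (+-identityʳ _))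
    ∑-append k (suc l) = begin
      ∑ (k ℕ.+ suc l) f                                             ≡⟨ cong (λ w → ∑ w f) (ℕ.+-suc k l) ⟩
      ∑ (k ℕ.+ l) f + f (+ (k ℕ.+ l))                               ≡⟨ cong (_+ f (+ (k ℕ.+ l))) (∑-append k l) ⟩
      (∑ k f + ∑ l (λ i → f (+ k + i))) + f (+ k + + l)             ≡⟨ +-assoc (∑ k f) _ _ ⟩
      ∑ k f + (∑ l (λ i → f (+ k + i)) + f (+ k + + l))             ∎

  -- Residue classes are represented by integers: translation and negation need no reduction, and
  -- passing between ℤ/m and ℤ/n changes the period but not the function.
  record Periodic (n : ℕ) (f : ℤ → ℤ) : Set where
    constructor mkPeriodic
    field step : ∀ x → f (x + + n) ≡ f x
  open Periodic

  periodic-multiple : ∀ {n f} → Periodic n f → ∀ k x → f (x + k * + n) ≡ f x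
  periodic-multiple {n} {f} per (+ k) x = ℕmultiple k x
    where
    lemma : ∀ x k n → x + (+ 1 + k) * n ≡ (x + k * n) + n
    lemma = solve-∀
    ℕmultiple : ∀ k x → f (x + + k * + n) ≡ f x
    ℕmultiple zero    x = cong f (trans (cong (_+_ x) (*-zeroˡ (+ n))) (+-identityʳ x))
    ℕmultiple (suc k) x = trans (cong f (lemma x (+ k) (+ n))) (trans (step per _) (ℕmultiple k x))
  periodic-multiple {n} {f} per -[1+ k ] x =
    trans (sym (periodic-multiple per (+ suc k) _)) (cong f (lemma x (+ suc k) (+ n)))
    where
    lemma : ∀ x k n → (x + (- k) * n) + k * n ≡ x
    lemma = solve-∀

  periodic-≡ : ∀ {n f} → Periodic n f → ∀ {x y} → + n ∣ x - y → f x ≡ f y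
  periodic-≡ {n} {f} per {x} {y} (divides k eq) =
    trans (cong f (trans (lemma x y) (cong (_+_ y) eq))) (periodic-multiple per k y)
    where
    lemma : ∀ x y → x ≡ y + (x - y)
    lemma = solve-∀

  ∣-rep : ∀ n .{{_ : ℕ.NonZero n}} x → + n ∣ x - + (x %ℕ n)
  ∣-rep n x = divides (x /ℕ n) (trans (cong (_- + (x %ℕ n)) (a≡a%ℕn+[a/ℕn]*n x n)) (lemma (+ (x %ℕ n)) _))
    where
    lemma : ∀ a b → (a + b) - a ≡ b
    lemma = solve-∀

  periodic-rep : ∀ {n} .{{_ : ℕ.NonZero n}} {f} → Periodic n f → ∀ x → f x ≡ f (+ (x %ℕ n))
  periodic-rep {n} {f} per x = periodic-≡ per (∣-rep n x)

  ∑-zero : ∀ {n} .{{_ : ℕ.NonZero n}} {f} → Periodic n f → (∀ x → 0ℤ ≤ f x) → ∑ n f ≡ 0ℤ → ∀ x → f x ≡ 0ℤ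
  ∑-zero {n} {f} per f≥0 eq x = trans (periodic-rep per x) (∑-zero< n f f≥0 eq _ (n%ℕd<d x n))

  -- Moving the window by one exchanges f(0) for f(n), which are equal.
  ∑-suc : ∀ {n f} → Periodic n f → ∑ n (λ x → f (+ 1 + x)) ≡ ∑ n f
  ∑-suc {n} {f} per = +-cancelˡ (f 0ℤ) _ _ (trans (sym (∑-front n f)) (trans (+-comm (∑ n f) _) (cong (_+ ∑ n f) (trans (cong f (sym (+-identityˡ (+ n)))) (step per 0ℤ)))))
    where
    +-cancelˡ : ∀ a b c → a + b ≡ a + c → b ≡ c
    +-cancelˡ a b c eq = trans (lemma a b) (trans (cong (_- a) eq) (sym (lemma a c)))
      where
      lemma : ∀ a b → b ≡ (a + b) - a
      lemma = solve-∀

  periodic-shift : ∀ {n f} → Periodic n f → ∀ k → Periodic n (λ x → f (k + x))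
  periodic-shift {n} {f} per k .step x = trans (cong f (sym (+-assoc k x (+ n)))) (step per (k + x))

  ∑-shift : ∀ {n f} → Periodic n f → ∀ k → ∑ n (λ x → f (k + x)) ≡ ∑ n f
  ∑-shift {n} per (+ k) = ℕshift per k
    where
    ℕshift : ∀ {f} → Periodic n f → ∀ k → ∑ n (λ x → f (+ k + x)) ≡ ∑ n f
    ℕshift {f} per zero    = ∑-cong n (λ x → cong f (+-identityˡ x))
    ℕshift {f} per (suc k) = trans (∑-cong n (λ x → cong f (lemma (+ k) x)))
      (trans (∑-suc (periodic-shift per (+ k))) (ℕshift per k))
      where
      lemma : ∀ k x → + 1 + k + x ≡ k + (+ 1 + x)
      lemma = solve-∀
  -- A negative shift is reduced to the opposite positive shift of the function already shifted.
  ∑-shift {n} {f} per -[1+ k ] =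
    trans (sym (∑-shift (periodic-shift per -[1+ k ]) (+ suc k)))
          (∑-cong n (λ x → cong f (lemma (+ suc k) x)))
    where
    lemma : ∀ k x → (- k) + (k + x) ≡ x
    lemma = solve-∀

  -- Negation carries the window 0, ..., n - 1 to its translate by 1 - n, traversed backwards.
  ∑-reflect : ∀ {n f} → Periodic n f → ∑ n (λ x → f (- x)) ≡ ∑ n f
  ∑-reflect {n} {f} per = trans (reverse n) (∑-shift per (+ 1 - + n))
    where
    lemma₁ : ∀ n → - n ≡ (+ 1 - (+ 1 + n)) + + 0
    lemma₁ = solve-∀
    lemma₂ : ∀ n x → (+ 1 - n) + x ≡ (+ 1 - (+ 1 + n)) + (+ 1 + x)
    lemma₂ = solve-∀
    reverse : ∀ n → ∑ n (λ x → f (- x)) ≡ ∑ n (λ x → f ((+ 1 - + n) + x))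
    reverse zero    = refl
    reverse (suc n) = begin
      ∑ n (λ x → f (- x)) + f (- + n)                                 ≡⟨ +-comm _ (f (- + n)) ⟩
      f (- + n) + ∑ n (λ x → f (- x))                                 ≡⟨ cong₂ _+_ (cong f (lemma₁ (+ n))) (trans (reverse n) (∑-cong n (λ x → cong f (lemma₂ (+ n) x)))) ⟩
      f ((+ 1 - + suc n) + 0ℤ) + ∑ n (λ x → f ((+ 1 - + suc n) + (+ 1 + x))) ≡⟨ ∑-front n (λ x → f ((+ 1 - + suc n) + x)) ⟨
      ∑ (suc n) (λ x → f ((+ 1 - + suc n) + x))                       ∎

  ∑-flip : ∀ {n f} → Periodic n f → ∀ k → ∑ n (λ x → f (k - x)) ≡ ∑ n f
  ∑-flip {n} {f} per k = trans (∑-reflect (periodic-shift per k)) (∑-shift per k)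

  -- Convolution

  periodic-+ : ∀ {n f g} → Periodic n f → Periodic n g → Periodic n (λ x → f x + g x)
  periodic-+ pf pg .step x = cong₂ _+_ (step pf x) (step pg x)

  periodic-* : ∀ {n f g} → Periodic n f → Periodic n g → Periodic n (λ x → f x * g x)
  periodic-* pf pg .step x = cong₂ _*_ (step pf x) (step pg x)

  periodic-neg : ∀ {n f} → Periodic n f → Periodic n (λ x → - f x)
  periodic-neg pf .step x = cong -_ (step pf x)

  periodic-const : ∀ {n} c → Periodic n (λ _ → c)
  periodic-const c .step x = refl

  periodic-reflect : ∀ {n f} → Periodic n f → Periodic n (λ x → f (- x))
  periodic-reflect {n} {f} pf .step x = trans (sym (step pf _)) (cong f (lemma x (+ n)))
    where
    lemma : ∀ x n → - (x + n) + n ≡ - x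
    lemma = solve-∀

  periodic-flip : ∀ {n f} → Periodic n f → ∀ k → Periodic n (λ x → f (k - x))
  periodic-flip pf k = periodic-reflect (periodic-shift pf k)

  periodic-· : ∀ {m f} r → Periodic m f → Periodic (r ℕ.* m) f
  periodic-· {m} {f} r pf .step x = trans (cong (λ w → f (x + w)) (pos-* r m)) (periodic-multiple pf (+ r) x)

  conv : ℕ → (ℤ → ℤ) → (ℤ → ℤ) → ℤ → ℤ
  conv n f g x = ∑ n (λ h → f h * g (x - h))

  conv-cong : ∀ n {f f′ g g′} → (∀ x → f x ≡ f′ x) → (∀ x → g x ≡ g′ x) → ∀ x → conv n f g x ≡ conv n f′ g′ x
  conv-cong n ef eg x = ∑-cong n (λ h → cong₂ _*_ (ef h) (eg (x - h)))

  conv-comm : ∀ {n f g} → Periodic n f → Periodic n g → ∀ x → conv n f g x ≡ conv n g f x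
  conv-comm {n} {f} {g} pf pg x = trans (sym (∑-flip (periodic-* pf (periodic-flip pg x)) x))
    (∑-cong n (λ h → trans (cong (λ w → f (x - h) * g w) (lemma x h)) (*-comm (f (x - h)) (g h))))
    where
    lemma : ∀ x h → x - (x - h) ≡ h
    lemma = solve-∀

  conv-distribʳ : ∀ n f g h x → conv n f (λ y → g y + h y) x ≡ conv n f g x + conv n f h x
  conv-distribʳ n f g h x = trans (∑-cong n (λ y → *-distribˡ-+ (f y) (g (x - y)) (h (x - y)))) (∑-+ n _ _)

  conv-distribˡ : ∀ n f g h x → conv n (λ y → f y + g y) h x ≡ conv n f h x + conv n g h x
  conv-distribˡ n f g h x = trans (∑-cong n (λ y → *-distribʳ-+ (h (x - y)) (f y) (g y))) (∑-+ n _ _)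

  conv-negʳ : ∀ n f g x → conv n f (λ y → - g y) x ≡ - conv n f g x
  conv-negʳ n f g x = trans (∑-cong n (λ y → sym (neg-distribʳ-* (f y) (g (x - y))))) (∑-neg n _)

  conv-negˡ : ∀ n f g x → conv n (λ y → - f y) g x ≡ - conv n f g x
  conv-negˡ n f g x = trans (∑-cong n (λ y → sym (neg-distribˡ-* (f y) (g (x - y))))) (∑-neg n _)

  conv-*ˡ : ∀ n c f g x → conv n (λ y → c * f y) g x ≡ c * conv n f g x
  conv-*ˡ n c f g x = trans (∑-cong n (λ y → *-assoc c (f y) (g (x - y)))) (∑-*ˡ n c _)

  conv-constʳ : ∀ n f c x → conv n f (λ _ → c) x ≡ ∑ n f * c
  conv-constʳ n f c x = ∑-*ʳ n c f

  conv-constˡ : ∀ {n g} c → Periodic n g → ∀ x → conv n (λ _ → c) g x ≡ c * ∑ n g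
  conv-constˡ {n} {g} c pg x = trans (∑-*ˡ n c (λ h → g (x - h))) (cong (c *_) (∑-flip pg x))

  conv-assoc : ∀ {n f g h} → Periodic n f → Periodic n g → Periodic n h → ∀ x →
    conv n (conv n f g) h x ≡ conv n f (conv n g h) x
  conv-assoc {n} {f} {g} {h} pf pg ph x = begin
    ∑ n (λ j → ∑ n (λ i → f i * g (j - i)) * h (x - j))    ≡⟨ ∑-cong n (λ j → ∑-*ʳ n (h (x - j)) _) ⟨
    ∑ n (λ j → ∑ n (λ i → f i * g (j - i) * h (x - j)))    ≡⟨ ∑-swap n n (λ j i → f i * g (j - i) * h (x - j)) ⟩
    ∑ n (λ i → ∑ n (λ j → f i * g (j - i) * h (x - j)))    ≡⟨ ∑-cong n (λ i → trans (∑-cong n (λ j → *-assoc (f i) _ _)) (∑-*ˡ n (f i) _)) ⟩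
    ∑ n (λ i → f i * ∑ n (λ j → g (j - i) * h (x - j)))    ≡⟨ ∑-cong n (λ i → cong (f i *_) (inner i)) ⟩
    ∑ n (λ i → f i * ∑ n (λ j → g j * h (x - i - j)))      ∎
    where
    lemma₁ : ∀ i j → - i + j ≡ j - i
    lemma₁ = solve-∀
    lemma₂ : ∀ x i j → x - i - (- i + j) ≡ x - j
    lemma₂ = solve-∀
    inner : ∀ i → ∑ n (λ j → g (j - i) * h (x - j)) ≡ ∑ n (λ j → g j * h (x - i - j))
    inner i = trans (∑-cong n (λ j → cong₂ _*_ (cong g (sym (lemma₁ i j))) (cong h (sym (lemma₂ x i j)))))
                    (∑-shift (periodic-* pg (periodic-flip ph (x - i))) (- i))

  conv-periodic : ∀ {n} f {g} → Periodic n g → Periodic n (conv n f g)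
  conv-periodic {n} f {g} pg .step x = ∑-cong n (λ h → cong (f h *_) (trans (cong g (lemma x (+ n) h)) (step pg (x - h))))
    where
    lemma : ∀ x n h → x + n - h ≡ x - h + n
    lemma = solve-∀

  -- Negation is an automorphism of ℤ/n and so acts multiplicatively on the group ring.
  conv-reflect : ∀ {n f g} → Periodic n f → Periodic n g → ∀ x →
    conv n (λ y → f (- y)) (λ y → g (- y)) x ≡ conv n f g (- x)
  conv-reflect {n} {f} {g} pf pg x = trans (∑-cong n (λ h → cong (λ w → f (- h) * g w) (lemma x h)))
    (∑-reflect (periodic-* pf (periodic-flip pg (- x))))
    where
    lemma : ∀ x h → - (x - h) ≡ - x - (- h)
    lemma = solve-∀

  ⟦_⟧ : {A : Set} → Dec A → ℤ
  ⟦ yes _ ⟧ = 1ℤ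
  ⟦ no  _ ⟧ = 0ℤ

  ⟦⟧-yes : {A : Set} (A? : Dec A) → A → ⟦ A? ⟧ ≡ 1ℤ
  ⟦⟧-yes (yes _) a = refl
  ⟦⟧-yes (no ¬a) a = contradiction a ¬a

  ⟦⟧-no : {A : Set} (A? : Dec A) → ¬ A → ⟦ A? ⟧ ≡ 0ℤ
  ⟦⟧-no (yes a) ¬a = contradiction a ¬a
  ⟦⟧-no (no _)  ¬a = refl

  ⟦⟧-cong : {A B : Set} (A? : Dec A) (B? : Dec B) → (A → B) → (B → A) → ⟦ A? ⟧ ≡ ⟦ B? ⟧
  ⟦⟧-cong (yes a) B? to from = sym (⟦⟧-yes B? (to a))
  ⟦⟧-cong (no ¬a) B? to from = sym (⟦⟧-no B? (¬a ∘ from))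

  -- Plays two parts: `δ n` is the identity of the group ring of ℤ/n, while for m ∣ n `δ m` is the
  -- indicator of the subgroup generated by m.
  δ : ℕ → ℤ → ℤ
  δ m x = ⟦ + m ∣? x ⟧

  δ-yes : ∀ {m x} → + m ∣ x → δ m x ≡ 1ℤ
  δ-yes {m} {x} = ⟦⟧-yes (+ m ∣? x)

  δ-no : ∀ {m x} → ¬ (+ m ∣ x) → δ m x ≡ 0ℤ
  δ-no {m} {x} = ⟦⟧-no (+ m ∣? x)

  δ-cong : ∀ {m x k y} → (+ m ∣ x → + k ∣ y) → (+ k ∣ y → + m ∣ x) → δ m x ≡ δ k y
  δ-cong {m} {x} {k} {y} = ⟦⟧-cong (+ m ∣? x) (+ k ∣? y)

  δ-periodic : ∀ m → Periodic m (δ m)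
  δ-periodic m .step x = δ-cong (λ d → ∣m+n∣n⇒∣m d ∣-refl) (λ d → ∣m∣n⇒∣m+n d ∣-refl)

  δ-even : ∀ m x → δ m (- x) ≡ δ m x
  δ-even m x = δ-cong (λ d → subst (+ m ∣_) (neg-involutive x) (∣m⇒∣-m d)) ∣m⇒∣-m

  ∤-between : ∀ {m i} → 0 ℕ.< i → i ℕ.< m → ¬ (+ m ∣ + i)
  ∤-between {i = suc _} _ i<m d = ℕ.>⇒∤ i<m (∣⇒∣ᵤ d)

  ∑-δ : ∀ m .{{_ : ℕ.NonZero m}} (f : ℤ → ℤ) → ∑ m (λ x → δ m x * f x) ≡ f 0ℤ
  ∑-δ (suc m) f = begin
    ∑ (suc m) (λ x → δ (suc m) x * f x)                                     ≡⟨ ∑-front m _ ⟩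
    δ (suc m) 0ℤ * f 0ℤ + ∑ m (λ x → δ (suc m) (+ 1 + x) * f (+ 1 + x))     ≡⟨ cong₂ _+_ (trans (cong (_* f 0ℤ) (δ-yes {suc m} (divides 0ℤ refl))) (*-identityˡ (f 0ℤ))) (trans (∑-cong< m vanish) (∑-0 m)) ⟩
    f 0ℤ + 0ℤ                                                               ≡⟨ +-identityʳ _ ⟩
    f 0ℤ                                                                    ∎
    where
    vanish : ∀ i → i ℕ.< m → δ (suc m) (+ 1 + + i) * f (+ 1 + + i) ≡ 0ℤ
    vanish i i<m = trans (cong (_* f (+ suc i)) (δ-no (∤-between {suc m} {suc i} (ℕ.s≤s ℕ.z≤n) (ℕ.s≤s i<m)))) (*-zeroˡ (f (+ suc i)))

  -- Multiplication by the group element k translates by k.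
  conv-δ : ∀ {m} .{{_ : ℕ.NonZero m}} {f} → Periodic m f → ∀ k x → conv m (λ y → δ m (y - k)) f x ≡ f (x - k)
  conv-δ {m} {f} pf k x = begin
    ∑ m (λ h → δ m (h - k) * f (x - h))                  ≡⟨ ∑-shift (periodic-* (mkPeriodic λ y → trans (cong (δ m) (lemma₁ y k (+ m))) (step (δ-periodic m) (y - k))) (periodic-flip pf x)) k ⟨
    ∑ m (λ h → δ m (k + h - k) * f (x - (k + h)))        ≡⟨ ∑-cong m (λ h → cong (λ w → δ m w * f (x - (k + h))) (lemma₂ k h)) ⟩
    ∑ m (λ h → δ m h * f (x - (k + h)))                  ≡⟨ ∑-δ m _ ⟩
    f (x - (k + 0ℤ))                                     ≡⟨ cong (λ w → f (x - w)) (+-identityʳ k) ⟩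
    f (x - k)                                            ∎
    where
    lemma₁ : ∀ y k m → y + m - k ≡ y - k + m
    lemma₁ = solve-∀
    lemma₂ : ∀ k h → k + h - k ≡ h
    lemma₂ = solve-∀

  -- The group ring of ℤ/m and its Frobenius map

  infix 4 _≡_[mod_]

  record _≡_[mod_] (a b : ℤ) (p : ℕ) : Set where
    constructor mkMod
    field difference : + p ∣ a - b
  open _≡_[mod_] public

  private
    mod-lift₂ : ∀ {p a b c d e f} → (a - b) + (c - d) ≡ e - f → a ≡ b [mod p ] → c ≡ d [mod p ] → e ≡ f [mod p ]
    mod-lift₂ {p} eq (mkMod x) (mkMod y) = mkMod (subst (+ p ∣_) eq (∣m∣n⇒∣m+n x y))

  mod-reflexive : ∀ {p a b} → a ≡ b → a ≡ b [mod p ]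
  mod-reflexive {p} {a} refl = mkMod (subst (+ p ∣_) (sym (+-inverseʳ a)) (divides 0ℤ refl))

  mod-sym : ∀ {p a b} → a ≡ b [mod p ] → b ≡ a [mod p ]
  mod-sym {p} {a} {b} (mkMod d) = mkMod (subst (+ p ∣_) (lemma a b) (∣m⇒∣-m d))
    where
    lemma : ∀ a b → - (a - b) ≡ b - a
    lemma = solve-∀

  mod-trans : ∀ {p a b c} → a ≡ b [mod p ] → b ≡ c [mod p ] → a ≡ c [mod p ]
  mod-trans {p} {a} {b} {c} = mod-lift₂ (lemma a b c)
    where
    lemma : ∀ a b c → (a - b) + (b - c) ≡ a - c
    lemma = solve-∀

  mod-+ : ∀ {p a b c d} → a ≡ b [mod p ] → c ≡ d [mod p ] → a + c ≡ b + d [mod p ]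
  mod-+ {p} {a} {b} {c} {d} = mod-lift₂ (lemma a b c d)
    where
    lemma : ∀ a b c d → (a - b) + (c - d) ≡ (a + c) - (b + d)
    lemma = solve-∀

  mod-cancelˡ : ∀ {p a b c d} → a ≡ b [mod p ] → a + c ≡ b + d [mod p ] → c ≡ d [mod p ]
  mod-cancelˡ {p} {a} {b} {c} {d} e = mod-lift₂ (lemma a b c d) (mod-sym e)
    where
    lemma : ∀ a b c d → (b - a) + ((a + c) - (b + d)) ≡ c - d
    lemma = solve-∀

  mod-*ʳ : ∀ {p a b} c → a ≡ b [mod p ] → a * c ≡ b * c [mod p ]
  mod-*ʳ {p} {a} {b} c (mkMod e) = mkMod (subst (+ p ∣_) (lemma a b c) (∣m⇒∣m*n c e))
    where
    lemma : ∀ a b c → (a - b) * c ≡ a * c - b * c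
    lemma = solve-∀

  mod-∑ : ∀ {p} n {f g} → (∀ x → f x ≡ g x [mod p ]) → ∑ n f ≡ ∑ n g [mod p ]
  mod-∑ zero    e = mod-reflexive refl
  mod-∑ (suc n) e = mod-+ (mod-∑ n e) (e (+ n))

  module GroupRing (m : ℕ) .{{_ : ℕ.NonZero m}} where

    record PeriodicFunction : Set where
      constructor _,ₚ_
      field
        fn       : ℤ → ℤ
        periodic : Periodic m fn
    open PeriodicFunction public

    -- Packaged in this form so that powers, the binomial theorem and `freshman^` apply to
    -- convolution.
    commutativeSemiring : CommutativeSemiring 0ℓ 0ℓ
    commutativeSemiring = record
      { Carrier = PeriodicFunction
      ; _≈_     = λ f g → ∀ x → fn f x ≡ fn g x
      ; _+_     = λ f g → (λ x → fn f x + fn g x) ,ₚ periodic-+ (periodic f) (periodic g)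
      ; _*_     = λ f g → conv m (fn f) (fn g) ,ₚ conv-periodic (fn f) (periodic g)
      ; 0#      = (λ _ → 0ℤ) ,ₚ periodic-const 0ℤ
      ; 1#      = δ m ,ₚ δ-periodic m
      ; isCommutativeSemiring = record
        { isSemiring = record
          { isSemiringWithoutAnnihilatingZero = record
            { +-isCommutativeMonoid = record
              { isMonoid = record
                { isSemigroup = record
                  { isMagma = record
                    { isEquivalence = record
                      { refl = λ x → refl ; sym = λ e x → sym (e x) ; trans = λ e f x → trans (e x) (f x) }
                    ; ∙-cong = λ e f x → cong₂ _+_ (e x) (f x) }
                  ; assoc = λ f g h x → +-assoc (fn f x) (fn g x) (fn h x) }
                ; identity = (λ f x → +-identityˡ (fn f x)) , (λ f x → +-identityʳ (fn f x)) }
              ; comm = λ f g x → +-comm (fn f x) (fn g x) }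
            ; *-cong = λ e f → conv-cong m e f
            ; *-assoc = λ f g h → conv-assoc (periodic f) (periodic g) (periodic h)
            ; *-identity = identityˡ
                         , (λ f x → trans (conv-comm (periodic f) (δ-periodic m) x) (identityˡ f x))
            ; distrib = (λ f g h → conv-distribʳ m (fn f) (fn g) (fn h))
                      , (λ f g h → conv-distribˡ m (fn g) (fn h) (fn f)) }
          ; zero = (λ f x → ∑-0′ (λ h → *-zeroˡ (fn f (x - h)))) , (λ f x → ∑-0′ (λ h → *-zeroʳ (fn f h))) }
        ; *-comm = λ f g → conv-comm (periodic f) (periodic g) } }
      where
      identityˡ : ∀ f x → conv m (δ m) (fn f) x ≡ fn f x
      identityˡ f x = trans (∑-δ m (λ h → fn f (x - h))) (cong (fn f) (+-identityʳ x))
      ∑-0′ : ∀ {f} → (∀ x → f x ≡ 0ℤ) → ∑ m f ≡ 0ℤ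
      ∑-0′ e = trans (∑-cong m e) (∑-0 m)

    open CommutativeSemiring commutativeSemiring public using (_≈_) renaming (_+_ to _⊕_; _*_ to _⊛_)
    open CommutativeSemiring commutativeSemiring using (semiring)
    open Exp semiring public using (^-congˡ) renaming (_^_ to _↑_)
    open Mult semiring using () renaming (_×_ to _×ₙ_)

    ×ₙ-fn : ∀ n f x → fn (n ×ₙ f) x ≡ + n * fn f x
    ×ₙ-fn zero    f x = sym (*-zeroˡ (fn f x))
    ×ₙ-fn (suc n) f x = trans (cong (_+_ (fn f x)) (×ₙ-fn n f x)) (lemma (+ n) (fn f x))
      where
      lemma : ∀ n a → a + n * a ≡ (+ 1 + n) * a
      lemma = solve-∀

    infixl 7 _⊡_

    _⊡_ : ℤ → PeriodicFunction → PeriodicFunction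
    c ⊡ f = (λ x → c * fn f x) ,ₚ periodic-* (periodic-const c) (periodic f)

    monomial : ℤ → PeriodicFunction
    monomial k = (λ x → δ m (x - k)) ,ₚ mkPeriodic λ x →
      trans (cong (δ m) (lemma x k (+ m))) (step (δ-periodic m) (x - k))
      where
      lemma : ∀ y k m → y + m - k ≡ y - k + m
      lemma = solve-∀

    monomial-↑ : ∀ k n x → fn (monomial k ↑ n) x ≡ δ m (x - + n * k)
    monomial-↑ k zero    x = cong (δ m) (sym (trans (cong (_-_ x) (*-zeroˡ k)) (+-identityʳ x)))
    monomial-↑ k (suc n) x = trans (conv-δ (periodic (monomial k ↑ n)) k x)
      (trans (monomial-↑ k n (x - k)) (cong (δ m) (lemma x (+ n) k)))
      where
      lemma : ∀ x n k → x - k - n * k ≡ x - (+ 1 + n) * k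
      lemma = solve-∀

    module _ {p : ℕ} (pp : Prime p) (k : ℕ) where
      private q = p ℕ.^ k

      ↑-additive : ∀ f g x → fn ((f ⊕ g) ↑ q) x ≡ fn (f ↑ q) x + fn (g ↑ q) x [mod p ]
      ↑-additive f g x with FreshmansDream.freshman^ commutativeSemiring pp k f g
      ... | u , eq = mkMod (divides (fn u x) (trans (cong (_- s) (trans (eq x) (cong (_+_ s) (×ₙ-fn p u x)))) (lemma s (+ p) (fn u x))))
        where
        s = fn (f ↑ q) x + fn (g ↑ q) x
        lemma : ∀ s p u → s + p * u - s ≡ u * p
        lemma = solve-∀

      0↑ : ∀ f → (∀ x → fn f x ≡ 0ℤ) → ∀ x → fn (f ↑ q) x ≡ 0ℤ
      0↑ f f≈0 = go q (ℕ.m^n>0 p {{prime⇒nonZero pp}} k)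
        where
        go : ∀ n → 0 ℕ.< n → ∀ x → fn (f ↑ n) x ≡ 0ℤ
        go (suc n) _ x = trans (∑-cong m (λ h → trans (cong (_* fn (f ↑ n) (x - h)) (f≈0 h)) (*-zeroˡ (fn (f ↑ n) (x - h))))) (∑-0 m)

      -- Additivity applied to f + g = 0 yields the sign rule without any discussion of the parity
      -- of q.
      ↑-neg : ∀ f g → (∀ x → fn f x + fn g x ≡ 0ℤ) → ∀ {a x} → fn (f ↑ q) x ≡ a [mod p ] → fn (g ↑ q) x ≡ - a [mod p ]
      ↑-neg f g f+g≈0 {a} {x} e = mod-cancelˡ e (mod-trans (mod-sym (↑-additive f g x))
        (mod-reflexive (trans (0↑ (f ⊕ g) f+g≈0 x) (sym (+-inverseʳ a)))))

      -- Fermat's little theorem in disguise: a natural multiple is repeated addition, so additivity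
      -- alone moves the scalar out of the power unchanged.
      ⊡-↑ : ∀ c f x → fn ((c ⊡ f) ↑ q) x ≡ c * fn (f ↑ q) x [mod p ]
      ⊡-↑ (+ n) f x = ℕ⊡ n
        where
        lemma : ∀ n a → (+ 1 + n) * a ≡ n * a + a
        lemma = solve-∀
        ℕ⊡ : ∀ n → fn ((+ n ⊡ f) ↑ q) x ≡ + n * fn (f ↑ q) x [mod p ]
        ℕ⊡ zero    = mod-reflexive (trans (0↑ (+ 0 ⊡ f) (λ y → *-zeroˡ (fn f y)) x) (sym (*-zeroˡ (fn (f ↑ q) x))))
        ℕ⊡ (suc n) = mod-trans (mod-reflexive (^-congˡ q {+ suc n ⊡ f} {(+ n ⊡ f) ⊕ f} (λ y → lemma (+ n) (fn f y)) x))
          (mod-trans (↑-additive (+ n ⊡ f) f x)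
          (mod-trans (mod-+ (ℕ⊡ n) (mod-reflexive {a = fn (f ↑ q) x} refl))
                     (mod-reflexive (sym (lemma (+ n) (fn (f ↑ q) x))))))
      ⊡-↑ -[1+ n ] f x = mod-trans
        (↑-neg (+ suc n ⊡ f) (-[1+ n ] ⊡ f) (λ y → lemma (+ suc n) (fn f y)) (⊡-↑ (+ suc n) f x))
        (mod-reflexive (neg-distribˡ-* (+ suc n) (fn (f ↑ q) x)))
        where
        lemma : ∀ n a → n * a + (- n) * a ≡ 0ℤ
        lemma = solve-∀

      -- Expand f in group elements: the power is additive modulo p, fixes integer coefficients and
      -- sends the group element h to qh.
      frobenius : ∀ f x → fn (f ↑ q) x ≡ ∑ m (λ h → fn f h * δ m (x - + q * h)) [mod p ]
      frobenius f x = mod-trans (mod-reflexive (^-congˡ q {f} {partial m} expand x)) (go m)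
        where
        -- Partial sums of the expansion, so that additivity is applied to one term at a time.
        partial : ℕ → PeriodicFunction
        partial j = (λ x → ∑ j (λ h → fn f h * δ m (x - h))) ,ₚ
                    mkPeriodic λ x → ∑-cong j (λ h → cong (fn f h *_) (step (periodic (monomial h)) x))

        expand : ∀ x → fn f x ≡ ∑ m (λ h → fn f h * δ m (x - h))
        expand x = sym (trans (conv-comm (periodic f) (δ-periodic m) x)
                              (trans (∑-δ m (λ h → fn f (x - h))) (cong (fn f) (+-identityʳ x))))

        go : ∀ j → fn (partial j ↑ q) x ≡ ∑ j (λ h → fn f h * δ m (x - + q * h)) [mod p ]
        go zero    = mod-reflexive (0↑ (partial 0) (λ _ → refl) x)
        go (suc j) = mod-trans (mod-reflexive (^-congˡ q {partial (suc j)} {partial j ⊕ fn f (+ j) ⊡ monomial (+ j)} (λ _ → refl) x))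
          (mod-trans (↑-additive (partial j) (fn f (+ j) ⊡ monomial (+ j)) x)
          (mod-+ (go j) (mod-trans (⊡-↑ (fn f (+ j)) (monomial (+ j)) x)
                                   (mod-reflexive (cong (fn f (+ j) *_) (monomial-↑ (+ j) q x))))))

  -- Frobenius on cyclic groups of prime power order

  prime-∣-* : ∀ {p} → Prime p → ∀ a b → + p ∣ a * b → (+ p ∣ a) ⊎ (+ p ∣ b)
  prime-∣-* {p} pp a b d with euclidsLemma ∣ a ∣ ∣ b ∣ pp (subst (p ℕ.∣_) (abs-* a b) (∣⇒∣ᵤ d))
  ... | inj₁ e = inj₁ (∣ᵤ⇒∣ e)
  ... | inj₂ e = inj₂ (∣ᵤ⇒∣ e)

  prime>1 : ∀ {p} → Prime p → 1 ℕ.< p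
  prime>1 pp = ℕ.nonTrivial⇒n>1 _ {{prime⇒nonTrivial pp}}

  ∣∣<⇒∤ : ∀ {p a} → a ≢ 0ℤ → ∣ a ∣ ℕ.< p → ¬ (+ p ∣ a)
  ∣∣<⇒∤ {p} {a} a≢0 a<p d = ℕ.>⇒∤ {{ℕ.≢-nonZero (a≢0 ∘ ∣i∣≡0⇒i≡0)}} a<p (∣⇒∣ᵤ d)

  prime-power-∤1 : ∀ {p} → Prime p → ∀ {γ} → 1 ℕ.≤ γ → ¬ (+ (p ℕ.^ γ) ∣ 1ℤ)
  prime-power-∤1 {p} pp {γ} 1≤γ = ∣∣<⇒∤ {p ℕ.^ γ} {1ℤ} (λ ()) (ℕ.<-≤-trans (prime>1 pp)
    (subst (ℕ._≤ p ℕ.^ γ) (ℕ.*-identityʳ p) (ℕ.^-monoʳ-≤ p {{prime⇒nonZero pp}} 1≤γ)))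

  power-quotient : ∀ p {γ α} → γ ℕ.≤ α → p ℕ.^ α ≡ p ℕ.^ (α ℕ.∸ γ) ℕ.* p ℕ.^ γ
  power-quotient p {γ} {α} γ≤α = trans (cong (p ℕ.^_) (sym (ℕ.m∸n+n≡m γ≤α))) (ℕ.^-distribˡ-+-* p (α ℕ.∸ γ) γ)

  -- Modulo p, the power F^(p^γ) is the constant ε(F), so F is invertible there whenever p ∤ ε(F).
  constant-factor : ∀ {p} → Prime p → ∀ γ {f h} → let m = p ℕ.^ γ in
    Periodic m f → Periodic m h → ∀ c → (∀ x → conv m f h x ≡ c) → ¬ (+ p ∣ ∑ m f) →
    ∀ x y → h x ≡ h y [mod p ]
  constant-factor {p} pp γ {f} {h} pf ph c f*h≡c p∤εf x y =
    [ (λ p∣ε → contradiction p∣ε p∤εf) , mkMod ]′ (prime-∣-* pp (∑ (p ℕ.^ γ) f) (h x - h y)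
      (subst (+ p ∣_) (lemma (∑ (p ℕ.^ γ) f) (h x) (h y)) (difference (mod-trans (mod-sym (multiple x)) (multiple y)))))
    where
    m = p ℕ.^ γ
    instance
      m≢0 : ℕ.NonZero m
      m≢0 = ℕ.m^n≢0 p γ {{prime⇒nonZero pp}}
    open GroupRing m
    lemma : ∀ e a b → e * a - e * b ≡ e * (a - b)
    lemma = solve-∀
    F H : PeriodicFunction
    F = f ,ₚ pf
    H = h ,ₚ ph
    -- One of the factors F turns H into the constant c, and convolution with a constant gives a
    -- constant.
    power-constant : ∀ n → 0 ℕ.< n → ∃ λ K → ∀ x → fn ((F ↑ n) ⊛ H) x ≡ K
    power-constant (suc n) _ = ∑ m (fn (F ↑ n)) * c , λ x →
      trans (conv-cong m {g = h} (λ z → conv-comm pf (periodic (F ↑ n)) z) (λ _ → refl) x)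
      (trans (conv-assoc (periodic (F ↑ n)) pf ph x)
      (trans (conv-cong m {f = fn (F ↑ n)} (λ _ → refl) f*h≡c x) (conv-constʳ m (fn (F ↑ n)) c x)))
    -- The exponent equals the group order m, so every group element is sent to 0 and only the
    -- coefficient sum survives.
    power-mod : ∀ x → fn (F ↑ m) x ≡ ∑ m f * δ m x [mod p ]
    power-mod x = mod-trans (frobenius pp γ F x) (mod-reflexive
      (trans (∑-cong m (λ i → cong (f i *_) (trans (cong (λ w → δ m (x - w)) (*-comm (+ m) i)) (δ-multiple i)))) (∑-*ʳ m (δ m x) f)))
      where
      δ-multiple : ∀ i → δ m (x - i * + m) ≡ δ m x
      δ-multiple i = trans (sym (periodic-multiple (δ-periodic m) i (x - i * + m))) (cong (δ m) (cancel x (i * + m)))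
        where
        cancel : ∀ x y → x - y + y ≡ x
        cancel = solve-∀
    K = proj₁ (power-constant m (ℕ.m^n>0 p {{prime⇒nonZero pp}} γ))
    multiple : ∀ x → K ≡ ∑ m f * h x [mod p ]
    multiple x = mod-trans (mod-reflexive (sym (proj₂ (power-constant m (ℕ.m^n>0 p {{prime⇒nonZero pp}} γ)) x)))
      (mod-trans (mod-∑ m (λ i → mod-*ʳ (h (x - i)) (power-mod i)))
      (mod-reflexive (trans (conv-*ˡ m (∑ m f) (δ m) h x)
        (cong (∑ m f *_) (trans (∑-δ m (λ i → h (x - i))) (cong h (+-identityʳ x)))))))

  -- Two coefficients of the p-th power are compared. Frobenius places its support on multiples of
  -- p, so the coefficient at 1 vanishes; the coefficient at 0 collects b over the solutions of ph =
  -- 0, which are the multiples of m′. Both equal the same constant modulo p.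
  square-constant⇒∑-torsion : ∀ {p} → Prime p → ∀ γ {b} → let m′ = p ℕ.^ γ; m = p ℕ.^ suc γ in
    Periodic m b → ∀ c → (∀ x → conv m b b x ≡ c [mod p ]) → + p ∣ ∑ p (λ j → b (j * + m′))
  square-constant⇒∑-torsion {p} pp γ {b} pb c b*b≡c =
    subst (+ p ∣_) (lemma (∑ p (λ j → b (j * + m′)))) (difference (mod-trans (mod-sym at-0)
      (mod-trans (power-constant 0ℤ 1ℤ) at-1)))
    where
    m′ = p ℕ.^ γ
    m  = p ℕ.^ suc γ
    instance
      p≢0 : ℕ.NonZero p
      p≢0 = prime⇒nonZero pp
      m≢0 : ℕ.NonZero m
      m≢0 = ℕ.m^n≢0 p (suc γ)
      m′≢0 : ℕ.NonZero m′
      m′≢0 = ℕ.m^n≢0 p γ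
    open GroupRing m
    B : PeriodicFunction
    B = b ,ₚ pb
    lemma : ∀ a → a - 0ℤ ≡ a
    lemma = solve-∀
    -- Since the exponent is at least 2, two of the factors can be replaced by c modulo p; the
    -- remaining ones contribute only their coefficient sum.
    square : ∀ n → 1 ℕ.< n → ∃ λ K → ∀ x → fn (B ↑ n) x ≡ K [mod p ]
    square (suc (suc n)) _ = c * ∑ m (fn (B ↑ n)) , λ x →
      mod-trans (mod-reflexive (sym (conv-assoc pb pb (periodic (B ↑ n)) x)))
      (mod-trans (mod-∑ m (λ i → mod-*ʳ (fn (B ↑ n) (x - i)) (b*b≡c i)))
      (mod-reflexive (conv-constˡ c (periodic (B ↑ n)) x)))
    square (suc zero) (ℕ.s≤s ())
    q = p ℕ.^ 1
    q≡p : + q ≡ + p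
    q≡p = cong (+_) (ℕ.*-identityʳ p)
    power-constant : ∀ x y → fn (B ↑ q) x ≡ fn (B ↑ q) y [mod p ]
    power-constant x y with square q (subst (1 ℕ.<_) (sym (ℕ.*-identityʳ p)) (prime>1 pp))
    ... | K , eq = mod-trans (eq x) (mod-sym (eq y))
    m≡ : + m ≡ + p * + m′
    m≡ = pos-* p m′
    p∣m : + p ∣ + m
    p∣m = divides (+ m′) (trans m≡ (*-comm (+ p) (+ m′)))
    at-1 : fn (B ↑ q) 1ℤ ≡ 0ℤ [mod p ]
    at-1 = mod-trans (frobenius pp 1 B 1ℤ) (mod-reflexive (trans (∑-cong m (λ h →
      trans (cong (b h *_) (δ-no (λ d → ∣∣<⇒∤ (λ ()) (prime>1 pp) (subst (+ p ∣_) (cancel (+ q * h)) (∣m∣n⇒∣m+n (∣-trans p∣m d) (∣m⇒∣m*n h (subst (+ p ∣_) (sym q≡p) ∣-refl))))))) (*-zeroʳ (b h)))) (∑-0 m)))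
      where
      cancel : ∀ a → 1ℤ - a + a ≡ 1ℤ
      cancel = solve-∀
    δ-block : ∀ j i → δ m (0ℤ - + q * (j * + m′ + i)) ≡ δ m′ i
    δ-block j i = δ-cong
      (λ d → ∣m+n∣m⇒∣n (*-cancelˡ-∣ (+ p) {+ m′} {j * + m′ + i} (subst₂ _∣_ m≡ (eq₁ (j * + m′ + i)) (∣m⇒∣-m d))) (∣n⇒∣m*n j ∣-refl))
      (λ d → subst₂ _∣_ (sym m≡) (eq₂ (j * + m′ + i)) (∣m⇒∣-m (*-monoʳ-∣ (+ p) (∣m∣n⇒∣m+n (∣n⇒∣m*n j ∣-refl) d))))
      where
      eq₁′ : ∀ p x → - (0ℤ - p * x) ≡ p * x
      eq₁′ = solve-∀
      eq₁ : ∀ x → - (0ℤ - + q * x) ≡ + p * x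
      eq₁ x = trans (eq₁′ (+ q) x) (cong (_* x) q≡p)
      eq₂′ : ∀ p x → - (p * x) ≡ 0ℤ - p * x
      eq₂′ = solve-∀
      eq₂ : ∀ x → - (+ p * x) ≡ 0ℤ - + q * x
      eq₂ x = trans (eq₂′ (+ p) x) (cong (λ w → 0ℤ - w * x) (sym q≡p))
    at-0 : fn (B ↑ q) 0ℤ ≡ ∑ p (λ j → b (j * + m′)) [mod p ]
    at-0 = mod-trans (frobenius pp 1 B 0ℤ) (mod-reflexive (trans
      (∑-blocks p m′ (λ h → b h * δ m (0ℤ - + q * h)))
      (∑-cong p (λ j → begin
        ∑ m′ (λ i → b (j * + m′ + i) * δ m (0ℤ - + q * (j * + m′ + i))) ≡⟨ ∑-cong m′ (λ i → trans (cong (b (j * + m′ + i) *_) (δ-block j i)) (*-comm (b (j * + m′ + i)) (δ m′ i))) ⟩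
        ∑ m′ (λ i → δ m′ i * b (j * + m′ + i))                          ≡⟨ ∑-δ m′ (λ i → b (j * + m′ + i)) ⟩
        b (j * + m′ + 0ℤ)                                               ≡⟨ cong b (+-identityʳ (j * + m′)) ⟩
        b (j * + m′)                                                    ∎))))

  -- The window is shifted to -k, ..., k, where the terms at j and -j agree; the induction peels off
  -- both ends at once.
  ∑-even : ∀ k {f} → Periodic (suc (k ℕ.+ k)) f → (∀ x → f (- x) ≡ f x) →
    ∑ (suc (k ℕ.+ k)) f ≡ f 0ℤ + (+ 2 * ∑ k (λ x → f (+ 1 + x)))
  ∑-even k {f} pf even = trans (sym (∑-shift pf (- + k))) (centred k)
    where
    centred : ∀ k → ∑ (suc (k ℕ.+ k)) (λ x → f (- + k + x)) ≡ f 0ℤ + (+ 2 * ∑ k (λ x → f (+ 1 + x)))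
    centred zero    = +-comm 0ℤ (f 0ℤ)
    centred (suc k) = begin
      ∑ (suc (suc k ℕ.+ suc k)) g                          ≡⟨ cong (λ w → ∑ (suc (suc w)) g) (ℕ.+-suc k k) ⟩
      ∑ (suc (suc (k ℕ.+ k))) g + g (+ suc (suc (k ℕ.+ k))) ≡⟨ cong (_+ g (+ suc (suc (k ℕ.+ k)))) (∑-front (suc (k ℕ.+ k)) g) ⟩
      (g 0ℤ + ∑ (suc (k ℕ.+ k)) (λ x → g (+ 1 + x))) + g (+ suc (suc (k ℕ.+ k)))
        ≡⟨ cong₂ _+_ (cong₂ _+_ (trans (cong f (+-identityʳ (- + suc k))) (even (+ suc k)))
                                (trans (∑-cong (suc (k ℕ.+ k)) (λ x → cong f (lemma₁ (+ k) x))) (centred k)))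
                     (cong f (lemma₂ (+ k))) ⟩
      (f (+ suc k) + (f 0ℤ + (+ 2 * ∑ k (λ x → f (+ 1 + x))))) + f (+ suc k)
        ≡⟨ lemma₃ (f 0ℤ) (f (+ suc k)) (∑ k (λ x → f (+ 1 + x))) ⟩
      f 0ℤ + (+ 2 * ∑ (suc k) (λ x → f (+ 1 + x)))         ∎
      where
      g : ℤ → ℤ
      g x = f (- + suc k + x)
      lemma₁ : ∀ k x → - (+ 1 + k) + (+ 1 + x) ≡ - k + x
      lemma₁ = solve-∀
      lemma₂ : ∀ k → - (+ 1 + k) + (+ 2 + (k + k)) ≡ + 1 + k
      lemma₂ = solve-∀
      lemma₃ : ∀ a b s → (b + (a + + 2 * s)) + b ≡ a + + 2 * (s + b)
      lemma₃ = solve-∀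

  -- Functions with B∗B = sB + c

  odd⇒1+2k : ∀ {p} → ¬ (2 ℕ.∣ p) → ∃ λ k → p ≡ suc (k ℕ.+ k)
  odd⇒1+2k {p} 2∤p with p ℕ.% 2 in eq | m%n<n p 2
  ... | 0 | _ = contradiction (ℕ.m%n≡0⇒n∣m p 2 eq) 2∤p
  ... | 1 | _ = p ℕ./ 2 , (begin
    p                                 ≡⟨ m≡m%n+[m/n]*n p 2 ⟩
    p ℕ.% 2 ℕ.+ p ℕ./ 2 ℕ.* 2         ≡⟨ cong₂ ℕ._+_ eq (trans (ℕ.*-comm (p ℕ./ 2) 2) (cong (p ℕ./ 2 ℕ.+_) (ℕ.+-identityʳ (p ℕ./ 2)))) ⟩
    suc (p ℕ./ 2 ℕ.+ p ℕ./ 2)         ∎)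
  ... | suc (suc _) | ℕ.s≤s (ℕ.s≤s ())

  ∑-of-0,-1 : ∀ k f → (∀ i → i ℕ.< k → f (+ i) ≡ 0ℤ ⊎ f (+ i) ≡ -1ℤ) → ∃ λ a → a ℕ.≤ k × ∑ k f ≡ - + a
  ∑-of-0,-1 zero    f h = 0 , ℕ.z≤n , refl
  ∑-of-0,-1 (suc k) f h with ∑-of-0,-1 k f (λ i i<k → h i (ℕ.m<n⇒m<1+n i<k)) | h k (ℕ.n<1+n k)
  ... | a , a≤k , eq | inj₁ z = a , ℕ.m≤n⇒m≤1+n a≤k , trans (cong₂ _+_ eq z) (+-identityʳ _)
  ... | a , a≤k , eq | inj₂ z = suc a , ℕ.s≤s a≤k , trans (cong₂ _+_ eq z) (lemma (+ a))
    where
    lemma : ∀ a → - a + -1ℤ ≡ - (+ 1 + a)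
    lemma = solve-∀

  -- The sign of 1 - 2a changes between a = 0 and a = 1, hence two cases. For `suc a` the number is
  -- `-[1+ a + a ]`, visibly nonzero, and the bound by k keeps its absolute value below 2k + 1.
  p∤1-2a : ∀ {p a k} → p ≡ suc (k ℕ.+ k) → 1 ℕ.< p → a ℕ.≤ k → ¬ (+ p ∣ 1ℤ + (+ 2 * (- + a)))
  p∤1-2a {p} {zero}  eq 1<p a≤k = ∣∣<⇒∤ (λ ()) 1<p
  p∤1-2a {p} {suc a} {k} eq 1<p a≤k d = ∣∣<⇒∤ {p} { -[1+ a ℕ.+ a ]} (λ ())
    (subst (suc (a ℕ.+ a) ℕ.<_) (sym eq) (ℕ.s≤s (ℕ.+-mono-≤ a≤k (ℕ.≤-trans (ℕ.n≤1+n a) a≤k))))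
    (subst (+ p ∣_) (lemma (+ a)) d)
    where
    lemma : ∀ a → 1ℤ + (+ 2 * (- (+ 1 + a))) ≡ - (+ 1 + (a + a))
    lemma = solve-∀

  module _ {p : ℕ} (pp : Prime p) (2∤p : ¬ (2 ℕ.∣ p)) (γ : ℕ) where
    private
      m′ = p ℕ.^ γ
      m  = p ℕ.^ suc γ
      instance
        p≢0 : ℕ.NonZero p
        p≢0 = prime⇒nonZero pp
        m≢0 : ℕ.NonZero m
        m≢0 = ℕ.m^n≢0 p (suc γ)
        m′≢0 : ℕ.NonZero m′
        m′≢0 = ℕ.m^n≢0 p γ

    p∤2 : ¬ (+ p ∣ + 2)
    p∤2 = ∣∣<⇒∤ (λ ()) (ℕ.≤∧≢⇒< (prime>1 pp) (λ eq → 2∤p (subst (2 ℕ.∣_) eq ℕ.∣-refl)))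

    -- If p ∤ s, the equation factors as (b - sδ)∗b = c and one factor is invertible modulo p, which
    -- makes the other constant. If p ∣ s, the square b∗b is itself constant modulo p.
    three-values-impossible : ∀ {b} → Periodic m b → (∀ x → b (- x) ≡ b x) → b 0ℤ ≡ 1ℤ →
      (∀ x → ¬ (+ m ∣ x) → b x ≡ 0ℤ ⊎ b x ≡ -1ℤ) → ∀ s c → (∀ x → conv m b b x ≡ s * b x + c) →
      ∀ g₁ g₂ → b g₁ ≡ -1ℤ → ¬ (b g₂ ≡ 0ℤ)
    three-values-impossible {b} pb even b0 values s c b*b g₁ g₂ bg₁ bg₂ with + p ∣? s
    ... | no p∤s = absurd
      where
      m∣⇒1 : ∀ {x} → + m ∣ x → b x ≡ 1ℤ
      m∣⇒1 {x} d = trans (periodic-≡ pb (subst (+ m ∣_) (sym (+-identityʳ x)) d)) b0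
      δg₁ : δ m g₁ ≡ 0ℤ
      δg₁ = δ-no (λ d → case trans (sym bg₁) (m∣⇒1 d) of λ ())
      δg₂ : δ m g₂ ≡ 0ℤ
      δg₂ = δ-no (λ d → case trans (sym bg₂) (m∣⇒1 d) of λ ())
      -- The cofactor b - sδ. Its coefficient sum differs from that of b by s, so p cannot divide
      -- both.
      h : ℤ → ℤ
      h x = - s * δ m x + b x
      ph : Periodic m h
      ph = periodic-+ (periodic-* (periodic-const (- s)) (δ-periodic m)) pb
      lemma : ∀ s b c → - s * b + (s * b + c) ≡ c
      lemma = solve-∀
      h*b : ∀ x → conv m h b x ≡ c
      h*b x = begin
        conv m h b x                                       ≡⟨ conv-distribˡ m (λ y → - s * δ m y) b b x ⟩
        conv m (λ y → - s * δ m y) b x + conv m b b x      ≡⟨ cong₂ _+_ (conv-*ˡ m (- s) (δ m) b x) (b*b x) ⟩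
        - s * conv m (δ m) b x + (s * b x + c)             ≡⟨ cong (λ w → - s * w + (s * b x + c)) (trans (∑-δ m (λ i → b (x - i))) (cong b (+-identityʳ x))) ⟩
        - s * b x + (s * b x + c)                          ≡⟨ lemma s (b x) c ⟩
        c                                                  ∎
      εh : ∑ m h ≡ - s + ∑ m b
      εh = trans (∑-+ m _ b) (cong (_+ ∑ m b) (trans (∑-cong m (λ x → *-comm (- s) (δ m x))) (∑-δ m (λ _ → - s))))
      absurd : _
      absurd with + p ∣? ∑ m b
      -- Neither g₁ nor g₂ is 0 in ℤ/m, so the correction by δ drops out and -1 and 0 would be
      -- congruent modulo p.
      ... | no p∤ε = ∣∣<⇒∤ {p} { -1ℤ} (λ ()) (prime>1 pp) (subst (+ p ∣_)
        (trans (cong₂ _-_ (cong₂ (λ u v → - s * u + v) δg₁ bg₁) (cong₂ (λ u v → - s * u + v) δg₂ bg₂)) (eval s))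
        (difference (constant-factor pp (suc γ) pb ph c (λ x → trans (conv-comm pb ph x) (h*b x)) p∤ε g₁ g₂)))
        where
        eval : ∀ s → (- s * 0ℤ + -1ℤ) - (- s * 0ℤ + 0ℤ) ≡ -1ℤ
        eval = solve-∀
      -- Here b itself is constant modulo p, so its values 1 at 0 and -1 at g₁ would differ by a
      -- multiple of p.
      ... | yes p∣ε = p∤2 (subst (+ p ∣_) (cong₂ _-_ b0 bg₁)
        (difference (constant-factor pp (suc γ) ph pb c h*b p∤εh 0ℤ g₁)))
        where
        p∤εh : ¬ (+ p ∣ ∑ m h)
        p∤εh d = p∤s (subst (+ p ∣_) (neg-involutive s) (∣m⇒∣-m (∣m+n∣n⇒∣m (subst (+ p ∣_) εh d) p∣ε)))
    -- On the multiples of m′ the value at 0 is 1 and the others pair off; a counts the value -1 in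
    -- one half, so the sum is 1 - 2a.
    ... | yes (divides s′ s≡) = p∤1-2a {p} {a} p≡ (prime>1 pp) a≤k
        (subst (+ p ∣_) (trans (trans (cong (λ w → ∑ w β) p≡) (∑-even k (subst (λ w → Periodic w β) p≡ pβ) evenβ)) (cong₂ (λ u v → u + (+ 2 * v)) b0 ∑≡))
          (square-constant⇒∑-torsion pp γ pb c (λ x → mkMod (divides (s′ * b x) (trans (cong (_- c) (b*b x)) (trans (cong (λ w → w * b x + c - c) s≡) (lemma s′ (+ p) (b x) c)))))))
      where
      lemma : ∀ s p b c → s * p * b + c - c ≡ s * b * p
      lemma = solve-∀
      β : ℤ → ℤ
      β j = b (j * + m′)
      pβ : Periodic p β
      pβ .step x = trans (cong b (trans (*-distribʳ-+ (+ m′) x (+ p)) (cong (_+_ (x * + m′)) (sym (pos-* p m′))))) (step pb (x * + m′))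
      evenβ : ∀ x → β (- x) ≡ β x
      evenβ x = trans (cong b (sym (neg-distribˡ-* x (+ m′)))) (even (x * + m′))
      k  = proj₁ (odd⇒1+2k 2∤p)
      p≡ : p ≡ suc (k ℕ.+ k)
      p≡ = proj₂ (odd⇒1+2k 2∤p)
      β-values : ∀ i → i ℕ.< k → β (+ suc i) ≡ 0ℤ ⊎ β (+ suc i) ≡ -1ℤ
      β-values i i<k = values (+ suc i * + m′) λ d →
        ∤-between {p} {suc i} (ℕ.s≤s ℕ.z≤n) (subst (suc i ℕ.<_) (sym p≡) (ℕ.s≤s (ℕ.≤-trans i<k (ℕ.m≤m+n k k))))
          (*-cancelʳ-∣ (+ m′) (subst (_∣ + suc i * + m′) (pos-* p m′) d))
      sum = ∑-of-0,-1 k (λ x → β (+ 1 + x)) β-values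
      a    = proj₁ sum
      a≤k  = proj₁ (proj₂ sum)
      ∑≡   = proj₂ (proj₂ sum)

  -- Equality in the Cauchy–Schwarz inequality: ∑ₕ (B(h) − B(g−h))² = 2 ((B∗B)(0) − (B∗B)(g)).
  maximal⇒period : ∀ {n} .{{_ : ℕ.NonZero n}} {B} → Periodic n B → (∀ x → B (- x) ≡ B x) →
    ∀ g → conv n B B g ≡ conv n B B 0ℤ → ∀ x → B (x + g) ≡ B x
  maximal⇒period {n} {B} pB even g eq x = begin
    B (x + g)     ≡⟨ cong B (lemma₃ x g) ⟩
    B (g - - x)   ≡⟨ sym (i-j≡0⇒i≡j (B (- x)) (B (g - - x)) (square≡0 _ (∑-zero pD D≥0 total (- x)))) ⟩
    B (- x)       ≡⟨ even x ⟩
    B x           ∎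
    where
    lemma₃ : ∀ x g → x + g ≡ g - - x
    lemma₃ = solve-∀
    D : ℤ → ℤ
    D h = (B h - B (g - h)) * (B h - B (g - h))
    pd : Periodic n (λ h → B h - B (g - h))
    pd = periodic-+ pB (periodic-neg (periodic-flip pB g))
    pD : Periodic n D
    pD = periodic-* pd pd
    square≥0 : ∀ a → 0ℤ ≤ a * a
    square≥0 (+ a)    = subst (0ℤ ≤_) (pos-* a a) (+≤+ ℕ.z≤n)
    square≥0 -[1+ a ] = +≤+ ℕ.z≤n
    D≥0 : ∀ h → 0ℤ ≤ D h
    D≥0 h = square≥0 (B h - B (g - h))
    square≡0 : ∀ a → a * a ≡ 0ℤ → a ≡ 0ℤ
    square≡0 a eq = [ (λ e → e) , (λ e → e) ]′ (i*j≡0⇒i≡0∨j≡0 a eq)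
    expand : ∀ a b → (a - b) * (a - b) ≡ (a * a + b * b) + (- + 2) * (a * b)
    expand = solve-∀
    Q : ℤ → ℤ
    Q h = B h * B h
    Q≡ : conv n B B 0ℤ ≡ ∑ n Q
    Q≡ = ∑-cong n (λ h → cong (B h *_) (trans (cong B (+-identityˡ (- h))) (even h)))
    final : ∀ q → (q + q) + (- + 2) * q ≡ 0ℤ
    final = solve-∀
    total : ∑ n D ≡ 0ℤ
    total = begin
      ∑ n D                                                                     ≡⟨ ∑-cong n (λ h → expand (B h) (B (g - h))) ⟩
      ∑ n (λ h → (Q h + Q (g - h)) + (- + 2) * (B h * B (g - h)))               ≡⟨ ∑-+ n (λ h → Q h + Q (g - h)) (λ h → (- + 2) * (B h * B (g - h))) ⟩
      ∑ n (λ h → Q h + Q (g - h)) + ∑ n (λ h → (- + 2) * (B h * B (g - h)))     ≡⟨ cong₂ _+_ (trans (∑-+ n Q (λ h → Q (g - h))) (cong (_+_ (∑ n Q)) (∑-flip (periodic-* pB pB) g))) (trans (∑-*ˡ n (- + 2) (λ h → B h * B (g - h))) (cong (- + 2 *_) (trans eq Q≡))) ⟩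
      (∑ n Q + ∑ n Q) + (- + 2) * ∑ n Q                                         ≡⟨ final (∑ n Q) ⟩
      0ℤ                                                                        ∎

  -- Subgroups of ℤ containing a power of p

  divisor-of-prime-power : ∀ {p} → Prime p → ∀ k d → d ℕ.∣ p ℕ.^ suc k → d ≡ p ℕ.^ suc k ⊎ d ℕ.∣ p ℕ.^ k
  divisor-of-prime-power {p} pp k d (ℕ.divides q eq) with p ℕ.∣? q
  -- Everything depends on the cofactor q of d: if p divides it, one p is cancelled; otherwise q is
  -- coprime to p, divides a power of p, and is therefore 1.
  ... | yes (ℕ.divides q′ refl) = inj₂ (ℕ.divides q′ (ℕ.*-cancelˡ-≡ (p ℕ.^ k) (q′ ℕ.* d) p {{prime⇒nonZero pp}}
    (trans eq (trans (cong (ℕ._* d) (ℕ.*-comm q′ p)) (ℕ.*-assoc p q′ d)))))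
  ... | no p∤q = inj₁ (trans (sym (ℕ.*-identityˡ d)) (trans (cong (ℕ._* d) (sym q≡1)) (sym eq)))
    where
    q⊥p : Coprime q p
    q⊥p (e∣q , e∣p) = [ (λ e≡1 → e≡1) , (λ e≡p → contradiction (subst (ℕ._∣ q) e≡p e∣q) p∤q) ]′ (prime⇒irreducible pp e∣p)
    cancel : ∀ j → q ℕ.∣ p ℕ.^ j → q ≡ 1
    cancel zero    q∣1 = ℕ.∣1⇒≡1 q∣1
    cancel (suc j) q∣  = cancel j (coprime-divisor q⊥p q∣)
    q≡1 : q ≡ 1
    q≡1 = cancel (suc k) (ℕ.divides d (trans eq (ℕ.*-comm q d)))

  pos-difference : ∀ d u v → d ℕ.+ u ≡ v → + v - + u ≡ + d
  pos-difference d u _ refl = cancel (+ d) (+ u)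
    where
    cancel : ∀ d u → d + u - u ≡ d
    cancel = solve-∀

  -- The element 0 is produced from a member as a + (-a).
  record IsSubgroup (P : ℤ → Set) : Set where
    field
      sum : ∀ {a b} → P a → P b → P (a + b)
      neg : ∀ {a} → P a → P (- a)

    ℕmultiple : ∀ k {a} → P a → P (+ k * a)
    ℕmultiple zero    {a} Pa = subst P (+-inverseʳ a) (sum Pa (neg Pa))
    ℕmultiple (suc k) {a} Pa = subst P (lemma (+ k) a) (sum (ℕmultiple k Pa) Pa)
      where
      lemma : ∀ k a → k * a + a ≡ (+ 1 + k) * a
      lemma = solve-∀

    ∣-closed : ∀ {a b} → a ∣ b → P a → P b
    ∣-closed     (divides (+ k)    eq) Pa = subst P (sym eq) (ℕmultiple k Pa)
    ∣-closed {a} (divides -[1+ k ] eq) Pa = subst P (trans (neg-distribˡ-* (+ suc k) a) (sym eq)) (neg (ℕmultiple (suc k) Pa))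

    gcd-closed : ∀ {a b} → P (+ a) → P (+ b) → P (+ gcd a b)
    gcd-closed {a} {b} Pa Pb with Bézout.identity (gcd-GCD a b)
    ... | Bézout.+- x y eq = subst P (pos-difference (gcd a b) (y ℕ.* b) (x ℕ.* a) eq)
                                     (sum (subst P (sym (pos-* x a)) (ℕmultiple x Pa)) (neg (subst P (sym (pos-* y b)) (ℕmultiple y Pb))))
    ... | Bézout.-+ x y eq = subst P (pos-difference (gcd a b) (x ℕ.* a) (y ℕ.* b) eq)
                                     (sum (subst P (sym (pos-* y b)) (ℕmultiple y Pb)) (neg (subst P (sym (pos-* x a)) (ℕmultiple x Pa))))

  open IsSubgroup

  -- Descends through the powers of p as long as they lie in P. Where the next power is missing, a
  -- member x not divisible by the current one would have, by Bézout, a gcd in P dividing that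
  -- missing power.
  subgroup-generator : ∀ {p} → Prime p → ∀ α {P} → IsSubgroup P → (∀ x → Dec (P x)) → P (+ (p ℕ.^ α)) →
    ∃ λ γ → γ ℕ.≤ α × P (+ (p ℕ.^ γ)) × (∀ x → P x → + (p ℕ.^ γ) ∣ x)
  subgroup-generator pp zero G P? Pn = 0 , ℕ.z≤n , Pn , (λ x _ → divides x (sym (*-identityʳ x)))
  subgroup-generator {p} pp (suc α) {P} G P? Pn with P? (+ (p ℕ.^ α))
  ... | yes Pn′ = let γ , γ≤α , Pγ , gen = subgroup-generator pp α G P? Pn′ in γ , ℕ.m≤n⇒m≤1+n γ≤α , Pγ , gen
  ... | no ¬Pn′ = suc α , ℕ.≤-refl , Pn , generates
    where
    generates : ∀ x → P x → + (p ℕ.^ suc α) ∣ x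
    generates x Px with divisor-of-prime-power pp α (gcd ∣ x ∣ (p ℕ.^ suc α)) (gcd[m,n]∣n ∣ x ∣ (p ℕ.^ suc α))
    ... | inj₁ d≡  = ∣ᵤ⇒∣ (subst (ℕ._∣ ∣ x ∣) d≡ (gcd[m,n]∣m ∣ x ∣ (p ℕ.^ suc α)))
    ... | inj₂ d∣n = contradiction (∣-closed G (∣ᵤ⇒∣ d∣n) (gcd-closed G {∣ x ∣} {p ℕ.^ suc α} (∣-closed G m∣∣m∣ Px) Pn)) ¬Pn′

  -- Compares ℤ/rm with its quotient ℤ/m; the factor r is the order of the kernel.
  conv-refine : ∀ r m {f g} → Periodic m f → Periodic m g → ∀ x → conv (r ℕ.* m) f g x ≡ + r * conv m f g x
  conv-refine r m {f} {g} pf pg x = begin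
    ∑ (r ℕ.* m) (λ h → f h * g (x - h))                                      ≡⟨ ∑-blocks r m (λ h → f h * g (x - h)) ⟩
    ∑ r (λ j → ∑ m (λ i → f (j * + m + i) * g (x - (j * + m + i))))          ≡⟨ ∑-cong r (λ j → ∑-cong m (λ i → cong₂ _*_ (reduce pf j i) (reduce (periodic-flip pg x) j i))) ⟩
    ∑ r (λ _ → conv m f g x)                                                 ≡⟨ ∑-const r _ ⟩
    + r * conv m f g x                                                       ∎
    where
    reduce : ∀ {f} → Periodic m f → ∀ j i → f (j * + m + i) ≡ f i
    reduce {f} pf j i = trans (cong f (+-comm (j * + m) i)) (periodic-multiple pf j i)

  -- The quotient by the stabiliser of B

  TernaryValued : (ℤ → ℤ) → Set
  TernaryValued B = ∀ x → B x ≡ 1ℤ ⊎ B x ≡ 0ℤ ⊎ B x ≡ -1ℤ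

  module _ {p : ℕ} (pp : Prime p) (2∤p : ¬ (2 ℕ.∣ p)) (α : ℕ) where
    private
      n = p ℕ.^ α
      instance
        p≢0 : ℕ.NonZero p
        p≢0 = prime⇒nonZero pp
        n≢0 : ℕ.NonZero n
        n≢0 = ℕ.m^n≢0 p α

    -- The number p^γ generates the set where B is 1. The clause `rigid` asks for γ ≥ 1 because the
    -- torsion argument works with a subgroup of order p in ℤ/p^γ; γ = 0 is excluded later by the
    -- zeros of B.
    record Stabilised (B : ℤ → ℤ) : Set where
      field
        γ        : ℕ
        γ≤α      : γ ℕ.≤ α
        periodic : Periodic (p ℕ.^ γ) B
        1⇒∣      : ∀ x → B x ≡ 1ℤ → + (p ℕ.^ γ) ∣ x
        rigid    : 1 ℕ.≤ γ → ∀ g₁ g₂ → B g₁ ≡ -1ℤ → ¬ (B g₂ ≡ 0ℤ)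

    stabilise : ∀ {B} → Periodic n B → (∀ x → B (- x) ≡ B x) → B 0ℤ ≡ 1ℤ → TernaryValued B →
      ∀ s c → (∀ x → conv n B B x ≡ s * B x + c) → Stabilised B
    stabilise {B} pB even B0 values s c B*B = record
      { γ = γ ; γ≤α = γ≤α ; periodic = pBm ; 1⇒∣ = gen ; rigid = rigid }
      where
      periods : ∀ {g} → B g ≡ 1ℤ → ∀ x → B (x + g) ≡ B x
      periods {g} Bg = maximal⇒period pB even g (trans (B*B g) (trans (cong (λ w → s * w + c) (trans Bg (sym B0))) (sym (B*B 0ℤ))))
      G : IsSubgroup (λ x → B x ≡ 1ℤ)
      G .sum Ba Bb = trans (periods Bb _) Ba
      G .neg Ba    = trans (even _) Ba
      generator = subgroup-generator pp α G (λ x → B x ≟ 1ℤ) (trans (cong B (sym (+-identityˡ (+ n)))) (trans (step pB 0ℤ) B0))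
      γ   = proj₁ generator
      γ≤α = proj₁ (proj₂ generator)
      m   = p ℕ.^ γ
      pBm : Periodic m B
      pBm .step = periods (proj₁ (proj₂ (proj₂ generator)))
      gen = proj₂ (proj₂ (proj₂ generator))
      r = p ℕ.^ (α ℕ.∸ γ)
      n≡ : n ≡ r ℕ.* m
      n≡ = power-quotient p γ≤α
      B*B′ : ∀ x → + r * conv m B B x ≡ s * B x + c
      B*B′ x = trans (sym (conv-refine r m pBm pBm x)) (trans (cong (λ w → conv w B B x) (sym n≡)) (B*B x))
      rigid : 1 ℕ.≤ γ → ∀ g₁ g₂ → B g₁ ≡ -1ℤ → ¬ (B g₂ ≡ 0ℤ)
      rigid 1≤γ g₁ g₂ Bg₁ Bg₂ = positive-exponent γ 1≤γ pBm not-1 b*b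
        where
        -- On the quotient the equation reads r (B∗B) = sB + c. Its values at g₂, where B is 0, and
        -- at 0, where B is 1, show that r divides c and s, so that r can be cancelled.
        v = conv m B B g₂
        c≡ : c ≡ + r * v
        c≡ = sym (trans (B*B′ g₂) (trans (cong (λ w → s * w + c) Bg₂) (trans (cong (_+ c) (*-zeroʳ s)) (+-identityˡ c))))
        s′ = conv m B B 0ℤ - v
        s≡ : s ≡ + r * s′
        s≡ = begin
          s                                       ≡⟨ lemma₁ s c ⟩
          (s * 1ℤ + c) - c                        ≡⟨ cong₂ _-_ (trans (cong (λ w → s * w + c) (sym B0)) (sym (B*B′ 0ℤ))) c≡ ⟩
          + r * conv m B B 0ℤ - + r * v           ≡⟨ lemma₂ (+ r) (conv m B B 0ℤ) v ⟩
          + r * s′                                ∎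
          where
          lemma₁ : ∀ s c → s ≡ (s * 1ℤ + c) - c
          lemma₁ = solve-∀
          lemma₂ : ∀ r a b → r * a - r * b ≡ r * (a - b)
          lemma₂ = solve-∀
        instance
          r≢0 : ℕ.NonZero r
          r≢0 = ℕ.m^n≢0 p (α ℕ.∸ γ)
        b*b : ∀ x → conv m B B x ≡ s′ * B x + v
        b*b x = *-cancelˡ-≡ (+ r) _ _ (trans (B*B′ x) (trans (cong₂ (λ u w → u * B x + w) s≡ c≡) (lemma (+ r) s′ (B x) v)))
          where
          lemma : ∀ r s b v → r * s * b + r * v ≡ r * (s * b + v)
          lemma = solve-∀
        not-1 : ∀ x → ¬ (+ m ∣ x) → B x ≡ 0ℤ ⊎ B x ≡ -1ℤ
        not-1 x m∤x = [ (λ e → contradiction (gen x e) m∤x) , (λ e → e) ]′ (values x)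
        -- Restated for a variable exponent, so that it can be matched with a successor.
        positive-exponent : ∀ γ → 1 ℕ.≤ γ → let m = p ℕ.^ γ in Periodic m B →
          (∀ x → ¬ (+ m ∣ x) → B x ≡ 0ℤ ⊎ B x ≡ -1ℤ) → (∀ x → conv m B B x ≡ s′ * B x + v) → ⊥
        positive-exponent (suc k) _ pB not-1 b*b = three-values-impossible pp 2∤p k pB even B0 not-1 s′ v b*b g₁ g₂ Bg₁ Bg₂

  -- Classification of the solutions of the dihedral equations

  BinaryValued : (ℤ → ℤ) → Set
  BinaryValued f = ∀ x → f x ≡ 0ℤ ⊎ f x ≡ 1ℤ

  binary-≥0 : ∀ {a} → a ≡ 0ℤ ⊎ a ≡ 1ℤ → 0ℤ ≤ a
  binary-≥0 (inj₁ refl) = +≤+ ℕ.z≤n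
  binary-≥0 (inj₂ refl) = +≤+ ℕ.z≤n

  binary-idem : ∀ {a} → a ≡ 0ℤ ⊎ a ≡ 1ℤ → a * a ≡ a
  binary-idem (inj₁ refl) = refl
  binary-idem (inj₂ refl) = refl

  -- On the support of f the other factor is the constant c. This evaluates most convolutions with
  -- the indicator of a subgroup.
  ∑-absorb : ∀ n (f g : ℤ → ℤ) c → (∀ h → f h ≡ 0ℤ ⊎ g h ≡ c) → ∑ n (λ h → f h * g h) ≡ ∑ n f * c
  ∑-absorb n f g c cases = trans (∑-cong n pointwise) (∑-*ʳ n c f)
    where
    pointwise : ∀ h → f h * g h ≡ f h * c
    pointwise h with cases h
    ... | inj₁ fh≡0 = trans (cong (_* g h) fh≡0) (trans (*-zeroˡ (g h)) (sym (trans (cong (_* c) fh≡0) (*-zeroˡ c))))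
    ... | inj₂ gh≡c = cong (f h *_) gh≡c

  δ-binary : ∀ m → BinaryValued (δ m)
  δ-binary m x = binary (+ m ∣? x)
    where
    binary : {A : Set} (A? : Dec A) → ⟦ A? ⟧ ≡ 0ℤ ⊎ ⟦ A? ⟧ ≡ 1ℤ
    binary (yes _) = inj₂ refl
    binary (no _)  = inj₁ refl

  δ≡1⇒∣ : ∀ {m x} → δ m x ≡ 1ℤ → + m ∣ x
  δ≡1⇒∣ {m} {x} eq = decidable-stable (+ m ∣? x) (λ ¬d → case trans (sym eq) (δ-no ¬d) of λ ())

  reflect : (ℤ → ℤ) → ℤ → ℤ
  reflect f x = f (- x)

  -- The two components of A² = tI + λA + μ(J − I − A), with τ = t − μ and d = λ − μ.
  record DihedralEquations (n : ℕ) (x y : ℤ → ℤ) (τ d μ : ℤ) : Set where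
    field
      rotations   : ∀ g → conv n x x g + conv n y (reflect y) g ≡ τ * δ n g + d * x g + μ
      reflections : ∀ g → conv n x y g + conv n y (reflect x) g ≡ d * y g + μ
  open DihedralEquations

  record Classified (p α : ℕ) (y z : ℤ → ℤ) : Set where
    field
      γ          : ℕ
      1≤γ        : 1 ℕ.≤ γ
      γ≤α        : γ ℕ.≤ α
      y-periodic : Periodic (p ℕ.^ γ) y
      y-skew     : ∀ g → y g + y (- g) ≡ 1ℤ + δ (p ℕ.^ γ) g
      z-shape    : (∀ g → z g ≡ δ (p ℕ.^ α) g) ⊎ (∀ g → z g ≡ δ (p ℕ.^ γ) g)

  -- The hypothesis `genuine` is k ≠ t: the sums of x and y add up to the degree, and τ + μ = t.
  module Classification {p : ℕ} (pp : Prime p) (2∤p : ¬ (2 ℕ.∣ p)) (α : ℕ)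
    {x y z : ℤ → ℤ} (px : Periodic (p ℕ.^ α) x) (py : Periodic (p ℕ.^ α) y) (pz : Periodic (p ℕ.^ α) z)
    (y≡ : ∀ g → y g ≡ x g + z g) (bx : BinaryValued x) (by : BinaryValued y) (bz : BinaryValued z)
    (y0 : y 0ℤ ≡ 1ℤ) (x0 : x 0ℤ ≡ 0ℤ) (z-even : ∀ g → z (- g) ≡ z g)
    {τ d μ : ℤ} (E : DihedralEquations (p ℕ.^ α) x y τ d μ)
    (genuine : ∑ (p ℕ.^ α) x + ∑ (p ℕ.^ α) y ≢ τ + μ)
    where
    private
      n = p ℕ.^ α
      instance
        n≢0 : ℕ.NonZero n
        n≢0 = ℕ.m^n≢0 p α {{prime⇒nonZero pp}}
      x′ = reflect x
      y′ = reflect y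
      px′ = periodic-reflect px
      py′ = periodic-reflect py

    y′≡ : ∀ g → y′ g ≡ x′ g + z g
    y′≡ g = trans (y≡ (- g)) (cong (_+_ (x′ g)) (z-even g))

    -- After substituting y = x + z and y′ = x′ + z, all products involving x or x′ cancel in the
    -- difference of the two equations.
    z*z : ∀ g → conv n z z g ≡ τ * δ n g - d * z g
    z*z g = begin
      zz                                                ≡⟨ lemma₁ xx xx′ xz zx′ zz ⟩
      (xx + ((xx′ + xz) + (zx′ + zz))) - ((xx + xz) + (xx′ + zx′)) ≡⟨ cong₂ _-_ (trans (cong (_+_ xx) (sym yy′)) (rotations E g)) (trans (cong₂ _+_ (sym xy) (sym yx′)) (reflections E g)) ⟩
      (τ * δ n g + d * x g + μ) - (d * y g + μ)         ≡⟨ cong (λ w → (τ * δ n g + d * x g + μ) - (d * w + μ)) (y≡ g) ⟩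
      (τ * δ n g + d * x g + μ) - (d * (x g + z g) + μ) ≡⟨ lemma₂ (τ * δ n g) d (x g) (z g) μ ⟩
      τ * δ n g - d * z g                               ∎
      where
      xx  = conv n x x g
      xx′ = conv n x x′ g
      xz  = conv n x z g
      zx′ = conv n z x′ g
      zz  = conv n z z g
      lemma₁ : ∀ a b c d e → e ≡ (a + ((b + c) + (d + e))) - ((a + c) + (b + d))
      lemma₁ = solve-∀
      lemma₂ : ∀ a d x z μ → (a + d * x + μ) - (d * (x + z) + μ) ≡ a - d * z
      lemma₂ = solve-∀
      yy′ : conv n y y′ g ≡ (xx′ + xz) + (zx′ + zz)
      yy′ = trans (conv-cong n y≡ y′≡ g) (trans (conv-distribˡ n x z (λ h → x′ h + z h) g)
              (cong₂ _+_ (conv-distribʳ n x x′ z g) (conv-distribʳ n z x′ z g)))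
      xy : conv n x y g ≡ xx + xz
      xy = trans (conv-cong n {f = x} (λ _ → refl) y≡ g) (conv-distribʳ n x x z g)
      yx′ : conv n y x′ g ≡ xx′ + zx′
      yx′ = trans (conv-cong n {g = x′} y≡ (λ _ → refl) g) (conv-distribˡ n x z x′ g)

    B : ℤ → ℤ
    B g = y g + y′ g - 1ℤ

    pB : Periodic n B
    pB = periodic-+ (periodic-+ py py′) (periodic-const -1ℤ)

    B-even : ∀ g → B (- g) ≡ B g
    B-even g = cong (_- 1ℤ) (trans (cong (λ w → y (- g) + y w) (neg-involutive g)) (+-comm (y (- g)) (y g)))

    -- Convolution commutes, so the reflection equation has y as a common factor, and w is the
    -- function that multiplies it.
    w : ℤ → ℤ
    w g = x g + x′ g

    w≡ : ∀ g → w g ≡ (B g + 1ℤ) + (- + 2) * z g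
    w≡ g = trans (lemma (x g) (x′ g) (z g)) (cong₂ (λ u v → (u + v - 1ℤ) + 1ℤ + (- + 2) * z g) (sym (y≡ g)) (sym (y′≡ g)))
      where
      lemma : ∀ a b z → a + b ≡ ((a + z) + (b + z) - 1ℤ) + 1ℤ + (- + 2) * z
      lemma = solve-∀

    w-expand : ∀ {f} → Periodic n f → ∀ g → conv n w f g ≡ (conv n B f g + ∑ n f) + (- + 2) * conv n z f g
    w-expand {f} pf g = begin
      conv n w f g                                                          ≡⟨ conv-cong n {g = f} w≡ (λ _ → refl) g ⟩
      conv n (λ h → (B h + 1ℤ) + (- + 2) * z h) f g                         ≡⟨ conv-distribˡ n (λ h → B h + 1ℤ) (λ h → (- + 2) * z h) f g ⟩
      conv n (λ h → B h + 1ℤ) f g + conv n (λ h → (- + 2) * z h) f g        ≡⟨ cong₂ _+_ (trans (conv-distribˡ n B (λ _ → 1ℤ) f g) (cong (_+_ (conv n B f g)) (trans (conv-constˡ 1ℤ pf g) (*-identityˡ (∑ n f))))) (conv-*ˡ n (- + 2) z f g) ⟩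
      (conv n B f g + ∑ n f) + (- + 2) * conv n z f g                       ∎

    w*y : ∀ g → conv n w y g ≡ d * y g + μ
    w*y g = trans (conv-distribˡ n x x′ y g) (trans (cong (_+_ (conv n x y g)) (conv-comm px′ py g)) (reflections E g))

    w*y′ : ∀ g → conv n w y′ g ≡ d * y′ g + μ
    w*y′ g = trans (conv-cong n {g = y′} (λ h → sym (trans (cong (λ u → x (- h) + x u) (neg-involutive h)) (+-comm (x (- h)) (x h)))) (λ _ → refl) g)
      (trans (conv-reflect (periodic-+ px px′) py g) (w*y (- g)))

    -- Collects the constants: 2μ from the equations for y and y′, d from writing y + y′ as B + 1,
    -- -∑w from the -1 in B, and -∑B from the 1 in w = B + 1 - 2z.
    c : ℤ
    c = d + + 2 * μ - ∑ n w - ∑ n B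

    B*B : ∀ g → conv n B B g ≡ (+ 2 * conv n z B g + d * B g) + c
    B*B g = begin
      conv n B B g                                                                 ≡⟨ lemma₁ (conv n B B g) (∑ n B) (conv n z B g) ⟩
      ((conv n B B g + ∑ n B) + (- + 2) * conv n z B g) - ∑ n B + + 2 * conv n z B g ≡⟨ cong (λ u → u - ∑ n B + + 2 * conv n z B g) (trans (sym (w-expand pB g)) w*B) ⟩
      (d * y g + μ + (d * y′ g + μ) - ∑ n w) - ∑ n B + + 2 * conv n z B g          ≡⟨ lemma₂ d μ (y g) (y′ g) (∑ n w) (∑ n B) (conv n z B g) ⟩
      (+ 2 * conv n z B g + d * B g) + c                                           ∎
      where
      lemma₁ : ∀ a b c → a ≡ ((a + b) + (- + 2) * c) - b + + 2 * c
      lemma₁ = solve-∀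
      lemma₂ : ∀ d μ y y′ a b z → (d * y + μ + (d * y′ + μ) - a) - b + + 2 * z ≡ (+ 2 * z + d * (y + y′ - 1ℤ)) + (d + + 2 * μ - a - b)
      lemma₂ = solve-∀
      minus : ∀ a → a * -1ℤ ≡ - a
      minus = solve-∀
      w*B : conv n w B g ≡ d * y g + μ + (d * y′ g + μ) - ∑ n w
      w*B = trans (conv-distribʳ n w (λ h → y h + y′ h) (λ _ → -1ℤ) g)
        (cong₂ _+_ (trans (conv-distribʳ n w y y′ g) (cong₂ _+_ (w*y g) (w*y′ g))) (trans (conv-constʳ n w -1ℤ g) (minus (∑ n w))))

    z0 : z 0ℤ ≡ 1ℤ
    z0 = trans (sym (trans (y≡ 0ℤ) (trans (cong (_+ z 0ℤ) x0) (+-identityˡ (z 0ℤ))))) y0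

    z⇒y : ∀ {g} → z g ≡ 1ℤ → y g ≡ 1ℤ
    z⇒y {g} zg with by g | bx g
    ... | inj₂ yg | _       = yg
    ... | inj₁ yg | inj₁ xg = case trans (sym yg) (trans (y≡ g) (cong₂ _+_ xg zg)) of λ ()
    ... | inj₁ yg | inj₂ xg = case trans (sym yg) (trans (y≡ g) (cong₂ _+_ xg zg)) of λ ()

    z⇒B : ∀ {g} → z g ≡ 1ℤ → B g ≡ 1ℤ
    z⇒B {g} zg = cong₂ (λ u v → u + v - 1ℤ) (z⇒y zg) (z⇒y (trans (z-even g) zg))

    B0 : B 0ℤ ≡ 1ℤ
    B0 = z⇒B z0

    B-ternary : TernaryValued B
    B-ternary g with by g | by (- g)
    ... | inj₁ a | inj₁ b = inj₂ (inj₂ (cong₂ (λ u v → u + v - 1ℤ) a b))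
    ... | inj₁ a | inj₂ b = inj₂ (inj₁ (cong₂ (λ u v → u + v - 1ℤ) a b))
    ... | inj₂ a | inj₁ b = inj₂ (inj₁ (cong₂ (λ u v → u + v - 1ℤ) a b))
    ... | inj₂ a | inj₂ b = inj₁ (cong₂ (λ u v → u + v - 1ℤ) a b)

    B⇒y : ∀ {g} → B g ≡ 1ℤ → y g ≡ 1ℤ
    B⇒y {g} Bg with by g | by (- g)
    ... | inj₂ a | _      = a
    ... | inj₁ a | inj₁ b = case trans (sym Bg) (cong₂ (λ u v → u + v - 1ℤ) a b) of λ ()
    ... | inj₁ a | inj₂ b = case trans (sym Bg) (cong₂ (λ u v → u + v - 1ℤ) a b) of λ ()

    -- If B has no zeros then X and Y are inverse-closed, which forces t = k.
    B-has-zeros : ¬ (∀ g → B g ≢ 0ℤ)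
    B-has-zeros B≢0 = genuine (begin
      ∑ n x + ∑ n y                               ≡⟨ cong₂ _+_ (∑-cong n (λ h → sym (trans (cong (λ u → x h * x u) (+-identityˡ (- h))) (trans (cong (x h *_) (x-even h)) (binary-idem (bx h))))))
                                                               (∑-cong n (λ h → sym (trans (cong (λ u → y h * y u) (trans (cong -_ (+-identityˡ (- h))) (neg-involutive h))) (binary-idem (by h))))) ⟩
      conv n x x 0ℤ + conv n y y′ 0ℤ              ≡⟨ rotations E 0ℤ ⟩
      τ * δ n 0ℤ + d * x 0ℤ + μ                   ≡⟨ cong₂ (λ u v → τ * u + d * v + μ) (δ-yes {n} (divides 0ℤ refl)) x0 ⟩
      τ * 1ℤ + d * 0ℤ + μ                         ≡⟨ lemma τ d μ ⟩
      τ + μ                                       ∎)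
      where
      lemma : ∀ τ d μ → τ * 1ℤ + d * 0ℤ + μ ≡ τ + μ
      lemma = solve-∀
      y-even : ∀ g → y (- g) ≡ y g
      y-even g with by g | by (- g)
      ... | inj₁ a | inj₁ b = trans b (sym a)
      ... | inj₂ a | inj₂ b = trans b (sym a)
      ... | inj₁ a | inj₂ b = contradiction (cong₂ (λ u v → u + v - 1ℤ) a b) (B≢0 g)
      ... | inj₂ a | inj₁ b = contradiction (cong₂ (λ u v → u + v - 1ℤ) a b) (B≢0 g)
      x≡ : ∀ g → x g ≡ y g - z g
      x≡ g = trans (cancel (x g) (z g)) (cong (_- z g) (sym (y≡ g)))
        where
        cancel : ∀ a b → a ≡ a + b - b
        cancel = solve-∀
      x-even : ∀ g → x (- g) ≡ x g
      x-even g = trans (x≡ (- g)) (trans (cong₂ _-_ (y-even g) (z-even g)) (sym (x≡ g)))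

    ζ : ℤ
    ζ = ∑ n z

    -- The coefficient s of the quadratic equation is 2 + d when z∗B = B. When z∗B = ζB and d = -ζ
    -- it is 2ζ - ζ = ζ.
    data ZShape (s : ℤ) : Set where
      trivial  : (∀ g → z g ≡ δ n g) → s ≡ + 2 + d → ZShape s
      subgroup : s ≡ ζ → d ≡ - ζ → ZShape s

    δ-conv : ∀ {f} → Periodic n f → (∀ g → z g ≡ δ n g) → ∀ g → conv n z f g ≡ f g
    δ-conv {f} pf z≡δ g = trans (conv-cong n {g = f} z≡δ (λ _ → refl) g) (trans (∑-δ n (λ h → f (g - h))) (cong f (+-identityʳ g)))

    module NontrivialZ (g₀ : ℤ) (zg₀ : z g₀ ≡ 1ℤ) (n∤g₀ : ¬ (+ n ∣ g₀)) where
      -- If a + b lay outside Y∖X it would be nonzero, so `z*z` would give it no representation as a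
      -- sum of two elements of Y∖X; but a and b provide one.
      z-closed : ∀ {a b} → z a ≡ 1ℤ → z b ≡ 1ℤ → z (a + b) ≡ 1ℤ
      z-closed {a} {b} za zb with bz (a + b)
      ... | inj₂ one  = one
      ... | inj₁ zero′ = case trans (sym (∑-zero (periodic-* pz (periodic-flip pz (a + b))) nonneg vanish a)) (cong₂ _*_ za (trans (cong z (lemma a b)) zb)) of λ ()
        where
        lemma : ∀ a b → a + b - a ≡ b
        lemma = solve-∀
        *-≥0 : ∀ {u v} → 0ℤ ≤ u → 0ℤ ≤ v → 0ℤ ≤ u * v
        *-≥0 {+ u} {+ v} _ _ = subst (0ℤ ≤_) (pos-* u v) (+≤+ ℕ.z≤n)
        nonneg : ∀ h → 0ℤ ≤ z h * z (a + b - h)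
        nonneg h = *-≥0 (binary-≥0 (bz h)) (binary-≥0 (bz (a + b - h)))
        n∤a+b : ¬ (+ n ∣ a + b)
        n∤a+b n∣ = case trans (sym zero′) (trans (periodic-≡ pz (subst (+ n ∣_) (sym (+-identityʳ (a + b))) n∣)) z0) of λ ()
        eval : ∀ τ d → τ * 0ℤ - d * 0ℤ ≡ 0ℤ
        eval = solve-∀
        vanish : conv n z z (a + b) ≡ 0ℤ
        vanish = trans (z*z (a + b)) (trans (cong₂ (λ u v → τ * u - d * v) (δ-no n∤a+b) zero′) (eval τ d))

      z-absorb : ∀ {f g} → (∀ {h} → z h ≡ 1ℤ → f h ≡ 1ℤ) → z g ≡ 1ℤ → conv n z f g ≡ ζ
      z-absorb {f} {g} f-one zg = trans (∑-absorb n z (λ h → f (g - h)) 1ℤ cases) (*-identityʳ ζ)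
        where
        cases : ∀ h → z h ≡ 0ℤ ⊎ f (g - h) ≡ 1ℤ
        cases h with bz h
        ... | inj₁ zh = inj₁ zh
        ... | inj₂ zh = inj₂ (f-one (z-closed zg (trans (z-even h) zh)))

      -- At g₀ the term with τ vanishes, and every element of the subgroup contributes one
      -- representation.
      d≡ : d ≡ - ζ
      d≡ = begin
        d                          ≡⟨ lemma τ d ⟩
        - (τ * 0ℤ - d * 1ℤ)        ≡⟨ cong₂ (λ u v → - (τ * u - d * v)) (δ-no n∤g₀) zg₀ ⟨
        - (τ * δ n g₀ - d * z g₀)  ≡⟨ cong -_ (z*z g₀) ⟨
        - conv n z z g₀            ≡⟨ cong -_ (z-absorb (λ e → e) zg₀) ⟩
        - ζ                        ∎
        where
        lemma : ∀ τ d → d ≡ - (τ * 0ℤ - d * 1ℤ)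
        lemma = solve-∀

      -- On Y∖X both B and z∗B are constant, with values 1 and ζ. Hence B∗B takes the same value
      -- there as at 0, which is what `maximal⇒period` asks for, although B∗B is not yet known to be
      -- quadratic in B.
      z-periods : ∀ {g} → z g ≡ 1ℤ → ∀ h → B (h + g) ≡ B h
      z-periods {g} zg = maximal⇒period pB B-even g (trans (value zg) (sym (value z0)))
        where
        value : ∀ {g} → z g ≡ 1ℤ → conv n B B g ≡ (+ 2 * ζ + d * 1ℤ) + c
        value {g} zg = trans (B*B g) (cong₂ (λ u v → (+ 2 * u + d * v) + c) (z-absorb z⇒B zg) (z⇒B zg))

      z*B : ∀ g → conv n z B g ≡ ζ * B g
      z*B g = ∑-absorb n z (λ h → B (g - h)) (B g) cases
        where
        lemma : ∀ g h → g - h + h ≡ g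
        lemma = solve-∀
        cases : ∀ h → z h ≡ 0ℤ ⊎ B (g - h) ≡ B g
        cases h with bz h
        ... | inj₁ zh = inj₁ zh
        ... | inj₂ zh = inj₂ (trans (sym (z-periods zh (g - h))) (cong B (lemma g h)))

      B*B′ : ∀ g → conv n B B g ≡ ζ * B g + c
      B*B′ g = trans (B*B g) (trans (cong₂ (λ u v → (+ 2 * u + v * B g) + c) (z*B g) d≡) (lemma ζ (B g) c))
        where
        lemma : ∀ ζ b c → (+ 2 * (ζ * b) + - ζ * b) + c ≡ ζ * b + c
        lemma = solve-∀

    quadratic : ∃ λ s → ZShape s × (∀ g → conv n B B g ≡ s * B g + c)
    -- A finite search compares Y∖X with {0}; since 0 lies in Y∖X, any discrepancy is a nonzero
    -- element.
    quadratic with ℕ.anyUpTo? (λ i → ¬? (z (+ i) ≟ δ n (+ i))) n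
    ... | no all-equal = + 2 + d , trivial z≡δ refl , λ g → trans (B*B g) (trans (cong (λ u → (+ 2 * u + d * B g) + c) (δ-conv pB z≡δ g)) (lemma d (B g) c))
      where
      lemma : ∀ d b c → (+ 2 * b + d * b) + c ≡ (+ 2 + d) * b + c
      lemma = solve-∀
      z≡δ : ∀ g → z g ≡ δ n g
      z≡δ g = trans (periodic-rep pz g) (trans (decidable-stable (_ ≟ _) (λ ≢ → all-equal (_ , n%ℕd<d g n , ≢))) (sym (periodic-rep (δ-periodic n) g)))
    ... | yes (i , _ , z≢δ) = nontrivial (bz (+ i)) (+ n ∣? + i)
      where
      nontrivial : z (+ i) ≡ 0ℤ ⊎ z (+ i) ≡ 1ℤ → Dec (+ n ∣ + i) → ∃ λ s → ZShape s × (∀ g → conv n B B g ≡ s * B g + c)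
      nontrivial (inj₁ zi) (no n∤i)  = contradiction (trans zi (sym (δ-no n∤i))) z≢δ
      nontrivial (inj₂ zi) (yes n∣i) = contradiction (trans zi (sym (δ-yes n∣i))) z≢δ
      nontrivial (inj₁ zi) (yes n∣i) = case trans (sym zi) (trans (periodic-≡ pz (subst (+ n ∣_) (sym (+-identityʳ (+ i))) n∣i)) z0) of λ ()
      nontrivial (inj₂ zi) (no n∤i)  = ζ , subgroup refl d≡ , B*B′
        where open NontrivialZ (+ i) zi n∤i

    module FromQuadratic (s : ℤ) (shape : ZShape s) (B*B : ∀ g → conv n B B g ≡ s * B g + c)
      (stabilised : Stabilised pp 2∤p α B) where
      open Stabilised stabilised
      private m = p ℕ.^ γ

      -- Period 1 would make B constantly 1, leaving no zeros.
      1≤γ : 1 ℕ.≤ γ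
      1≤γ = ℕ.n≢0⇒n>0 λ γ≡0 → B-has-zeros λ g Bg≡0 → case trans (sym Bg≡0) (trans
        (periodic-≡ (subst (λ k → Periodic (p ℕ.^ k) B) γ≡0 periodic) {g} {0ℤ} (divides (g - 0ℤ) (sym (*-identityʳ (g - 0ℤ))))) B0) of λ ()

      -- A single value -1 would, by `rigid`, forbid every zero, against `B-has-zeros`.
      B≡δ : ∀ g → B g ≡ δ m g
      B≡δ g with B-ternary g
      ... | inj₁ Bg        = trans Bg (sym (δ-yes (1⇒∣ g Bg)))
      ... | inj₂ (inj₁ Bg) = trans Bg (sym (δ-no λ m∣g → case trans (sym Bg) (trans (periodic-≡ periodic (subst (+ m ∣_) (sym (+-identityʳ g)) m∣g)) B0) of λ ()))
      ... | inj₂ (inj₂ Bg) = contradiction (λ g₂ → rigid 1≤γ g g₂ Bg) B-has-zeros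

      bB : BinaryValued B
      bB g = subst (λ u → u ≡ 0ℤ ⊎ u ≡ 1ℤ) (sym (B≡δ g)) (δ-binary m g)

      m∤1 : ¬ (+ m ∣ 1ℤ)
      m∤1 = prime-power-∤1 pp 1≤γ

      -- Evaluate at 1, which is not in the subgroup: h and 1 - h are then never both in it, so B∗B
      -- vanishes there along with B.
      c≡0 : c ≡ 0ℤ
      c≡0 = begin
        c                 ≡⟨ lemma s c ⟩
        s * 0ℤ + c        ≡⟨ cong (λ u → s * u + c) (trans (B≡δ 1ℤ) (δ-no m∤1)) ⟨
        s * B 1ℤ + c      ≡⟨ B*B 1ℤ ⟨
        conv n B B 1ℤ     ≡⟨ ∑-absorb n B (λ h → B (1ℤ - h)) 0ℤ disjoint ⟩
        ∑ n B * 0ℤ        ≡⟨ *-zeroʳ (∑ n B) ⟩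
        0ℤ                ∎
        where
        lemma : ∀ s c → c ≡ s * 0ℤ + c
        lemma = solve-∀
        cancel : ∀ h → h + (1ℤ - h) ≡ 1ℤ
        cancel = solve-∀
        disjoint : ∀ h → B h ≡ 0ℤ ⊎ B (1ℤ - h) ≡ 0ℤ
        disjoint h with bB h | bB (1ℤ - h)
        ... | inj₁ e | _      = inj₁ e
        ... | inj₂ _ | inj₁ e = inj₂ e
        ... | inj₂ e | inj₂ f = contradiction (subst (+ m ∣_) (cancel h) (∣m∣n⇒∣m+n (1⇒∣ h e) (1⇒∣ (1ℤ - h) f))) m∤1

      ∑B≡s : ∑ n B ≡ s
      ∑B≡s = begin
        ∑ n B                 ≡⟨ ∑-cong n (λ h → sym (trans (cong (B h *_) (trans (cong B (+-identityˡ (- h))) (B-even h))) (binary-idem (bB h)))) ⟩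
        conv n B B 0ℤ         ≡⟨ B*B 0ℤ ⟩
        s * B 0ℤ + c          ≡⟨ cong₂ (λ u v → s * u + v) B0 c≡0 ⟩
        s * 1ℤ + 0ℤ           ≡⟨ lemma s ⟩
        s                     ∎
        where
        lemma : ∀ s → s * 1ℤ + 0ℤ ≡ s
        lemma = solve-∀

      -- One has z ≤ B pointwise, and the two sums over a period agree.
      z≡B : s ≡ ζ → ∀ g → z g ≡ B g
      z≡B s≡ζ g = sym (i-j≡0⇒i≡j (B g) (z g) (∑-zero (periodic-+ pB (periodic-neg pz)) nonneg total g))
        where
        nonneg : ∀ h → 0ℤ ≤ B h - z h
        nonneg h with bz h
        ... | inj₁ zh = subst (0ℤ ≤_) (trans (sym (+-identityʳ (B h))) (cong (_-_ (B h)) (sym zh))) (binary-≥0 (bB h))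
        ... | inj₂ zh = ≤-reflexive (sym (cong₂ _-_ (z⇒B zh) zh))
        total : ∑ n (λ h → B h - z h) ≡ 0ℤ
        total = trans (∑-+ n B (λ h → - z h)) (trans (cong₂ _+_ (trans ∑B≡s s≡ζ) (∑-neg n z)) (+-inverseʳ ζ))

      z-shape : ZShape s → (∀ g → z g ≡ δ n g) ⊎ (∀ g → z g ≡ δ m g)
      z-shape (trivial z≡δ _)  = inj₁ z≡δ
      z-shape (subgroup s≡ζ _) = inj₂ (λ g → trans (z≡B s≡ζ g) (B≡δ g))

      equation : ∀ g → (conv n B y g + ∑ n y) + (- + 2) * conv n z y g ≡ d * y g + μ
      equation g = trans (sym (w-expand py g)) (w*y g)

      -- Eliminates z from w∗y. In the subgroup case z = B, so -2 z∗y reverses the sign of B∗y, and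
      -- d = -s reverses it back.
      affine : ZShape s → ∃ λ κ → ∀ g → conv n B y g ≡ s * y g + κ
      affine (trivial z≡δ s≡) = μ - ∑ n y , λ g → begin
        conv n B y g                                                                ≡⟨ lemma₁ (conv n B y g) (∑ n y) (y g) ⟩
        ((conv n B y g + ∑ n y) + (- + 2) * y g) + (+ 2 * y g - ∑ n y)              ≡⟨ cong (_+ (+ 2 * y g - ∑ n y)) (trans (cong (λ u → (conv n B y g + ∑ n y) + (- + 2) * u) (sym (δ-conv py z≡δ g))) (equation g)) ⟩
        (d * y g + μ) + (+ 2 * y g - ∑ n y)                                         ≡⟨ lemma₂ d (y g) μ (∑ n y) ⟩
        (+ 2 + d) * y g + (μ - ∑ n y)                                               ≡⟨ cong (λ u → u * y g + (μ - ∑ n y)) s≡ ⟨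
        s * y g + (μ - ∑ n y)                                                       ∎
        where
        lemma₁ : ∀ a b y → a ≡ ((a + b) + (- + 2) * y) + (+ 2 * y - b)
        lemma₁ = solve-∀
        lemma₂ : ∀ d y μ b → (d * y + μ) + (+ 2 * y - b) ≡ (+ 2 + d) * y + (μ - b)
        lemma₂ = solve-∀
      affine (subgroup s≡ζ d≡) = ∑ n y - μ , λ g → begin
        conv n B y g                                                                ≡⟨ lemma₁ (conv n B y g) (∑ n y) ⟩
        - ((conv n B y g + ∑ n y) + (- + 2) * conv n B y g) + ∑ n y                 ≡⟨ cong (λ u → - u + ∑ n y) (trans (cong (λ u → (conv n B y g + ∑ n y) + (- + 2) * u) (conv-cong n {g = y} (λ h → sym (z≡B s≡ζ h)) (λ _ → refl) g)) (equation g)) ⟩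
        - (d * y g + μ) + ∑ n y                                                     ≡⟨ cong (λ u → - (u * y g + μ) + ∑ n y) (trans d≡ (cong -_ (sym s≡ζ))) ⟩
        - (- s * y g + μ) + ∑ n y                                                   ≡⟨ lemma₂ s (y g) μ (∑ n y) ⟩
        s * y g + (∑ n y - μ)                                                       ∎
        where
        lemma₁ : ∀ a b → a ≡ - ((a + b) + (- + 2) * a) + b
        lemma₁ = solve-∀
        lemma₂ : ∀ s y μ b → - (- s * y + μ) + b ≡ s * y + (b - μ)
        lemma₂ = solve-∀

      -- The constant is found at 0: the even set where B is 1 is contained in Y, so B∗y there
      -- equals ∑B = s.
      B*y : ∀ g → conv n B y g ≡ s * y g
      B*y g = trans (eq g) (trans (cong (_+_ (s * y g)) κ≡0) (+-identityʳ (s * y g)))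
        where
        κ = proj₁ (affine shape)
        eq = proj₂ (affine shape)
        lemma : ∀ s κ → κ ≡ (s * 1ℤ + κ) - s
        lemma = solve-∀
        cases : ∀ h → B h ≡ 0ℤ ⊎ y (0ℤ - h) ≡ 1ℤ
        cases h with bB h
        ... | inj₁ e = inj₁ e
        ... | inj₂ e = inj₂ (B⇒y (trans (cong B (+-identityˡ (- h))) (trans (B-even h) e)))
        κ≡0 : κ ≡ 0ℤ
        κ≡0 = begin
          κ                       ≡⟨ lemma s κ ⟩
          (s * 1ℤ + κ) - s        ≡⟨ cong (λ u → (s * u + κ) - s) y0 ⟨
          (s * y 0ℤ + κ) - s      ≡⟨ cong (_- s) (eq 0ℤ) ⟨
          conv n B y 0ℤ - s       ≡⟨ cong (_- s) (trans (∑-absorb n B (λ h → y (0ℤ - h)) 1ℤ cases) (trans (*-identityʳ (∑ n B)) ∑B≡s)) ⟩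
          s - s                   ≡⟨ +-inverseʳ s ⟩
          0ℤ                      ∎

      -- For g in Y the value s of B∗y is the largest possible, so no element of the translated
      -- subgroup may miss Y.
      y-translate : ∀ {g} → y g ≡ 1ℤ → ∀ h → B h ≡ 1ℤ → y (g - h) ≡ 1ℤ
      y-translate {g} yg h Bh = sym (i-j≡0⇒i≡j 1ℤ (y (g - h)) (trans (sym (trans (cong (_* (1ℤ - y (g - h))) Bh) (*-identityˡ (1ℤ - y (g - h)))))
        (∑-zero {f = D} (periodic-* pB (periodic-+ (periodic-const 1ℤ) (periodic-neg (periodic-flip py g)))) nonneg total h)))
        where
        D : ℤ → ℤ
        D h = B h * (1ℤ - y (g - h))
        nonneg : ∀ h → 0ℤ ≤ D h
        nonneg h with bB h | by (g - h)
        ... | inj₁ e | _      = ≤-reflexive (sym (trans (cong (_* (1ℤ - y (g - h))) e) (*-zeroˡ (1ℤ - y (g - h)))))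
        ... | inj₂ e | inj₁ f = subst (0ℤ ≤_) (sym (cong₂ (λ u v → u * (1ℤ - v)) e f)) (+≤+ ℕ.z≤n)
        ... | inj₂ e | inj₂ f = ≤-reflexive (sym (cong₂ (λ u v → u * (1ℤ - v)) e f))
        lemma : ∀ b y → b * (1ℤ - y) ≡ b + - (b * y)
        lemma = solve-∀
        total : ∑ n D ≡ 0ℤ
        total = begin
          ∑ n D                                          ≡⟨ ∑-cong n (λ h → lemma (B h) (y (g - h))) ⟩
          ∑ n (λ h → B h + - (B h * y (g - h)))          ≡⟨ ∑-+ n B (λ h → - (B h * y (g - h))) ⟩
          ∑ n B + ∑ n (λ h → - (B h * y (g - h)))        ≡⟨ cong₂ _+_ ∑B≡s (trans (∑-neg n (λ h → B h * y (g - h))) (cong -_ (trans (B*y g) (trans (cong (s *_) yg) (*-identityʳ s))))) ⟩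
          s - s                                          ≡⟨ +-inverseʳ s ⟩
          0ℤ                                             ∎

      Bm : B (+ m) ≡ 1ℤ
      Bm = trans (B≡δ (+ m)) (δ-yes ∣-refl)

      y-periodic : Periodic m y
      y-periodic .step g with by g | by (g + + m)
      ... | inj₁ a | inj₁ b = trans b (sym a)
      ... | inj₂ a | inj₂ b = trans b (sym a)
      ... | inj₂ a | inj₁ b = case trans (sym b) (trans (cong (λ u → y (g + u)) (sym (neg-involutive (+ m)))) (y-translate a (- + m) (trans (B-even (+ m)) Bm))) of λ ()
      ... | inj₁ a | inj₂ b = case trans (sym a) (trans (cong y (sym (lemma g (+ m)))) (y-translate b (+ m) Bm)) of λ ()
        where
        lemma : ∀ g m → g + m - m ≡ g
        lemma = solve-∀

      y-skew : ∀ g → y g + y (- g) ≡ 1ℤ + δ m g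
      y-skew g = trans (lemma (y g + y (- g))) (cong (_+_ 1ℤ) (B≡δ g))
        where
        lemma : ∀ a → a ≡ 1ℤ + (a - 1ℤ)
        lemma = solve-∀

      classified : Classified p α y z
      classified = record
        { γ = γ ; 1≤γ = 1≤γ ; γ≤α = γ≤α ; y-periodic = y-periodic ; y-skew = y-skew ; z-shape = z-shape shape }

    classified : Classified p α y z
    classified = let s , shape , B*B = quadratic in FromQuadratic.classified s shape B*B (stabilise pp 2∤p α pB B-even B0 B-ternary s c B*B)

  -- The adjacency matrix in terms of indicator functions

  open import Defs

  module _ {n : ℕ} .{{_ : ℕ.NonZero n}} where

    toℕ-mod-injective : {i j : Fin n} → + toℕ i ≡ + toℕ j [mod n ] → i ≡ j
    toℕ-mod-injective {i} {j} e = toℕ-injective (+-injective (i-j≡0⇒i≡j (+ toℕ i) (+ toℕ j)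
      (decidable-stable (_ ≟ _) (λ ≢0 → ∣∣<⇒∤ ≢0 small (difference e)))))
      where
      small : ∣ + toℕ i - + toℕ j ∣ ℕ.< n
      small = ℕ.≤-<-trans (subst (λ w → ∣ w ∣ ℕ.≤ toℕ i ℕ.⊔ toℕ j) (sym (m-n≡m⊖n (toℕ i) (toℕ j))) (∣m⊝n∣≤m⊔n (toℕ i) (toℕ j))) (ℕ.⊔-lub (toℕ<n i) (toℕ<n j))

    residue : ℤ → Fin n
    residue a = fromℕ< (n%ℕd<d a n)

    toℕ-residue : ∀ a → + toℕ (residue a) ≡ a [mod n ]
    toℕ-residue a = mod-trans (mod-reflexive (cong +_ (toℕ-fromℕ< (n%ℕd<d a n)))) (mod-sym (mkMod (∣-rep n a)))

    residue-unique : ∀ {i a} → + toℕ i ≡ a [mod n ] → i ≡ residue a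
    residue-unique e = toℕ-mod-injective (mod-trans e (mod-sym (toℕ-residue _)))

    residue-toℕ : ∀ i → residue (+ toℕ i) ≡ i
    residue-toℕ i = sym (residue-unique (mod-reflexive refl))

    residue-cong : ∀ {a b} → a ≡ b [mod n ] → residue a ≡ residue b
    residue-cong e = residue-unique (mod-trans (toℕ-residue _) e)

  %-mod : ∀ k n .{{_ : ℕ.NonZero n}} → + (k ℕ.% n) ≡ + k [mod n ]
  %-mod k n = mod-sym (mkMod (divides (+ (k ℕ./ n)) (begin
    + k - + (k ℕ.% n)                                             ≡⟨ cong (λ w → + w - + (k ℕ.% n)) (m≡m%n+[m/n]*n k n) ⟩
    + (k ℕ.% n) + + (k ℕ./ n ℕ.* n) - + (k ℕ.% n)                 ≡⟨ lemma (+ (k ℕ.% n)) _ ⟩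
    + (k ℕ./ n ℕ.* n)                                             ≡⟨ pos-* (k ℕ./ n) n ⟩
    + (k ℕ./ n) * + n                                             ∎)))
    where
    lemma : ∀ a b → a + b - a ≡ b
    lemma = solve-∀

  toℕ-+ₘ : ∀ {n} (i j : Fin n) → + toℕ (i +ₘ j) ≡ + toℕ i + + toℕ j [mod n ]
  toℕ-+ₘ {suc m} i j = mod-trans (mod-reflexive (cong +_ (toℕ-fromℕ< (m%n<n (toℕ i ℕ.+ toℕ j) (suc m))))) (%-mod (toℕ i ℕ.+ toℕ j) (suc m))

  toℕ-*ₘ : ∀ {n} (i j : Fin n) → + toℕ (i *ₘ j) ≡ + toℕ i * + toℕ j [mod n ]
  toℕ-*ₘ {suc m} i j = mod-trans (mod-reflexive (cong +_ (toℕ-fromℕ< (m%n<n (toℕ i ℕ.* toℕ j) (suc m)))))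
    (mod-trans (%-mod (toℕ i ℕ.* toℕ j) (suc m)) (mod-reflexive (pos-* (toℕ i) (toℕ j))))

  toℕ--ₘ : ∀ {n} (i : Fin n) → + toℕ (-ₘ i) ≡ - + toℕ i [mod n ]
  toℕ--ₘ {suc m} i = mod-trans (mod-reflexive (cong +_ (toℕ-fromℕ< (m%n<n (suc m ℕ.∸ toℕ i) (suc m)))))
    (mod-trans (%-mod (suc m ℕ.∸ toℕ i) (suc m)) (mkMod (divides 1ℤ (begin
      + (suc m ℕ.∸ toℕ i) - - + toℕ i         ≡⟨ cong (_+_ (+ (suc m ℕ.∸ toℕ i))) (neg-involutive (+ toℕ i)) ⟩
      + (suc m ℕ.∸ toℕ i ℕ.+ toℕ i)           ≡⟨ cong +_ (ℕ.m∸n+n≡m (ℕ.<⇒≤ (toℕ<n i))) ⟩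
      + suc m                                 ≡⟨ *-identityˡ (+ suc m) ⟨
      1ℤ * + suc m                            ∎))))

  toℕ-oneₘ : ∀ {n} (i : Fin n) → + toℕ (oneₘ i) ≡ 1ℤ [mod n ]
  toℕ-oneₘ {suc m} i = mod-trans (mod-reflexive (cong +_ (toℕ-fromℕ< (m%n<n 1 (suc m))))) (%-mod 1 (suc m))

  mod-neg : ∀ {p a b} → a ≡ b [mod p ] → - a ≡ - b [mod p ]
  mod-neg {p} {a} {b} (mkMod e) = mkMod (subst (+ p ∣_) (lemma a b) (∣m⇒∣-m e))
    where
    lemma : ∀ a b → - (a - b) ≡ - a - - b
    lemma = solve-∀

  ∑-allD : ∀ n (F : D n → ℕ) G → (∀ i → + F (i , false) + + F (i , true) ≡ G (+ toℕ i)) → + (Σ[ allD n ] F) ≡ ∑ n G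
  ∑-allD n F = go n (λ i → i)
    where
    -- An arbitrary tabulated family replaces the list of all indices, because the tail of that list
    -- is again a tabulation, now along successors.
    go : ∀ k (h : Fin k → Fin n) (G : ℤ → ℤ) → (∀ i → + F (h i , false) + + F (h i , true) ≡ G (+ toℕ i)) →
      + (Σ[ cartesianProduct (List.tabulate h) (false ∷ true ∷ []) ] F) ≡ ∑ k G
    go zero    h G eq = refl
    go (suc k) h G eq = begin
      + F (h Fin.zero , false) + (+ F (h Fin.zero , true) + + rest) ≡⟨ +-assoc (+ F (h Fin.zero , false)) (+ F (h Fin.zero , true)) (+ rest) ⟨
      (+ F (h Fin.zero , false) + + F (h Fin.zero , true)) + + rest ≡⟨ cong₂ _+_ (eq Fin.zero) (go k (λ i → h (Fin.suc i)) (λ a → G (+ 1 + a)) (λ i → eq (Fin.suc i))) ⟩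
      G 0ℤ + ∑ k (λ a → G (+ 1 + a))                                ≡⟨ ∑-front k G ⟨
      ∑ (suc k) G                                                   ∎
      where rest = Σ[ cartesianProduct (List.tabulate (λ i → h (Fin.suc i))) (false ∷ true ∷ []) ] F

  module _ {n : ℕ} .{{_ : ℕ.NonZero n}} where

    residue-+ : ∀ a b → residue {n} a +ₘ residue b ≡ residue (a + b)
    residue-+ a b = residue-unique (mod-trans (toℕ-+ₘ (residue a) (residue b)) (mod-+ (toℕ-residue a) (toℕ-residue b)))

    residue-neg : ∀ a → -ₘ residue {n} a ≡ residue (- a)
    residue-neg a = residue-unique (mod-trans (toℕ--ₘ (residue a)) (mod-neg (toℕ-residue a)))

    indicator : Subset n → ℤ → ℤ
    indicator S a = + 𝟙 (lookup S (residue a))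

    indicator-periodic : ∀ S → Periodic n (indicator S)
    indicator-periodic S .step a = cong (λ i → + 𝟙 (lookup S i)) (residue-cong {a = a + + n} {a} (mkMod (divides 1ℤ (lemma a (+ n)))))
      where
      lemma : ∀ a n → a + n - a ≡ 1ℤ * n
      lemma = solve-∀

    indicator-binary : ∀ S → BinaryValued (indicator S)
    indicator-binary S a with lookup S (residue a)
    ... | true  = inj₂ refl
    ... | false = inj₁ refl

    module _ (X Y : Subset n) where
      private
        x = indicator X
        y = indicator Y
        px = indicator-periodic X
        py = indicator-periodic Y
        x′ = reflect x
        y′ = reflect y

        A : D n → D n → ℕ
        A g h = 𝟙 (DihArc X Y g h)

        I : D n → D n → ℕ
        I g h = 𝟙 (does (g ≟D h))

      vertex : ℤ → Bool → D n
      vertex a e = residue a , e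

      on-vertices : (P : D n → Set) → (∀ a e → P (vertex a e)) → ∀ g → P g
      on-vertices P P-vertex (i , e) = subst (λ j → P (j , e)) (residue-toℕ i) (P-vertex (+ toℕ i) e)

      -- The exponent of the rotation in g⁻¹h. A reflection is its own inverse and inverts the
      -- rotation to its right, so the sign depends only on the type of g.
      offset : Bool → ℤ → ℤ → ℤ
      offset false a b = b - a
      offset true  a b = a - b

      connection : Bool → ℤ → ℤ
      connection false = x
      connection true  = y

      unit : Bool → ℤ → ℤ
      unit false = δ n
      unit true  = λ _ → 0ℤ

      paths : Bool → ℤ → ℤ
      paths false g = conv n x x g + conv n y y′ g
      paths true  g = conv n x y g + conv n y x′ g

      residue-diff : ∀ a b → residue {n} a +ₘ (-ₘ residue b) ≡ residue (a - b)
      residue-diff a b = trans (cong (residue a +ₘ_) (residue-neg b)) (residue-+ a (- b))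

      residue-diff′ : ∀ a b → (-ₘ residue {n} a) +ₘ residue b ≡ residue (b - a)
      residue-diff′ a b = trans (cong (_+ₘ residue b) (residue-neg a)) (trans (residue-+ (- a) b) (cong residue (+-comm (- a) b)))

      arc : ∀ a e b f → + A (vertex a e) (vertex b f) ≡ connection (e xor f) (offset e a b)
      arc a false b false = cong (λ i → + 𝟙 (lookup X i)) (residue-diff′ a b)
      arc a false b true  = cong (λ i → + 𝟙 (lookup Y i)) (residue-diff′ a b)
      arc a true  b false = cong (λ i → + 𝟙 (lookup Y i)) (residue-diff a b)
      arc a true  b true  = cong (λ i → + 𝟙 (lookup X i)) (residue-diff a b)

      identity : ∀ a e b f → + I (vertex a e) (vertex b f) ≡ unit (e xor f) (offset e a b)
      identity a e b f = trans (𝟙-does (vertex a e ≟D vertex b f)) (evaluate e f)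
        where
        𝟙-does : {P : Set} (P? : Dec P) → + 𝟙 (does P?) ≡ ⟦ P? ⟧
        𝟙-does (yes _) = refl
        𝟙-does (no _)  = refl
        residue-injective : ∀ {a b} → residue {n} a ≡ residue b → + n ∣ a - b
        residue-injective {a} {b} eq = difference (mod-trans (mod-sym (toℕ-residue a)) (mod-trans (mod-reflexive (cong (λ i → + toℕ i) eq)) (toℕ-residue b)))
        evaluate : ∀ e f → ⟦ vertex a e ≟D vertex b f ⟧ ≡ unit (e xor f) (offset e a b)
        evaluate false false = ⟦⟧-cong (vertex a false ≟D vertex b false) (+ n ∣? b - a) (λ eq → residue-injective {b} {a} (sym (cong proj₁ eq))) (λ d → cong (_, false) (sym (residue-cong {a = b} {a} (mkMod d))))
        evaluate true  true  = ⟦⟧-cong (vertex a true ≟D vertex b true) (+ n ∣? a - b) (λ eq → residue-injective {a} {b} (cong proj₁ eq)) (λ d → cong (_, true) (residue-cong {a = a} {b} (mkMod d)))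
        evaluate false true  = ⟦⟧-no (vertex a false ≟D vertex b true) (λ ())
        evaluate true  false = ⟦⟧-no (vertex a true ≟D vertex b false) (λ ())

      ∑-vertices : ∀ F G → (∀ l → + F (vertex l false) + + F (vertex l true) ≡ G l) → + (Σ[ allD n ] F) ≡ ∑ n G
      ∑-vertices F G eq = ∑-allD n F G λ i → trans (cong (λ j → + F (j , false) + + F (j , true)) (sym (residue-toℕ i))) (eq (+ toℕ i))

      conv-from : ∀ {u v} → Periodic n u → Periodic n v → ∀ a b → ∑ n (λ l → u (l - a) * v (b - l)) ≡ conv n u v (b - a)
      conv-from {u} {v} pu pv a b = trans (sym (∑-shift (periodic-* (mkPeriodic λ l → trans (cong u (move l (+ n) a)) (step pu (l - a))) (periodic-flip pv b)) a))
        (∑-cong n (λ l → cong₂ (λ p q → u p * v q) (lemma₁ a l) (lemma₂ a b l)))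
        where
        move : ∀ l n a → l + n - a ≡ l - a + n
        move = solve-∀
        lemma₁ : ∀ a l → a + l - a ≡ l
        lemma₁ = solve-∀
        lemma₂ : ∀ a b l → b - (a + l) ≡ b - a - l
        lemma₂ = solve-∀

      conv-to : ∀ {u v} → Periodic n u → Periodic n v → ∀ a b → ∑ n (λ l → u (a - l) * v (l - b)) ≡ conv n u v (a - b)
      conv-to {u} {v} pu pv a b = trans (∑-cong n (λ l → *-comm (u (a - l)) (v (l - b)))) (trans (conv-from pv pu b a) (conv-comm pv pu (a - b)))

      -- The middle vertex is a rotation or a reflection. In the latter case the second step has the
      -- reversed offset, which is the source of y′ and x′.
      two-step : ∀ a e b f → + (Σ[ allD n ] (λ z → A (vertex a e) z ℕ.* A z (vertex b f))) ≡ paths (e xor f) (offset e a b)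
      two-step a e b f = trans (∑-vertices _ _ λ l → cong₂ _+_ (term l false) (term l true)) (evaluate e f)
        where
        term : ∀ l k → + (A (vertex a e) (vertex l k) ℕ.* A (vertex l k) (vertex b f)) ≡ connection (e xor k) (offset e a l) * connection (k xor f) (offset k l b)
        term l k = trans (pos-* (A (vertex a e) (vertex l k)) (A (vertex l k) (vertex b f))) (cong₂ _*_ (arc a e l k) (arc l k b f))
        px′ = periodic-reflect px
        py′ = periodic-reflect py
        flip : ∀ l b → l - b ≡ - (b - l)
        flip = solve-∀
        evaluate : ∀ e f → ∑ n (λ l → connection (e xor false) (offset e a l) * connection (false xor f) (offset false l b) + connection (e xor true) (offset e a l) * connection (true xor f) (offset true l b)) ≡ paths (e xor f) (offset e a b)
        evaluate false false = trans (∑-+ n (λ l → x (l - a) * x (b - l)) (λ l → y (l - a) * y (l - b)))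
          (cong₂ _+_ (conv-from px px a b) (trans (∑-cong n (λ l → cong (λ p → y (l - a) * y p) (flip l b))) (conv-from py py′ a b)))
        evaluate false true  = trans (∑-+ n (λ l → x (l - a) * y (b - l)) (λ l → y (l - a) * x (l - b)))
          (cong₂ _+_ (conv-from px py a b) (trans (∑-cong n (λ l → cong (λ p → y (l - a) * x p) (flip l b))) (conv-from py px′ a b)))
        evaluate true  false = trans (∑-+ n (λ l → y (a - l) * x (b - l)) (λ l → x (a - l) * y (l - b)))
          (trans (cong₂ _+_ (trans (∑-cong n (λ l → cong (λ p → y (a - l) * x p) (flip b l))) (conv-to py px′ a b)) (conv-to px py a b)) (+-comm (conv n y x′ (a - b)) (conv n x y (a - b))))
        evaluate true  true  = trans (∑-+ n (λ l → y (a - l) * y (b - l)) (λ l → x (a - l) * x (l - b)))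
          (trans (cong₂ _+_ (trans (∑-cong n (λ l → cong (λ p → y (a - l) * y p) (flip b l))) (conv-to py py′ a b)) (conv-to px px a b)) (+-comm (conv n y y′ (a - b)) (conv n x x (a - b))))

      ∑-translate : ∀ {u} → Periodic n u → ∀ a → ∑ n (λ l → u (l - a)) ≡ ∑ n u
      ∑-translate {u} pu a = trans (∑-cong n (λ l → cong u (+-comm l (- a)))) (∑-shift pu (- a))

      out-degree : ∀ g → + (Σ[ allD n ] (A g)) ≡ ∑ n x + ∑ n y
      out-degree = on-vertices _ λ a e → trans (∑-vertices _ _ λ l → cong₂ _+_ (arc a e l false) (arc a e l true)) (evaluate a e)
        where
        evaluate : ∀ a e → ∑ n (λ l → connection (e xor false) (offset e a l) + connection (e xor true) (offset e a l)) ≡ ∑ n x + ∑ n y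
        evaluate a false = trans (∑-+ n (λ l → x (l - a)) (λ l → y (l - a))) (cong₂ _+_ (∑-translate px a) (∑-translate py a))
        evaluate a true  = trans (∑-+ n (λ l → y (a - l)) (λ l → x (a - l))) (trans (cong₂ _+_ (∑-flip py a) (∑-flip px a)) (+-comm (∑ n y) (∑ n x)))

      in-degree : ∀ g → + (Σ[ allD n ] (λ z → A z g)) ≡ ∑ n x + ∑ n y
      in-degree = on-vertices _ λ b f → trans (∑-vertices _ _ λ l → cong₂ _+_ (arc l false b f) (arc l true b f)) (evaluate b f)
        where
        evaluate : ∀ b f → ∑ n (λ l → connection (false xor f) (b - l) + connection (true xor f) (l - b)) ≡ ∑ n x + ∑ n y
        evaluate b false = trans (∑-+ n (λ l → x (b - l)) (λ l → y (l - b))) (cong₂ _+_ (∑-flip px b) (∑-translate py b))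
        evaluate b true  = trans (∑-+ n (λ l → y (b - l)) (λ l → x (l - b))) (trans (cong₂ _+_ (∑-flip py b) (∑-translate px b)) (+-comm (∑ n y) (∑ n x)))

      private
        regroup : ∀ t λ′ μ i a → (t * i) + (λ′ * a) + (μ * ((1ℤ - i) - a)) ≡ (t - μ) * i + (λ′ - μ) * a + μ
        regroup = solve-∀
        drop-0 : ∀ τ d a μ → τ * 0ℤ + d * a + μ ≡ d * a + μ
        drop-0 = solve-∀

      -- Reads off the row of the identity; in a Cayley digraph the other rows are translates of it.
      dsrg⇒equations : ∀ {k μ λ′ t} → IsDSRGWith (allD n) _≟D_ (DihArc X Y) k μ λ′ t →
        DihedralEquations n x y (+ t - + μ) (+ λ′ - + μ) (+ μ) × ∑ n x + ∑ n y ≡ + k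
      dsrg⇒equations {k} {μ} {λ′} {t} (_ , _ , out , _ , square) =
        record { rotations   = λ g → trans (cong (paths false) (sym (+-identityʳ g))) (trans (at g false) (cong (λ u → (+ t - + μ) * δ n u + (+ λ′ - + μ) * x u + + μ) (+-identityʳ g)))
               ; reflections = λ g → trans (cong (paths true) (sym (+-identityʳ g))) (trans (at g true) (trans (drop-0 (+ t - + μ) (+ λ′ - + μ) (y (g - 0ℤ)) (+ μ)) (cong (λ u → (+ λ′ - + μ) * y u + + μ) (+-identityʳ g)))) }
        , trans (sym (out-degree (vertex 0ℤ false))) (cong +_ (out (vertex 0ℤ false)))
        where
        at : ∀ g f → paths f (g - 0ℤ) ≡ (+ t - + μ) * unit f (g - 0ℤ) + (+ λ′ - + μ) * connection f (g - 0ℤ) + + μ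
        at g f = trans (sym (two-step 0ℤ false g f)) (trans (square (vertex 0ℤ false) (vertex g f))
          (trans (cong₂ (λ i a → (+ t * i) + (+ λ′ * a) + (+ μ * ((1ℤ - i) - a))) (identity 0ℤ false g f) (arc 0ℤ false g f))
                 (regroup (+ t) (+ λ′) (+ μ) (unit f (g - 0ℤ)) (connection f (g - 0ℤ)))))

      equations⇒dsrg : ∀ {k μ λ′ t} → 0 ℕ.< t → t ℕ.< k → ∑ n x + ∑ n y ≡ + k →
        DihedralEquations n x y (+ t - + μ) (+ λ′ - + μ) (+ μ) → IsDSRGWith (allD n) _≟D_ (DihArc X Y) k μ λ′ t
      equations⇒dsrg {k} {μ} {λ′} {t} 0<t t<k degree E =
        0<t , t<k , (λ g → +-injective (trans (out-degree g) degree)) , (λ g → +-injective (trans (in-degree g) degree)) , square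
        where
        equation : ∀ f g → paths f g ≡ (+ t - + μ) * unit f g + (+ λ′ - + μ) * connection f g + + μ
        equation false g = rotations E g
        equation true  g = trans (reflections E g) (sym (drop-0 (+ t - + μ) (+ λ′ - + μ) (y g) (+ μ)))
        Square : D n → D n → Set
        Square g h = + (Σ[ allD n ] (λ z → A g z ℕ.* A z h)) ≡ (+ t * + I g h) + (+ λ′ * + A g h) + (+ μ * ((1ℤ - + I g h) - + A g h))
        square : ∀ g h → Square g h
        square = on-vertices (λ g → ∀ h → Square g h) λ a e → on-vertices (Square (vertex a e)) λ b f →
          trans (two-step a e b f) (trans (equation (e xor f) (offset e a b))
          (sym (trans (cong₂ (λ i c → (+ t * i) + (+ λ′ * c) + (+ μ * ((1ℤ - i) - c))) (identity a e b f) (arc a e b f))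
                      (regroup (+ t) (+ λ′) (+ μ) (unit (e xor f) (offset e a b)) (connection (e xor f) (offset e a b))))))

  -- Construction of solutions

  -- The condition m ∤ 1 makes the subgroup R generated by m proper; its order is ρ, and M is the
  -- size of Y.
  module Converse {m n : ℕ} .{{_ : ℕ.NonZero n}} (m∣n : ∃ λ r → n ≡ r ℕ.* m) (m∤1 : ¬ (+ m ∣ 1ℤ))
    {y : ℤ → ℤ} (ym : Periodic m y) (by : BinaryValued y) (y-skew : ∀ g → y g + y (- g) ≡ 1ℤ + δ m g) where

    private
      R = δ m
      y′ = reflect y
      M = ∑ n y
      ρ = ∑ n R

      refine : ∀ {f} → Periodic m f → Periodic n f
      refine {f} pf = subst (λ k → Periodic k f) (sym (proj₂ m∣n)) (periodic-· (proj₁ m∣n) pf)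

      py : Periodic n y
      py = refine ym
      pR : Periodic n R
      pR = refine (δ-periodic m)
      py′ = periodic-reflect py
      yy = conv n y y

      R*_ : ∀ {f} → Periodic m f → ∀ g → conv n R f g ≡ ρ * f g
      R*_ {f} pf g = ∑-absorb n R (λ h → f (g - h)) (f g) cases
        where
        lemma : ∀ g h → g - h - g ≡ - h
        lemma = solve-∀
        cases : ∀ h → R h ≡ 0ℤ ⊎ f (g - h) ≡ f g
        cases h with δ-binary m h
        ... | inj₁ e = inj₁ e
        ... | inj₂ e = inj₂ (periodic-≡ pf (subst (+ m ∣_) (sym (lemma g h)) (∣m⇒∣-m (δ≡1⇒∣ e))))

      y*R : ∀ g → conv n y R g ≡ ρ * y g
      y*R g = trans (conv-comm py pR g) ((R* ym) g)

      y′≡ : ∀ g → y′ g ≡ (1ℤ + R g) + - y g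
      y′≡ g = trans (lemma (y g) (y′ g)) (cong (_- y g) (y-skew g))
        where
        lemma : ∀ a b → b ≡ (a + b) - a
        lemma = solve-∀

      -- Substituting y′ = 1 + R - y leaves the undetermined product y∗y with a minus sign, ready to
      -- cancel against the one in x∗x or x∗y.
      y*y′ : ∀ g → conv n y y′ g ≡ (M + ρ * y g) - yy g
      y*y′ g = begin
        conv n y y′ g                                       ≡⟨ conv-cong n {f = y} (λ _ → refl) y′≡ g ⟩
        conv n y (λ h → (1ℤ + R h) + - y h) g               ≡⟨ conv-distribʳ n y (λ h → 1ℤ + R h) (λ h → - y h) g ⟩
        conv n y (λ h → 1ℤ + R h) g + conv n y (λ h → - y h) g ≡⟨ cong₂ _+_ (conv-distribʳ n y (λ _ → 1ℤ) R g) (conv-negʳ n y y g) ⟩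
        (conv n y (λ _ → 1ℤ) g + conv n y R g) - yy g       ≡⟨ cong (_- yy g) (cong₂ _+_ (trans (conv-constʳ n y 1ℤ g) (*-identityʳ M)) (y*R g)) ⟩
        (M + ρ * y g) - yy g                                ∎

    -- With X = Y − Q everything is determined by the products Q∗Y and Q∗Q.
    module _ {Q : ℤ → ℤ} (pQ : Periodic n Q) (Q-even : ∀ g → Q (- g) ≡ Q g) (ε : ℤ)
      (Q*y : ∀ g → conv n Q y g ≡ ε * y g) (Q*Q : ∀ g → conv n Q Q g ≡ ε * Q g) where
      private
        x : ℤ → ℤ
        x g = y g + - Q g

        x-expand : ∀ f g → conv n x f g ≡ conv n y f g - conv n Q f g
        x-expand f g = trans (conv-distribˡ n y (λ h → - Q h) f g) (cong (_+_ (conv n y f g)) (conv-negˡ n Q f g))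

        y*Q : ∀ g → conv n y Q g ≡ ε * y g
        y*Q g = trans (conv-comm py pQ g) (Q*y g)

      x*x+y*y′ : ∀ g → conv n x x g + conv n y y′ g ≡ ε * Q g + (ρ - + 2 * ε) * y g + M
      x*x+y*y′ g = begin
        conv n x x g + conv n y y′ g
          ≡⟨ cong₂ _+_ (trans (x-expand x g) (cong₂ _-_ (f*x y (y*Q g)) (f*x Q (Q*Q g)))) (y*y′ g) ⟩
        ((yy g - ε * y g) - (conv n Q y g - ε * Q g)) + ((M + ρ * y g) - yy g)
          ≡⟨ cong (λ u → ((yy g - ε * y g) - (u - ε * Q g)) + ((M + ρ * y g) - yy g)) (Q*y g) ⟩
        ((yy g - ε * y g) - (ε * y g - ε * Q g)) + ((M + ρ * y g) - yy g)
          ≡⟨ lemma (yy g) ε (y g) (Q g) M ρ ⟩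
        ε * Q g + (ρ - + 2 * ε) * y g + M ∎
        where
        f*x : ∀ f {a} → conv n f Q g ≡ a → conv n f x g ≡ conv n f y g - a
        f*x f f*Q = trans (conv-distribʳ n f y (λ h → - Q h) g) (cong (_+_ (conv n f y g)) (trans (conv-negʳ n f Q g) (cong -_ f*Q)))
        lemma : ∀ yy ε y Q M ρ → ((yy - ε * y) - (ε * y - ε * Q)) + ((M + ρ * y) - yy) ≡ ε * Q + (ρ - + 2 * ε) * y + M
        lemma = solve-∀

      x*y+y*x′ : ∀ g → conv n x y g + conv n y (reflect x) g ≡ (ρ - + 2 * ε) * y g + M
      x*y+y*x′ g = begin
        conv n x y g + conv n y (reflect x) g
          ≡⟨ cong₂ _+_ (trans (x-expand y g) (cong (_-_ (yy g)) (Q*y g)))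
                       (trans (conv-cong n {f = y} (λ _ → refl) (λ h → cong (λ u → y′ h + - u) (Q-even h)) g)
                       (trans (conv-distribʳ n y y′ (λ h → - Q h) g)
                              (cong₂ _+_ (y*y′ g) (trans (conv-negʳ n y Q g) (cong -_ (y*Q g)))))) ⟩
        (yy g - ε * y g) + (((M + ρ * y g) - yy g) - ε * y g)
          ≡⟨ lemma (yy g) ε (y g) M ρ ⟩
        (ρ - + 2 * ε) * y g + M ∎
        where
        lemma : ∀ yy ε y M ρ → (yy - ε * y) + (((M + ρ * y) - yy) - ε * y) ≡ (ρ - + 2 * ε) * y + M
        lemma = solve-∀

    ρ₀ M₀ : ℕ
    ρ₀ = ∣ ρ ∣
    M₀ = ∣ M ∣

    +ρ₀ : + ρ₀ ≡ ρ
    +ρ₀ = 0≤i⇒+∣i∣≡i (∑-nonneg n R (λ g → binary-≥0 (δ-binary m g)))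

    +M₀ : + M₀ ≡ M
    +M₀ = 0≤i⇒+∣i∣≡i (∑-nonneg n y (λ g → binary-≥0 (by g)))

    0<ρ₀ : 0 ℕ.< ρ₀
    0<ρ₀ = ℕ.n≢0⇒n>0 λ ρ₀≡0 → case trans (sym (δ-yes {m} {0ℤ} (divides 0ℤ refl)))
      (∑-zero pR (λ g → binary-≥0 (δ-binary m g)) (trans (sym +ρ₀) (cong +_ ρ₀≡0)) 0ℤ) of λ ()

    ∑-complement : ∑ n (λ g → 1ℤ - R g) ≡ + n - ρ
    ∑-complement = trans (∑-+ n (λ _ → 1ℤ) (λ g → - R g)) (cong₂ _+_ (trans (∑-const n 1ℤ) (*-identityʳ (+ n))) (∑-neg n R))

    ρ₀<n : ρ₀ ℕ.< n
    ρ₀<n = ℕ.≤∧≢⇒< (drop‿+≤+ (subst (_≤ + n) (sym +ρ₀) (0≤i-j⇒j≤i (subst (0ℤ ≤_) ∑-complement (∑-nonneg n _ complement≥0)))))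
      λ ρ₀≡n → case trans (sym (cong (_-_ 1ℤ) (δ-no m∤1))) (∑-zero (periodic-+ (periodic-const 1ℤ) (periodic-neg pR)) complement≥0
        (trans ∑-complement (i≡j⇒i-j≡0 (trans (cong +_ (sym ρ₀≡n)) +ρ₀))) 1ℤ) of λ ()
      where
      complement≥0 : ∀ g → 0ℤ ≤ 1ℤ - R g
      complement≥0 g with δ-binary m g
      ... | inj₁ e = subst (λ u → 0ℤ ≤ 1ℤ - u) (sym e) (+≤+ ℕ.z≤n)
      ... | inj₂ e = subst (λ u → 0ℤ ≤ 1ℤ - u) (sym e) (+≤+ ℕ.z≤n)

    2M₀≡ : M₀ ℕ.+ M₀ ≡ n ℕ.+ ρ₀
    2M₀≡ = +-injective (begin
      + M₀ + + M₀                     ≡⟨ cong₂ _+_ +M₀ +M₀ ⟩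
      M + M                           ≡⟨ cong (_+_ M) (∑-reflect py) ⟨
      M + ∑ n y′                      ≡⟨ ∑-+ n y y′ ⟨
      ∑ n (λ g → y g + y′ g)          ≡⟨ ∑-cong n y-skew ⟩
      ∑ n (λ g → 1ℤ + R g)            ≡⟨ ∑-+ n (λ _ → 1ℤ) R ⟩
      ∑ n (λ _ → 1ℤ) + ρ              ≡⟨ cong₂ _+_ (trans (∑-const n 1ℤ) (*-identityʳ (+ n))) (sym +ρ₀) ⟩
      + n + + ρ₀                      ∎)

    -- By `2M₀≡`, M₀ is the mean of n and ρ₀, and ρ₀ < n. This strict inequality becomes t < k in
    -- both constructions.
    ρ₀<M₀ : ρ₀ ℕ.< M₀
    ρ₀<M₀ = ℕ.≰⇒> λ M₀≤ρ₀ → ℕ.<-irrefl 2M₀≡ (ℕ.≤-<-trans (ℕ.+-mono-≤ M₀≤ρ₀ M₀≤ρ₀) (ℕ.+-monoˡ-< ρ₀ ρ₀<n))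

    record Solution (x : ℤ → ℤ) : Set where
      field
        k μ λ′ t  : ℕ
        0<t       : 0 ℕ.< t
        t<k       : t ℕ.< k
        degree    : ∑ n x + ∑ n y ≡ + k
        equations : DihedralEquations n x y (+ t - + μ) (+ λ′ - + μ) (+ μ)

    difference-degree : ∀ {x Q} → (∀ g → x g ≡ y g + - Q g) → ∑ n x + M ≡ (M - ∑ n Q) + M
    difference-degree {x} {Q} x≡ = cong (_+ M) (trans (∑-cong n x≡) (trans (∑-+ n y (λ g → - Q g)) (cong (_+_ M) (∑-neg n Q))))

    -- Here t = |Y| + ρ − 1 and λ = |Y| + ρ − 2; the predecessors of ρ and |Y| avoid truncated subtraction.
    remove-identity : ∀ {x} → (∀ g → x g ≡ y g + - δ n g) → Solution x
    remove-identity {x} x≡ with ρ₀ | M₀ | 0<ρ₀ | ρ₀<M₀ | +ρ₀ | +M₀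
    ... | suc r | suc s | _ | ℕ.s≤s r<s | ρ≡ | M≡ = record
      { k = suc s ℕ.+ s ; μ = suc s ; λ′ = s ℕ.+ r ; t = suc s ℕ.+ r
      ; 0<t = ℕ.s≤s ℕ.z≤n ; t<k = ℕ.+-monoʳ-< (suc s) r<s
      ; degree = trans (difference-degree x≡) (trans (cong₂ (λ u v → (u - v) + u) (sym M≡) ∑δ) (lemma₁ (+ s)))
      ; equations = record
        { rotations = λ g → begin
            conv n x x g + conv n y y′ g                      ≡⟨ cong (_+ conv n y y′ g) (conv-cong n x≡ x≡ g) ⟩
            _                                                 ≡⟨ x*x+y*y′ (δ-periodic n) (δ-even n) 1ℤ (δ* py) (δ* (δ-periodic n)) g ⟩
            1ℤ * δ n g + (ρ - + 2 * 1ℤ) * y g + M             ≡⟨ cong₂ (λ u v → 1ℤ * δ n g + (u - + 2 * 1ℤ) * y g + v) (sym ρ≡) (sym M≡) ⟩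
            1ℤ * δ n g + (+ suc r - + 2 * 1ℤ) * y g + + suc s ≡⟨ lemma₂ (+ r) (+ s) (y g) (δ n g) ⟩
            (+ (suc s ℕ.+ r) - + suc s) * δ n g + (+ (s ℕ.+ r) - + suc s) * (y g + - δ n g) + + suc s ≡⟨ cong (λ u → (+ (suc s ℕ.+ r) - + suc s) * δ n g + (+ (s ℕ.+ r) - + suc s) * u + + suc s) (x≡ g) ⟨
            (+ (suc s ℕ.+ r) - + suc s) * δ n g + (+ (s ℕ.+ r) - + suc s) * x g + + suc s ∎
        ; reflections = λ g → begin
            conv n x y g + conv n y (reflect x) g             ≡⟨ cong₂ _+_ (conv-cong n {g = y} x≡ (λ _ → refl) g) (conv-cong n {f = y} (λ _ → refl) (λ h → x≡ (- h)) g) ⟩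
            _                                                 ≡⟨ x*y+y*x′ (δ-periodic n) (δ-even n) 1ℤ (δ* py) (δ* (δ-periodic n)) g ⟩
            (ρ - + 2 * 1ℤ) * y g + M                          ≡⟨ cong₂ (λ u v → (u - + 2 * 1ℤ) * y g + v) (sym ρ≡) (sym M≡) ⟩
            (+ suc r - + 2 * 1ℤ) * y g + + suc s              ≡⟨ lemma₃ (+ r) (+ s) (y g) ⟩
            (+ (s ℕ.+ r) - + suc s) * y g + + suc s           ∎ } }
      where
      δ* : ∀ {f} → Periodic n f → ∀ g → conv n (δ n) f g ≡ 1ℤ * f g
      δ* {f} pf g = trans (∑-δ n (λ h → f (g - h))) (trans (cong f (+-identityʳ g)) (sym (*-identityˡ (f g))))
      ∑δ : ∑ n (δ n) ≡ 1ℤ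
      ∑δ = trans (∑-cong n (λ g → sym (*-identityʳ (δ n g)))) (∑-δ n (λ _ → 1ℤ))
      lemma₁ : ∀ s → ((+ 1 + s) - 1ℤ) + (+ 1 + s) ≡ (+ 1 + s) + s
      lemma₁ = solve-∀
      lemma₂ : ∀ r s y e → 1ℤ * e + ((+ 1 + r) - + 2 * 1ℤ) * y + (+ 1 + s) ≡ (((+ 1 + s) + r) - (+ 1 + s)) * e + ((s + r) - (+ 1 + s)) * (y + - e) + (+ 1 + s)
      lemma₂ = solve-∀
      lemma₃ : ∀ r s y → ((+ 1 + r) - + 2 * 1ℤ) * y + (+ 1 + s) ≡ ((s + r) - (+ 1 + s)) * y + (+ 1 + s)
      lemma₃ = solve-∀

    -- With Q = R and ε = ρ the rotation side collapses to -ρ(y - R) + M = -ρx + M. No δ remains, so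
    -- t = μ = |Y|, and λ = |Y| - ρ.
    remove-subgroup : ∀ {x} → (∀ g → x g ≡ y g + - δ m g) → Solution x
    remove-subgroup {x} x≡ = record
      { k = q ℕ.+ M₀ ; μ = M₀ ; λ′ = q ; t = M₀
      ; 0<t = ℕ.<-trans 0<ρ₀ ρ₀<M₀ ; t<k = ℕ.m<n+m M₀ (ℕ.m<n⇒0<n∸m ρ₀<M₀)
      ; degree = trans (difference-degree x≡) (trans (cong₂ (λ u v → (u - v) + u) (sym +M₀) (sym +ρ₀)) (cong (_+ + M₀) (sym q≡)))
      ; equations = record
        { rotations = λ g → begin
            conv n x x g + conv n y y′ g                      ≡⟨ cong (_+ conv n y y′ g) (conv-cong n x≡ x≡ g) ⟩
            _                                                 ≡⟨ x*x+y*y′ pR (δ-even m) ρ (R* ym) (R* (δ-periodic m)) g ⟩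
            ρ * R g + (ρ - + 2 * ρ) * y g + M                 ≡⟨ cong₂ (λ u v → u * R g + (u - + 2 * u) * y g + v) (sym +ρ₀) (sym +M₀) ⟩
            + ρ₀ * R g + (+ ρ₀ - + 2 * + ρ₀) * y g + + M₀     ≡⟨ lemma₁ (+ ρ₀) (+ M₀) (y g) (R g) (δ n g) ⟩
            (+ M₀ - + M₀) * δ n g + ((+ M₀ - + ρ₀) - + M₀) * (y g + - R g) + + M₀ ≡⟨ cong₂ (λ u v → (+ M₀ - + M₀) * δ n g + (u - + M₀) * v + + M₀) q≡ (x≡ g) ⟨
            (+ M₀ - + M₀) * δ n g + (+ q - + M₀) * x g + + M₀ ∎
        ; reflections = λ g → begin
            conv n x y g + conv n y (reflect x) g             ≡⟨ cong₂ _+_ (conv-cong n {g = y} x≡ (λ _ → refl) g) (conv-cong n {f = y} (λ _ → refl) (λ h → x≡ (- h)) g) ⟩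
            _                                                 ≡⟨ x*y+y*x′ pR (δ-even m) ρ (R* ym) (R* (δ-periodic m)) g ⟩
            (ρ - + 2 * ρ) * y g + M                           ≡⟨ cong₂ (λ u v → (u - + 2 * u) * y g + v) (sym +ρ₀) (sym +M₀) ⟩
            (+ ρ₀ - + 2 * + ρ₀) * y g + + M₀                  ≡⟨ lemma₂ (+ ρ₀) (+ M₀) (y g) ⟩
            ((+ M₀ - + ρ₀) - + M₀) * y g + + M₀               ≡⟨ cong (λ u → (u - + M₀) * y g + + M₀) q≡ ⟨
            (+ q - + M₀) * y g + + M₀                         ∎ } }
      where
      q = M₀ ℕ.∸ ρ₀
      q≡ : + q ≡ + M₀ - + ρ₀
      q≡ = trans (sym (⊖-≥ (ℕ.<⇒≤ ρ₀<M₀))) (sym (m-n≡m⊖n M₀ ρ₀))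
      lemma₁ : ∀ r s y R e → r * R + (r - + 2 * r) * y + s ≡ (s - s) * e + ((s - r) - s) * (y + - R) + s
      lemma₁ = solve-∀
      lemma₂ : ∀ r s y → (r - + 2 * r) * y + s ≡ ((s - r) - s) * y + s
      lemma₂ = solve-∀

  -- Subsets of ℤ_n

  ∈─⇒∉ : ∀ {n} {i : Fin n} (S T : Subset n) → i ∈ S ─ T → i ∉ T
  ∈─⇒∉ (_ ∷ S) (outside ∷ T) here        ()
  ∈─⇒∉ (_ ∷ S) (outside ∷ T) (there i∈)  (there i∈T) = ∈─⇒∉ S T i∈ i∈T
  ∈─⇒∉ (_ ∷ S) (inside  ∷ T) (there i∈)  (there i∈T) = ∈─⇒∉ S T i∈ i∈T

  []ₛ≡𝟙 : ∀ s → [ s ]ₛ ≡ 𝟙 s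
  []ₛ≡𝟙 true  = refl
  []ₛ≡𝟙 false = refl

  mod′≡% : ∀ k m .{{_ : ℕ.NonZero m}} → k mod′ m ≡ k ℕ.% m
  mod′≡% k (suc m) = refl

  ∣toℕ⇒≡0 : ∀ {n} {i : Fin n} → + n ∣ + toℕ i → toℕ i ≡ 0
  ∣toℕ⇒≡0 {i = i} n∣i = ℕ.n≤0⇒n≡0 (ℕ.≮⇒≥ λ 0<i → ∤-between 0<i (toℕ<n i) n∣i)

  toℕ≡0⇒∣ : ∀ {n} {i : Fin n} → toℕ i ≡ 0 → + n ∣ + toℕ i
  toℕ≡0⇒∣ {n} i≡0 = subst (λ k → + n ∣ + k) (sym i≡0) (divides 0ℤ refl)

  δ-toℕ : ∀ {m} (i : Fin m) → δ m (+ toℕ i) ≡ + 𝟙 (toℕ i ℕ.≡ᵇ 0)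
  δ-toℕ {m} i with toℕ i in eq
  ... | zero  = δ-yes {m} (divides 0ℤ refl)
  ... | suc k = δ-no (∤-between (ℕ.s≤s ℕ.z≤n) (subst (ℕ._< m) eq (toℕ<n i)))

  module _ {n : ℕ} .{{_ : ℕ.NonZero n}} (S : Subset n) where

    ∈⇒indicator : ∀ a → residue a ∈ S → indicator S a ≡ 1ℤ
    ∈⇒indicator a a∈S = cong (λ b → + 𝟙 b) ([]=⇒lookup a∈S)

    indicator⇒∈ : ∀ a → indicator S a ≡ 1ℤ → residue a ∈ S
    indicator⇒∈ a eq = lookup⇒[]= (residue a) S (inside≡ (lookup S (residue a)) eq)
      where
      inside≡ : ∀ b → + 𝟙 b ≡ 1ℤ → b ≡ inside
      inside≡ true _ = refl

    toℕ∈⇒indicator : ∀ {i} → i ∈ S → indicator S (+ toℕ i) ≡ 1ℤ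
    toℕ∈⇒indicator {i} i∈S = ∈⇒indicator (+ toℕ i) (subst (_∈ S) (sym (residue-toℕ i)) i∈S)

    indicator⇒toℕ∈ : ∀ {i} → indicator S (+ toℕ i) ≡ 1ℤ → i ∈ S
    indicator⇒toℕ∈ {i} eq = subst (_∈ S) (residue-toℕ i) (indicator⇒∈ (+ toℕ i) eq)

  binary-ext : ∀ {a b} → a ≡ 0ℤ ⊎ a ≡ 1ℤ → b ≡ 0ℤ ⊎ b ≡ 1ℤ → (a ≡ 1ℤ → b ≡ 1ℤ) → (b ≡ 1ℤ → a ≡ 1ℤ) → a ≡ b
  binary-ext (inj₂ a) _        to from = trans a (sym (to a))
  binary-ext (inj₁ a) (inj₁ b) to from = trans a (sym b)
  binary-ext (inj₁ a) (inj₂ b) to from = trans (from b) (sym b)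

  UnitInvariant : ∀ {n} → Subset n → Set
  UnitInvariant S = ∀ u → IsUnit u → ∀ i → i ∈ S → (u *ₘ i) ∈ S

  -- Compares the multiplicities of i on the two sides of the multiset equation.
  Skew : ∀ {m} → Subset m → Set
  Skew H = ∀ i → [ lookup H i ]ₛ ℕ.+ [ lookup H (-ₘ i) ]ₛ ≡ 1 ℕ.+ 𝟙 (toℕ i ℕ.≡ᵇ 0)

  -- From the digraph to the structure of X and Y

  module Forward {p : ℕ} (pp : Prime p) (2∤p : ¬ (2 ℕ.∣ p)) (α : ℕ) (X Y : Subset (p ℕ.^ α))
    (0∉X : ∀ i → toℕ i ≡ 0 → i ∉ X) (0∈Y : ∀ i → toℕ i ≡ 0 → i ∈ Y)
    (dsrg : IsDSRG (allD (p ℕ.^ α)) _≟D_ (DihArc X Y)) (X⊆Y : X ⊆ Y) (invariant : UnitInvariant (Y ─ X)) where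
    private
      n = p ℕ.^ α
      instance
        p≢0 : ℕ.NonZero p
        p≢0 = prime⇒nonZero pp
        n≢0 : ℕ.NonZero n
        n≢0 = ℕ.m^n≢0 p α
      x = indicator X
      y = indicator Y
      z : ℤ → ℤ
      z g = y g - x g

    y≡x+z : ∀ g → y g ≡ x g + z g
    y≡x+z g = lemma (x g) (y g)
      where
      lemma : ∀ x y → y ≡ x + (y - x)
      lemma = solve-∀

    x⇒y : ∀ g → x g ≡ 1ℤ → y g ≡ 1ℤ
    x⇒y g xg = ∈⇒indicator Y g (X⊆Y (indicator⇒∈ X g xg))

    bz : BinaryValued z
    bz g with indicator-binary X g | indicator-binary Y g
    ... | inj₁ a | inj₁ b = inj₁ (cong₂ _-_ b a)
    ... | inj₁ a | inj₂ b = inj₂ (cong₂ _-_ b a)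
    ... | inj₂ a | _      = inj₁ (cong₂ _-_ (x⇒y g a) a)

    z⇒∈ : ∀ g → z g ≡ 1ℤ → residue g ∈ Y ─ X
    z⇒∈ g zg with indicator-binary X g | indicator-binary Y g
    ... | inj₁ a | inj₂ b = x∈p∧x∉q⇒x∈p─q (indicator⇒∈ Y g b) (λ g∈X → case trans (sym a) (∈⇒indicator X g g∈X) of λ ())
    ... | inj₁ a | inj₁ b = case trans (sym zg) (cong₂ _-_ b a) of λ ()
    ... | inj₂ a | _      = case trans (sym zg) (cong₂ _-_ (x⇒y g a) a) of λ ()

    ∈⇒z : ∀ g → residue g ∈ Y ─ X → z g ≡ 1ℤ
    ∈⇒z g g∈ with indicator-binary X g
    ... | inj₁ a = cong₂ _-_ (∈⇒indicator Y g (p─q⊆p Y X g∈)) a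
    ... | inj₂ a = contradiction (indicator⇒∈ X g a) (∈─⇒∉ Y X g∈)

    residue-* : ∀ a b → residue {n} a *ₘ residue b ≡ residue (a * b)
    residue-* a b = residue-unique (mod-trans (toℕ-*ₘ (residue a) (residue b)) (mod-trans (mod-*ʳ (+ toℕ (residue {n} b)) (toℕ-residue a))
      (mod-trans (mod-reflexive (*-comm a (+ toℕ (residue {n} b)))) (mod-trans (mod-*ʳ a (toℕ-residue b)) (mod-reflexive (*-comm b a))))))

    -- Invariance under this unit is what makes Y∖X inverse-closed.
    -1-unit : IsUnit (residue {n} -1ℤ)
    -1-unit = residue -1ℤ , trans (residue-* -1ℤ -1ℤ) (sym (residue-unique (toℕ-oneₘ (residue -1ℤ))))

    z-closed-neg : ∀ g → z g ≡ 1ℤ → z (- g) ≡ 1ℤ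
    z-closed-neg g zg = ∈⇒z (- g) (subst (_∈ Y ─ X) (trans (residue-* -1ℤ g) (cong residue (-1*i≡-i g))) (invariant (residue -1ℤ) -1-unit (residue g) (z⇒∈ g zg)))

    z-even : ∀ g → z (- g) ≡ z g
    z-even g = binary-ext (bz (- g)) (bz g) (λ e → trans (cong z (sym (neg-involutive g))) (z-closed-neg (- g) e)) (z-closed-neg g)

    toℕ-residue-0 : toℕ (residue {n} 0ℤ) ≡ 0
    toℕ-residue-0 = trans (cong toℕ (trans (cong residue (cong +_ (sym (toℕ-fromℕ< 0<n)))) (residue-toℕ (fromℕ< 0<n)))) (toℕ-fromℕ< 0<n)
      where
      0<n : 0 ℕ.< n
      0<n = ℕ.m^n>0 p α

    y0 : y 0ℤ ≡ 1ℤ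
    y0 = ∈⇒indicator Y 0ℤ (0∈Y (residue 0ℤ) toℕ-residue-0)

    x0 : x 0ℤ ≡ 0ℤ
    x0 with indicator-binary X 0ℤ
    ... | inj₁ e = e
    ... | inj₂ e = contradiction (indicator⇒∈ X 0ℤ e) (0∉X (residue 0ℤ) toℕ-residue-0)

    classified : Classified p α y z
    classified =
      let k , μ , λ′ , t , is-dsrg = dsrg
          _ , t<k , _              = is-dsrg
          E , degree               = dsrg⇒equations X Y {k} {μ} {λ′} {t} is-dsrg
          genuine                  = λ eq → ℕ.<-irrefl (sym (+-injective (trans (sym degree) (trans eq (cancel (+ t) (+ μ)))))) t<k
      in Classification.classified pp 2∤p α (indicator-periodic X) (indicator-periodic Y)
           (periodic-+ (indicator-periodic Y) (periodic-neg (indicator-periodic X))) y≡x+z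
           (indicator-binary X) (indicator-binary Y) bz y0 x0 z-even E genuine
      where
      cancel : ∀ t μ → t - μ + μ ≡ t
      cancel = solve-∀

    module Conclusion (C : Classified p α y z) where
      open Classified C public
      private
        m = p ℕ.^ γ
        instance
          m≢0 : ℕ.NonZero m
          m≢0 = ℕ.m^n≢0 p γ

      -- Membership in Y is sampled at the representatives 0, ..., m - 1; periodicity of y makes the
      -- choice of representatives immaterial.
      H : Subset m
      H = tabulate (λ i → lookup Y (residue (+ toℕ i)))

      lookup-H : ∀ i → + 𝟙 (lookup H i) ≡ y (+ toℕ i)
      lookup-H i = cong (λ b → + 𝟙 b) (lookup∘tabulate (λ i → lookup Y (residue (+ toℕ i))) i)

      y-mod : ∀ {a b} → a ≡ b [mod m ] → y a ≡ y b
      y-mod {a} {b} e = periodic-≡ y-periodic {a} {b} (difference e)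

      H-skew : Skew H
      H-skew i = +-injective (begin
        + ([ lookup H i ]ₛ ℕ.+ [ lookup H (-ₘ i) ]ₛ)      ≡⟨ cong₂ (λ a b → + a + + b) ([]ₛ≡𝟙 (lookup H i)) ([]ₛ≡𝟙 (lookup H (-ₘ i))) ⟩
        + 𝟙 (lookup H i) + + 𝟙 (lookup H (-ₘ i))          ≡⟨ cong₂ _+_ (lookup-H i) (trans (lookup-H (-ₘ i)) (y-mod (toℕ--ₘ i))) ⟩
        y (+ toℕ i) + y (- + toℕ i)                       ≡⟨ y-skew (+ toℕ i) ⟩
        1ℤ + δ m (+ toℕ i)                                ≡⟨ cong (_+_ 1ℤ) (δ-toℕ i) ⟩
        + (1 ℕ.+ 𝟙 (toℕ i ℕ.≡ᵇ 0))                        ∎)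

      Y-preimage : ∀ i → (i ∈ Y) ⇔ InPreimage H i
      Y-preimage i = mk⇔ to from
        where
        to : i ∈ Y → InPreimage H i
        to i∈Y = residue (+ toℕ i) , trans (toℕ-fromℕ< (n%ℕd<d (+ toℕ i) m)) (sym (mod′≡% (toℕ i) m)) ,
          lookup⇒[]= (residue (+ toℕ i)) H (trans (lookup∘tabulate _ (residue (+ toℕ i)))
            ([]=⇒lookup (indicator⇒∈ Y (+ toℕ (residue {m} (+ toℕ i))) (trans (y-mod (toℕ-residue (+ toℕ i))) (toℕ∈⇒indicator Y i∈Y)))))
        from : InPreimage H i → i ∈ Y
        from (h , toℕh≡ , h∈H) = indicator⇒toℕ∈ Y (trans
          (y-mod (mod-trans (mod-sym (%-mod (toℕ i) m)) (mod-reflexive (cong +_ (sym (trans toℕh≡ (mod′≡% (toℕ i) m)))))))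
          (trans (sym (lookup-H h)) (cong (λ b → + 𝟙 b) ([]=⇒lookup h∈H))))

      -- Treats both shapes at once: q = p^α deletes only 0, since indices are smaller than p^α, and
      -- q = p^γ deletes the subgroup.
      X-complement : ∀ {q} → (∀ g → z g ≡ δ q g) → ∀ i → (i ∈ X) ⇔ (i ∈ Y × ¬ (+ q ∣ + toℕ i))
      X-complement {q} z≡δ i = mk⇔ to from
        where
        a = + toℕ i
        to : i ∈ X → i ∈ Y × ¬ (+ q ∣ a)
        to i∈X = X⊆Y i∈X , λ q∣a → case trans (sym (trans (z≡δ a) (δ-yes q∣a))) (cong₂ _-_ (x⇒y a (toℕ∈⇒indicator X i∈X)) (toℕ∈⇒indicator X i∈X)) of λ ()
        from : i ∈ Y × ¬ (+ q ∣ a) → i ∈ X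
        from (i∈Y , q∤a) with indicator-binary X a
        ... | inj₂ e = indicator⇒toℕ∈ X e
        ... | inj₁ e = case trans (sym (cong₂ _-_ (toℕ∈⇒indicator Y i∈Y) e)) (trans (z≡δ a) (δ-no q∤a)) of λ ()

      X-shape : (∀ i → (i ∈ X) ⇔ (i ∈ Y × toℕ i ≢ 0)) ⊎ (∀ i → (i ∈ X) ⇔ (i ∈ Y × ¬ (m ℕ.∣ toℕ i)))
      X-shape with z-shape
      ... | inj₁ z≡δ = inj₁ λ i → let open Equivalence (X-complement z≡δ i) in
        mk⇔ (λ i∈X → proj₁ (to i∈X) , proj₂ (to i∈X) ∘ toℕ≡0⇒∣) (λ (i∈Y , i≢0) → from (i∈Y , i≢0 ∘ ∣toℕ⇒≡0))
      ... | inj₂ z≡δ = inj₂ λ i → let open Equivalence (X-complement z≡δ i) in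
        mk⇔ (λ i∈X → proj₁ (to i∈X) , proj₂ (to i∈X) ∘ ∣ᵤ⇒∣) (λ (i∈Y , m∤i) → from (i∈Y , m∤i ∘ ∣⇒∣ᵤ))

  -- From the structure of X and Y to the digraph

  module Backward {p : ℕ} (pp : Prime p) {α γ : ℕ} (1≤γ : 1 ℕ.≤ γ) (γ≤α : γ ℕ.≤ α) (X Y : Subset (p ℕ.^ α))
    (0∉X : ∀ i → toℕ i ≡ 0 → i ∉ X) (0∈Y : ∀ i → toℕ i ≡ 0 → i ∈ Y)
    (H : Subset (p ℕ.^ γ)) (H-skew : Skew H) (preimage : ∀ i → (i ∈ Y) ⇔ InPreimage H i) where
    private
      n = p ℕ.^ α
      m = p ℕ.^ γ
      instance
        p≢0 : ℕ.NonZero p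
        p≢0 = prime⇒nonZero pp
        n≢0 : ℕ.NonZero n
        n≢0 = ℕ.m^n≢0 p α
        m≢0 : ℕ.NonZero m
        m≢0 = ℕ.m^n≢0 p γ
      x = indicator X
      y = indicator Y
      open Equivalence

    +m∣+n : + m ∣ + n
    +m∣+n = divides (+ (p ℕ.^ (α ℕ.∸ γ))) (trans (cong +_ (power-quotient p γ≤α)) (pos-* (p ℕ.^ (α ℕ.∸ γ)) m))

    coarsen : ∀ {a b} → a ≡ b [mod n ] → a ≡ b [mod m ]
    coarsen (mkMod d) = mkMod (∣-trans +m∣+n d)

    -- Since m ∣ n, reducing modulo n and then modulo m is reducing modulo m, so Y and H define the
    -- same function on ℤ.
    y≡H : ∀ g → y g ≡ indicator H g
    y≡H g = binary-ext (indicator-binary Y g) (indicator-binary H g) forth back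
      where
      forth : y g ≡ 1ℤ → indicator H g ≡ 1ℤ
      forth yg with to (preimage (residue g)) (indicator⇒∈ Y g yg)
      ... | h , toℕh≡ , h∈H = ∈⇒indicator H g (subst (_∈ H) (residue-unique (mod-trans
        (mod-trans (mod-reflexive (cong +_ (trans toℕh≡ (mod′≡% _ m)))) (%-mod (toℕ (residue {n} g)) m)) (coarsen (toℕ-residue g)))) h∈H)
      back : indicator H g ≡ 1ℤ → y g ≡ 1ℤ
      back hg = ∈⇒indicator Y g (from (preimage (residue g)) (residue (+ toℕ (residue {n} g)) ,
        trans (toℕ-fromℕ< (n%ℕd<d (+ toℕ (residue {n} g)) m)) (sym (mod′≡% _ m)) ,
        subst (_∈ H) (residue-cong (mod-sym (coarsen (toℕ-residue g)))) (indicator⇒∈ H g hg)))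

    y-periodic : Periodic m y
    y-periodic .step g = trans (y≡H (g + + m)) (trans (step (indicator-periodic H) g) (sym (y≡H g)))

    y-skew : ∀ g → y g + y (- g) ≡ 1ℤ + δ m g
    y-skew g = begin
      y g + y (- g)                                              ≡⟨ cong₂ _+_ (y≡H g) (y≡H (- g)) ⟩
      + 𝟙 (lookup H i) + + 𝟙 (lookup H (residue (- g)))          ≡⟨ cong (λ j → + 𝟙 (lookup H i) + + 𝟙 (lookup H j)) (residue-neg g) ⟨
      + 𝟙 (lookup H i) + + 𝟙 (lookup H (-ₘ i))                   ≡⟨ cong₂ (λ a b → + a + + b) ([]ₛ≡𝟙 (lookup H i)) ([]ₛ≡𝟙 (lookup H (-ₘ i))) ⟨
      + ([ lookup H i ]ₛ ℕ.+ [ lookup H (-ₘ i) ]ₛ)               ≡⟨ cong +_ (H-skew i) ⟩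
      1ℤ + + 𝟙 (toℕ i ℕ.≡ᵇ 0)                                    ≡⟨ cong (_+_ 1ℤ) (δ-toℕ i) ⟨
      1ℤ + δ m (+ toℕ i)                                         ≡⟨ cong (_+_ 1ℤ) (periodic-≡ (δ-periodic m) (difference (toℕ-residue g))) ⟩
      1ℤ + δ m g                                                 ∎
      where
      i : Fin m
      i = residue g

    0′ : Fin n
    0′ = fromℕ< (ℕ.m^n>0 p α)

    0∈ : 0′ ∈ Y
    0∈ = 0∈Y 0′ (toℕ-fromℕ< (ℕ.m^n>0 p α))

    multiple∈Y : ∀ i → + m ∣ + toℕ i → i ∈ Y
    multiple∈Y i m∣i = indicator⇒toℕ∈ Y (trans (periodic-≡ y-periodic {+ toℕ i} {+ toℕ 0′} (∣m∣n⇒∣m-n m∣i (subst (λ k → + m ∣ + k) (sym (toℕ-fromℕ< (ℕ.m^n>0 p α))) (divides 0ℤ refl)))) (toℕ∈⇒indicator Y 0∈))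

    -- Both shapes delete the multiples of q, with q = n or q = m. Here m ∣ q keeps the deleted set
    -- inside Y, and q ∣ n makes divisibility by q well defined on residues.
    module Removed (q : ℕ) (+m∣+q : + m ∣ + q) (+q∣+n : + q ∣ + n) (X≡ : ∀ i → (i ∈ X) ⇔ (i ∈ Y × ¬ (+ q ∣ + toℕ i))) where

      X⊂Y : X ⊂ Y
      X⊂Y = (λ {i} i∈X → proj₁ (to (X≡ i) i∈X)) , 0′ , 0∈ , 0∉X 0′ (toℕ-fromℕ< (ℕ.m^n>0 p α))

      ∉X⇒∣ : ∀ {i} → i ∈ Y → i ∉ X → + q ∣ + toℕ i
      ∉X⇒∣ {i} i∈Y i∉X = decidable-stable (+ q ∣? + toℕ i) (λ q∤i → i∉X (from (X≡ i) (i∈Y , q∤i)))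

      -- The set Y∖X consists of the multiples of q, an ideal of ℤ/n, hence is stable under every
      -- multiplication.
      invariant : UnitInvariant (Y ─ X)
      invariant u _ i i∈ = x∈p∧x∉q⇒x∈p─q (multiple∈Y (u *ₘ i) (∣-trans +m∣+q q∣ui)) (λ ui∈X → proj₂ (to (X≡ (u *ₘ i)) ui∈X) q∣ui)
        where
        q∣i : + q ∣ + toℕ i
        q∣i = ∉X⇒∣ (p─q⊆p Y X i∈) (∈─⇒∉ Y X i∈)
        q∣ui : + q ∣ + toℕ (u *ₘ i)
        q∣ui = ∣m+n∣n⇒∣m (∣-trans +q∣+n (difference (toℕ-*ₘ u i))) (∣m⇒∣-m (∣n⇒∣m*n (+ toℕ u) q∣i))

      x≡ : ∀ g → x g ≡ y g + - δ q g
      x≡ g = binary-ext (indicator-binary X g) (difference-binary (δ-binary q g)) forth back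
        where
        q∣residue : + q ∣ g → + q ∣ + toℕ (residue {n} g)
        q∣residue d = subst (+ q ∣_) (cancel (+ toℕ (residue {n} g)) g) (∣m∣n⇒∣m+n (∣-trans +q∣+n (difference (toℕ-residue g))) d)
          where
          cancel : ∀ a b → a - b + b ≡ a
          cancel = solve-∀
        residue∣q : + q ∣ + toℕ (residue {n} g) → + q ∣ g
        residue∣q d = subst (+ q ∣_) (cancel (+ toℕ (residue {n} g)) g) (∣m∣n⇒∣m-n d (∣-trans +q∣+n (difference (toℕ-residue g))))
          where
          cancel : ∀ a b → a - (a - b) ≡ b
          cancel = solve-∀
        δ⇒y : δ q g ≡ 1ℤ → y g ≡ 1ℤ
        δ⇒y e = ∈⇒indicator Y g (multiple∈Y (residue g) (∣-trans +m∣+q (q∣residue (δ≡1⇒∣ e))))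
        difference-binary : δ q g ≡ 0ℤ ⊎ δ q g ≡ 1ℤ → y g + - δ q g ≡ 0ℤ ⊎ y g + - δ q g ≡ 1ℤ
        difference-binary (inj₁ e) = subst (λ u → u ≡ 0ℤ ⊎ u ≡ 1ℤ) (sym (trans (cong (λ u → y g + - u) e) (+-identityʳ (y g)))) (indicator-binary Y g)
        difference-binary (inj₂ e) = inj₁ (cong₂ (λ u v → u + - v) (δ⇒y e) e)
        forth : x g ≡ 1ℤ → y g + - δ q g ≡ 1ℤ
        forth xg = let g∈Y , q∤ = to (X≡ (residue g)) (indicator⇒∈ X g xg) in
          cong₂ (λ u v → u + - v) (∈⇒indicator Y g g∈Y) (δ-no (q∤ ∘ q∣residue))
        back : y g + - δ q g ≡ 1ℤ → x g ≡ 1ℤ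
        back e = case-δ (δ-binary q g)
          where
          case-δ : δ q g ≡ 0ℤ ⊎ δ q g ≡ 1ℤ → x g ≡ 1ℤ
          case-δ (inj₂ f) = case trans (sym e) (cong₂ (λ u v → u + - v) (δ⇒y f) f) of λ ()
          case-δ (inj₁ f) = ∈⇒indicator X g (from (X≡ (residue g))
            ( indicator⇒∈ Y g (trans (sym (trans (cong (λ u → y g + - u) f) (+-identityʳ (y g)))) e)
            , λ q∣ → case trans (sym f) (δ-yes (residue∣q q∣)) of λ ()))

    open Converse {m} {n} (p ℕ.^ (α ℕ.∸ γ) , power-quotient p γ≤α) (prime-power-∤1 pp 1≤γ) y-periodic (indicator-binary Y) y-skew

    dsrg : Solution x → IsDSRG (allD n) _≟D_ (DihArc X Y)
    dsrg S = k , μ , λ′ , t , equations⇒dsrg X Y {k} {μ} {λ′} {t} 0<t t<k degree equations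
      where open Solution S

    conclusion : ((∀ i → (i ∈ X) ⇔ (i ∈ Y × toℕ i ≢ 0)) ⊎ (∀ i → (i ∈ X) ⇔ (i ∈ Y × ¬ (m ℕ.∣ toℕ i)))) →
      IsDSRG (allD n) _≟D_ (DihArc X Y) × X ⊂ Y × UnitInvariant (Y ─ X)
    conclusion (inj₁ X≡) = dsrg (remove-identity x≡) , X⊂Y , invariant
      where open Removed n +m∣+n ∣-refl (λ i → mk⇔ (λ i∈X → proj₁ (to (X≡ i) i∈X) , proj₂ (to (X≡ i) i∈X) ∘ ∣toℕ⇒≡0)
                                                   (λ (i∈Y , n∤i) → from (X≡ i) (i∈Y , n∤i ∘ toℕ≡0⇒∣)))
    conclusion (inj₂ X≡) = dsrg (remove-subgroup x≡) , X⊂Y , invariant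
      where open Removed m ∣-refl +m∣+n (λ i → mk⇔ (λ i∈X → proj₁ (to (X≡ i) i∈X) , proj₂ (to (X≡ i) i∈X) ∘ ∣⇒∣ᵤ)
                                                   (λ (i∈Y , m∤i) → from (X≡ i) (i∈Y , m∤i ∘ ∣ᵤ⇒∣)))

open import Defs
open import Data.Nat using (ℕ; _^_; _≤_; _+_; _≡ᵇ_)
open import Data.Nat.Primality using (Prime)
open import Data.Nat.Divisibility using (_∣_)
open import Data.Fin using (Fin; toℕ)
open import Data.Fin.Subset using (Subset; _∈_; _∉_; _⊂_; _─_)
open import Data.Vec using (lookup)
open import Data.Product using (_×_; Σ; ∃)
open import Data.Sum using (_⊎_)
open import Function.Bundles using (_⇔_)
open import Relation.Nullary using (¬_)
open import Relation.Binary.PropositionalEquality using (_≡_; _≢_)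
open import Data.Product using (_,_)
open import Function.Bundles using (mk⇔)

theorem7p2 : (p α : ℕ) → Prime p → ¬ (2 ∣ p) → 1 ≤ α →
  (X Y : Subset (p ^ α)) →
  (∀ y → toℕ y ≡ 0 → y ∉ X) →
  (∀ y → toℕ y ≡ 0 → y ∈ Y) →
  ((IsDSRG (allD (p ^ α)) _≟D_ (DihArc X Y)
      × X ⊂ Y
      × (∀ u → IsUnit u → ∀ y → y ∈ Y ─ X → (u *ₘ y) ∈ Y ─ X))
   ⇔
   ∃ λ γ → 1 ≤ γ × γ ≤ α × Σ (Subset (p ^ γ)) λ H →
     (∀ z → [ lookup H z ]ₛ + [ lookup H (-ₘ z) ]ₛ ≡ 1 + 𝟙 (toℕ z ≡ᵇ 0))
     × (∀ y → (y ∈ Y) ⇔ InPreimage H y)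
     × ((∀ y → (y ∈ X) ⇔ (y ∈ Y × toℕ y ≢ 0))
        ⊎ (∀ y → (y ∈ X) ⇔ (y ∈ Y × ¬ ((p ^ γ) ∣ toℕ y)))))
theorem7p2 p α pp 2∤p 1≤α X Y 0∉X 0∈Y = mk⇔
  (λ (dsrg , (X⊆Y , _) , invariant) →
    let open Dihedral.Forward pp 2∤p α X Y 0∉X 0∈Y dsrg X⊆Y invariant
        open Conclusion classified
    in γ , 1≤γ , γ≤α , H , H-skew , Y-preimage , X-shape)
  (λ (γ , 1≤γ , γ≤α , H , H-skew , Y-preimage , X-shape) →
    Dihedral.Backward.conclusion pp 1≤γ γ≤α X Y 0∉X 0∈Y H H-skew Y-preimage X-shape)
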